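{- Let $m\ge 3$ and let $\chi$ be a primitive Dirichlet character modulo $2^m$. Let $q\ge 1$ be odd and $n\ge 1$. If $k\ge 0$ is an integer having the opposite parity to $\chi$ (i.e. $\chi(-1)\neq(-1)^k$), then $$\mathcal{L}_{k+2^n q,\chi}-\mathcal{L}_{k,\chi}\equiv \frac{2^{n+2}}{1-\bar\chi(5)}\cdot \mathcal{L}_{d,\chi}\pmod{2^{n+3}},$$ where $d\in\{0,1\}$ satisfies $k\equiv d\pmod 2$. In particular, for integers $k,l\ge 0$ both having the opposite parity to $\chi$, we have $\mathcal{L}_{k,\chi}\equiv \mathcal{L}_{l,\chi}\pmod{2^{n+2}}$ if and only if $k\equiv l\pmod{2^n}$.
   Context: For a Dirichlet character $\chi$ modulo $N$, the generalized Bernoulli numbers $B_{k,\chi}$ are defined by $\sum_{k\ge0}\frac{B_{k,\chi}}{k!}t^k=\sum_{a=1}^{N}\chi(a)\frac{te^{at}}{e^{Nt}-1}$. For an integer $k\ge 0$ with $\chi(-1)\ne(-1)^k$, $L(-k,\chi)$ denotes the value at $s=-k$ of the (analytically continued) Dirichlet $L$-function $L(s,\chi)=\sum_{n\ge1}\chi(n)n^{ -s}$; it equals $-B_{k+1,\chi}/(k+1)$. For $\chi$ with conductor $2^m$, $m\ge3$, define $\mathcal{L}_{k,\chi}=(1-\chi(5))L(-k,\chi)$. $\bar\chi$ is the complex conjugate character. For numbers $x,y$ in the cyclotomic field generated by the values of $\chi$ and a prime $p$, $x\equiv y\pmod{p^r}$ means that $(x-y)/p^r$ is $p$-integral, i.e.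 lies in the localization of the ring of integers at (all primes above) $p$. -}

module Defs where

open import Data.Bool.Base using (if_then_else_)
open import Data.Nat.Base as ℕ using (ℕ; zero; suc; _∸_; _≤ᵇ_; _≡ᵇ_; _!; _<_; NonZero)
open import Data.Nat.Properties using (_!≢0; m^n≢0)
open import Data.Nat.Divisibility using () renaming (_∣_ to _∣ℕ_)
open import Data.Nat.Coprimality using (Coprime)
open import Data.Integer.Base as ℤ using (ℤ; +_; -[1+_]; ∣_∣)
open import Data.Integer.Divisibility using () renaming (_∣_ to _∣ℤ_)
open import Data.Rational.Base as ℚ using (ℚ; 0ℚ; 1ℚ; ↧ₙ_)
open import Data.Fin.Base using (Fin; toℕ)
open import Data.Vec.Base as Vec using (Vec; []; _∷_; tabulate; zipWith)
open import Data.Vec.Relation.Unary.All using (All)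
open import Data.List.Base as List using (List; upTo; foldr)
open import Data.Product.Base using (_×_)
open import Relation.Binary.PropositionalEquality using (_≡_; _≢_)
open import Relation.Nullary.Negation using (¬_)

-- The cyclotomic field  K_M = ℚ(ζ_{2M}) = ℚ[x]/(x^M + 1)   (M a power of 2),
-- elements represented by their coordinates in the power basis
-- 1, ζ, …, ζ^{M-1}  (ζ = class of x, a primitive 2M-th root of unity).

K : ℕ → Set
K M = Vec ℚ M

coord : ∀ {M} → K M → ℕ → ℚ
coord []       _       = 0ℚ
coord (x ∷ xs) zero    = x
coord (x ∷ xs) (suc i) = coord xs i

zeroK : ∀ {M} → K M
zeroK = tabulate (λ _ → 0ℚ)

embed : ∀ {M} → ℚ → K M
embed r = tabulate (λ j → if toℕ j ≡ᵇ 0 then r else 0ℚ)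

oneK : ∀ {M} → K M
oneK = embed 1ℚ

infixl 6 _⊕_ _⊖_
infixl 7 _⊛_ _•_

_⊕_ : ∀ {M} → K M → K M → K M
_⊕_ = zipWith ℚ._+_

_⊖_ : ∀ {M} → K M → K M → K M
_⊖_ = zipWith ℚ._-_

_•_ : ∀ {M} → ℚ → K M → K M
r • v = Vec.map (r ℚ.*_) v

sumQ : List ℚ → ℚ
sumQ = foldr ℚ._+_ 0ℚ

sumK : ∀ {M} → List (K M) → K M
sumK = foldr _⊕_ zeroK

-- multiplication in ℚ[x]/(x^M+1):  x^(i+j) = - x^(i+j-M)  when i+j ≥ M
_⊛_ : ∀ {M} → K M → K M → K M
_⊛_ {M} a b = tabulate λ k → sumQ (List.map (λ i →
   coord a i ℚ.* (if i ≤ᵇ toℕ k then coord b (toℕ k ∸ i)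
                                  else ℚ.- coord b ((M ℕ.+ toℕ k) ∸ i)))
   (upTo M))

-- complex conjugation  ζ ↦ ζ⁻¹ = - ζ^{M-1}, i.e.  ζ^j ↦ - ζ^{M-j} (1 ≤ j < M)
conj : ∀ {M} → K M → K M
conj {M} v = tabulate λ j →
  if toℕ j ≡ᵇ 0 then coord v 0 else ℚ.- coord v (M ∸ toℕ j)

-- 2-integrality: the ring of integers of ℚ(ζ_{2M}) is ℤ[ζ] with power basis
-- 1, ζ, …, ζ^{M-1}; so x lies in the localisation at 2 iff every coordinate
-- has odd denominator.
TwoIntegral : ∀ {M} → K M → Set
TwoIntegral v = All (λ c → ¬ (2 ∣ℕ (↧ₙ c))) v

CongMod2^ : ∀ {M} → K M → K M → ℕ → Set
CongMod2^ x y r = TwoIntegral ((ℚ._/_ (+ 1) (2 ℕ.^ r) {{m^n≢0 2 r}}) • (x ⊖ y))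

-- Dirichlet characters modulo 2^m, valued in K_{2^{m-3}} = ℚ(ζ_{2^{m-2}})
-- (which contains all values of any character modulo 2^m, m ≥ 3).

Mdeg : ℕ → ℕ
Mdeg m = 2 ℕ.^ (m ∸ 3)

record IsDirichletChar {M : ℕ} (N : ℕ) (χ : ℤ → K M) : Set where
  field
    periodic      : ∀ a → χ (a ℤ.+ + N) ≡ χ a
    multiplicative : ∀ a b → χ (a ℤ.* b) ≡ χ a ⊛ χ b
    at-one        : χ (+ 1) ≡ oneK
    nonunit-zero  : ∀ a → ¬ Coprime ∣ a ∣ N → χ a ≡ zeroK
    unit-nonzero  : ∀ a → Coprime ∣ a ∣ N → χ a ≢ zeroK

IsPrimitive : ∀ {M : ℕ} (N : ℕ) (χ : ℤ → K M) → Set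
IsPrimitive N χ = ∀ d → d ∣ℕ N → d < N →
  ¬ (∀ a → Coprime ∣ a ∣ N → (+ d) ∣ℤ (a ℤ.- + 1) → χ a ≡ oneK)

-- Generalised Bernoulli numbers, characterised by their generating function
--   Σ_k B_{k,χ} t^k / k!  =  Σ_{a=1}^N χ(a) t e^{at} / (e^{Nt} - 1),
-- i.e. (Σ_k B_{k,χ} t^k/k!)(e^{Nt} - 1) = Σ_{a=1}^N χ(a) t e^{at};
-- comparing coefficients of t^{n+1} (the t^0 coefficients are both 0):
--   Σ_{j=0}^{n} (B_j / j!) · N^{n+1-j}/(n+1-j)!  =  Σ_{a=1}^N χ(a) a^n / n!

frac : ℕ → (d : ℕ) → .{{NonZero d}} → ℚ
frac a d = ℚ._/_ (+ a) d

IsGenBernoulli : ∀ {M : ℕ} (N : ℕ) (χ : ℤ → K M) (B : ℕ → K M) → Set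
IsGenBernoulli N χ B = ∀ n →
  sumK (List.map (λ j →
          (frac 1 (j !) {{j !≢0}} ℚ.* frac (N ℕ.^ (suc n ∸ j)) ((suc n ∸ j) !) {{(suc n ∸ j) !≢0}})
            • B j)
        (upTo (suc n)))
  ≡ sumK (List.map (λ i → frac (suc i ℕ.^ n) (n !) {{n !≢0}} • χ (+ suc i)) (upTo N))

-- L(-k, χ) = - B_{k+1,χ} / (k+1)
Lneg : ∀ {M} → (ℕ → K M) → ℕ → K M
Lneg B k = (ℚ.- frac 1 (suc k)) • B (suc k)

calL : ∀ {M} → (ℤ → K M) → (ℕ → K M) → ℕ → K M
calL χ B k = (oneK ⊖ χ (+ 5)) ⊛ Lneg B k

signQ : ℕ → ℚ
signQ zero    = 1ℚ
signQ (suc k) = ℚ.- signQ k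

OppParity : ∀ {M} → (ℤ → K M) → ℕ → Set
OppParity χ k = χ -[1+ 0 ] ≢ embed (signQ k)

{-# OPTIONS --safe #-}

-- Put M = 2^(m-3), u = χ(5), π = 1 - u and β = 1 + u + ⋯ + u^(M-1), so that u^M = -1 and πβ = 2, and
-- let Λ be the linear functional on polynomials with Λ(xᵏ) = L(-k, χ).  The generating function of the
-- B_{k,χ} says Λ(f(x + 8M) - f(x)) = -Σ_{a<8M} χ(a) f(a); since χ(a + 4M) = -χ(a), this improves to
-- Λ(f(x + 4M) + f(x)) = Σ_{a<4M} χ(a) f(a), and pairing a with 4M - a expresses the right-hand side by
-- P(f) = Σ_{a<2M} χ(a) f(a).  Expanding f(x ± 4M) yields L(-k, χ) ≡ P(xᵏ) (mod 2β).  Expanding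
-- (x + 4M)^(2ⁿ) ≡ x^(2ⁿ) + 2ⁿ⁺² M x^(2ⁿ-1) (mod 2ⁿ⁺³) yields L(-k-2ⁿ, χ) - L(-k, χ) modulo 2ⁿ⁺²β in
-- terms of P.  Modulo 2 the odd a < 2M may be replaced by the powers 5ⁱ, i < M, so P(xᵏ) ≡ Σ uⁱ = β and
-- P(x^(k+2ⁿ) - xᵏ) ≡ 2ⁿ⁺² Σ i uⁱ (mod 2ⁿ⁺³).  Together L(-k-2ⁿ, χ) - L(-k, χ) ≡ 2ⁿ⁺¹ β² (mod 2ⁿ⁺²β),
-- from which both claims follow after multiplication by π, because π is not a 2-adic unit.
module Submission where

open import Defs
open import Level using (0ℓ)
open import Algebra.Bundles using (CommutativeRing)
open import Algebra.Solver.Ring.AlmostCommutativeRing using (fromCommutativeRing; _-Raw-AlmostCommutative⟶_)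
import Algebra.Solver.Ring as RingSolver
open import Algebra.Structures using (IsCommutativeRing)
open import Data.Bool.Base using (true; false; if_then_else_)
open import Data.Empty using (⊥-elim)
open import Data.Fin.Base using (toℕ)
open import Data.Integer.Base as ℤ using (ℤ; +_; -[1+_])
open import Data.Integer.Divisibility using () renaming (_∣_ to _∣ℤ_)
import Data.Integer.Divisibility.Signed as Signed
import Data.Integer.Properties as ℤₚ
import Data.Integer.Solver as ℤSolver
open ℤSolver.+-*-Solver using () renaming
  (solve to solveℤ; con to conℤ; _:=_ to _:=ℤ_; _:+_ to _:+ℤ_; _:*_ to _:*ℤ_; :-_ to :-ℤ_)
open import Data.List.Base as List using (upTo; applyUpTo)
open import Data.Maybe.Base as Maybe using (Maybe)
open import Data.Nat.Base as ℕ using (ℕ; zero; suc; z≤n; s≤s; _≤_; _<_; _!; _∸_; _%_; _/_; _≤ᵇ_; _≡ᵇ_)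
open import Data.Nat.Combinatorics
  using (_C_; nCn≡1; nCk+nC[k+1]≡[n+1]C[k+1]; k![n∸k]!∣n!; k>n⇒nCk≡0; nCk≡n!/k![n-k]!)
open import Data.Nat.Coprimality as Coprime using (Coprime; coprime-divisor)
open import Data.Nat.Divisibility as ℕ∣ using (divides) renaming (_∣_ to _∣ℕ_)
open import Data.Nat.DivMod using (m/n*n≡m; m≡m%n+[m/n]*n)
open import Data.Nat.Induction using (<-rec)
open import Data.Nat.Primality using (prime[2]; euclidsLemma)
import Data.Nat.Properties as ℕₚ
open import Data.Nat.Properties using (_!≢0)
import Data.Nat.Solver as ℕSolver
open ℕSolver.+-*-Solver using () renaming
  (solve to solveℕ; con to conℕ; _:=_ to _:=ℕ_; _:+_ to _:+ℕ_; _:*_ to _:*ℕ_)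
open import Data.Product.Base using (_×_; _,_; ∃; proj₁; proj₂)
open import Data.Rational.Base as ℚ using (ℚ; mkℚ; 0ℚ; 1ℚ; ½; ↥_; ↧_; ↧ₙ_; fromℚᵘ)
import Data.Rational.Properties as ℚₚ
import Data.Rational.Solver as ℚSolver
open ℚSolver.+-*-Solver using () renaming (solve to solveℚ; _:=_ to _:=ℚ_; _:+_ to _:+ℚ_; _:*_ to _:*ℚ_)
open import Data.Rational.Unnormalised.Base as ℚᵘ using (mkℚᵘ; *≡*)
import Data.Rational.Unnormalised.Properties as ℚᵘₚ
open import Data.Sum.Base using (_⊎_; inj₁; inj₂; [_,_])
open import Data.Vec.Base as Vec using ([]; _∷_; tabulate)
open import Data.Vec.Properties using (≡-dec)
open import Data.Vec.Relation.Unary.All using ([]; _∷_)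
open import Function.Base using (_∘_; id)
open import Function.Bundles using (_⇔_; mk⇔; Equivalence)
open import Relation.Binary.Definitions using (tri<; tri≈; tri>)
open import Relation.Binary.PropositionalEquality hiding ([_])
open import Relation.Nullary using (¬_; Dec; yes; no)
open import Relation.Nullary.Decidable using (dec⇒maybe)

-- Congruences are carried modulo multiples of β because β² is divisible by 2 as soon as M ≥ 2:
-- modulo 2ⁿ⁺² alone, the main term 2ⁿ⁺¹ β² would be invisible. Expanding f(x + 4M) mixes exponents
-- of both parities, so the inductions must also control L(-k, χ) when k has the parity of χ. Those
-- values are in fact 0, but divisibility by 2β is all that gets used. Integrality of the L-values
-- is never presupposed: the factor 4 in the shift 4M outweighs the factor 2 on the left of L(-k, χ)
-- + Λ((x + 4M)ᵏ). A second obstacle is the coefficient ring, which is given as ℚ[x]/(x^M + 1) and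
-- not known to be a field. Yet u^M = -1 needs ±1 to be the only square roots of 1, and integrality
-- of χ(a) needs the 2M-th roots of unity to be the powers of ζ. Both follow once zero divisors are
-- excluded. This is done by descent along 1 - ζ, whose residue field is 𝔽₂, and not through
-- irreducibility of x^M + 1. The exponent n ≥ 1 of the theorem mostly appears below as `suc n`.

Odd : ℕ → Set
Odd n = ¬ 2 ∣ℕ n

odd-* : ∀ {m n} → Odd m → Odd n → Odd (m ℕ.* n)
odd-* {m} {n} om on h = [ om , on ] (euclidsLemma m n prime[2] h)

odd-coprime-2^ : ∀ {n} → Odd n → ∀ k → Coprime n (2 ℕ.^ k)
odd-coprime-2^ on zero    (_ , d∣1) = ℕ∣.∣1⇒≡1 d∣1
odd-coprime-2^ {n} on (suc k) {d} (d∣n , d∣2^) = odd-coprime-2^ on k (d∣n , coprime-divisor d-2 d∣2^)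
  where
  d-2 : Coprime d 2
  d-2 {zero}        (_   , e∣2) = ⊥-elim (ℕₚ.0≢1+n (sym (ℕ∣.0∣⇒≡0 e∣2)))
  d-2 {suc zero}    (_   , e∣2) = refl
  d-2 {suc (suc zero)} (e∣d , e∣2) = ⊥-elim (on (ℕ∣.∣-trans e∣d d∣n))
  d-2 {suc (suc (suc e))} (_ , e∣2) = ⊥-elim (ℕₚ.<⇒≱ (s≤s (s≤s (s≤s z≤n))) (ℕ∣.∣⇒≤ e∣2))

odd-1 : Odd 1
odd-1 h = ℕₚ.<⇒≱ (s≤s (s≤s z≤n)) (ℕ∣.∣⇒≤ h)

parity : ∀ n → ∃ λ k → n ≡ 2 ℕ.* k ⊎ n ≡ suc (2 ℕ.* k)
parity zero    = 0 , inj₁ refl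
parity (suc n) with parity n
... | k , inj₁ e = k , inj₂ (cong suc e)
... | k , inj₂ e = suc k , inj₁ (trans (cong suc e) (cong suc (sym (ℕₚ.+-suc k (k ℕ.+ 0)))))

parityℤ : ∀ z → ∃ λ k → z ≡ + 2 ℤ.* k ⊎ z ≡ + 1 ℤ.+ + 2 ℤ.* k
parityℤ (+ n) with parity n
... | k , inj₁ e = + k , inj₁ (trans (cong (+_) e) (ℤₚ.pos-* 2 k))
... | k , inj₂ e = + k , inj₂ (trans (cong (+_) e) (cong (λ x → + 1 ℤ.+ x) (ℤₚ.pos-* 2 k)))
parityℤ -[1+ n ] with parity (suc n)
... | k , inj₁ e = ℤ.- (+ k) , inj₁ (trans (cong (λ m → ℤ.- (+ m)) e) (trans (cong ℤ.-_ (ℤₚ.pos-* 2 k)) (ℤₚ.neg-distribʳ-* (+ 2) (+ k))))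
... | k , inj₂ e = ℤ.- (+ suc k) , inj₂ (trans (cong (λ m → ℤ.- (+ m)) e) (begin
  ℤ.- (+ suc (2 ℕ.* k)) ≡⟨ cong (λ x → ℤ.- (+ 1 ℤ.+ x)) (ℤₚ.pos-* 2 k) ⟩
  ℤ.- (+ 1 ℤ.+ + 2 ℤ.* + k) ≡⟨ solveℤ 1 (λ k → :-ℤ (conℤ (+ 1) :+ℤ conℤ (+ 2) :*ℤ k) :=ℤ conℤ (+ 1) :+ℤ conℤ (+ 2) :*ℤ (:-ℤ (conℤ (+ 1) :+ℤ k))) refl (+ k) ⟩
  + 1 ℤ.+ + 2 ℤ.* (ℤ.- (+ 1 ℤ.+ + k))      ∎))
  where
  open ≡-Reasoning

n<2^n : ∀ n → n < 2 ℕ.^ n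
n<2^n zero    = s≤s z≤n
n<2^n (suc n) = ℕₚ.≤-trans (s≤s (n<2^n n)) (ℕₚ.≤-trans (ℕₚ.+-monoˡ-≤ (2 ℕ.^ n) (ℕₚ.m^n>0 2 n)) (ℕₚ.≤-reflexive (cong (2 ℕ.^ n ℕ.+_) (sym (ℕₚ.+-identityʳ (2 ℕ.^ n))))))

-- Powers of 5 and of odd numbers modulo powers of 2

2^_∸1 : ℕ → ℕ
2^ zero  ∸1 = 0
-- Arranged so that `suc 2^ suc n ∸1` unfolds to the sum of two copies of `suc 2^ n ∸1`, as the
-- proofs by repeated squaring require.
2^ suc n ∸1 = 2^ n ∸1 ℕ.+ suc 2^ n ∸1

suc-2^∸1 : ∀ n → suc 2^ n ∸1 ≡ 2 ℕ.^ n
suc-2^∸1 zero    = refl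
suc-2^∸1 (suc n) = cong₂ ℕ._+_ (suc-2^∸1 n) (trans (suc-2^∸1 n) (sym (ℕₚ.+-identityʳ _)))

-- 2 (half5^ i) + 1 = 5ⁱ
half5^ : ℕ → ℕ
half5^ zero    = 0
half5^ (suc i) = 5 ℕ.* half5^ i ℕ.+ 2

half5^-+ : ∀ m i → half5^ (m ℕ.+ i) ≡ half5^ m ℕ.* (2 ℕ.* half5^ i ℕ.+ 1) ℕ.+ half5^ i
half5^-+ zero    i = refl
half5^-+ (suc m) i = trans (cong (λ x → 5 ℕ.* x ℕ.+ 2) (half5^-+ m i))
  (solveℕ 2 (λ x y → conℕ 5 :*ℕ (x :*ℕ (conℕ 2 :*ℕ y :+ℕ conℕ 1) :+ℕ y) :+ℕ conℕ 2
       :=ℕ (conℕ 5 :*ℕ x :+ℕ conℕ 2) :*ℕ (conℕ 2 :*ℕ y :+ℕ conℕ 1) :+ℕ y) refl (half5^ m) (half5^ i))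

-- In terms of 5 this is 5^(2^r) = 1 + 2^(r+2) · odd. Squaring 1 + 2y gives 1 + 2 · 2y(1 + y), and 1
-- + y is odd because y is even.
half5^-2^ : ∀ r → ∃ λ s → half5^ (2 ℕ.^ r) ≡ 2 ℕ.^ suc r ℕ.* (1 ℕ.+ 2 ℕ.* s)
half5^-2^ zero    = 0 , refl
half5^-2^ (suc r) with half5^-2^ r
... | s , eq = s ℕ.+ 2 ℕ.^ r ℕ.* (1 ℕ.+ 2 ℕ.* s) ℕ.* (1 ℕ.+ 2 ℕ.* s) , (begin
  half5^ (m ℕ.+ (m ℕ.+ 0)) ≡⟨ cong (λ k → half5^ (m ℕ.+ k)) (ℕₚ.+-identityʳ m) ⟩
  half5^ (m ℕ.+ m) ≡⟨ half5^-+ m m ⟩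
  half5^ m ℕ.* (2 ℕ.* half5^ m ℕ.+ 1) ℕ.+ half5^ m  ≡⟨ cong (λ x → x ℕ.* (2 ℕ.* x ℕ.+ 1) ℕ.+ x) eq ⟩
  y ℕ.* (2 ℕ.* y ℕ.+ 1) ℕ.+ y ≡⟨ identity m s ⟩
  2 ℕ.^ suc (suc r) ℕ.* (1 ℕ.+ 2 ℕ.* (s ℕ.+ m ℕ.* (1 ℕ.+ 2 ℕ.* s) ℕ.* (1 ℕ.+ 2 ℕ.* s))) ∎)
  where
  open ≡-Reasoning
  m y : ℕ
  m = 2 ℕ.^ r
  y = 2 ℕ.* m ℕ.* (1 ℕ.+ 2 ℕ.* s)
  identity : ∀ m s → 2 ℕ.* m ℕ.* (1 ℕ.+ 2 ℕ.* s) ℕ.* (2 ℕ.* (2 ℕ.* m ℕ.* (1 ℕ.+ 2 ℕ.* s)) ℕ.+ 1) ℕ.+ 2 ℕ.* m ℕ.* (1 ℕ.+ 2 ℕ.* s)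
           ≡ 2 ℕ.* (2 ℕ.* m) ℕ.* (1 ℕ.+ 2 ℕ.* (s ℕ.+ m ℕ.* (1 ℕ.+ 2 ℕ.* s) ℕ.* (1 ℕ.+ 2 ℕ.* s)))
  identity = solveℕ 2 (λ m s → let o = conℕ 1 :+ℕ conℕ 2 :*ℕ s; y = conℕ 2 :*ℕ m :*ℕ o in
    y :*ℕ (conℕ 2 :*ℕ y :+ℕ conℕ 1) :+ℕ y :=ℕ conℕ 2 :*ℕ (conℕ 2 :*ℕ m) :*ℕ (conℕ 1 :+ℕ conℕ 2 :*ℕ (s :+ℕ m :*ℕ o :*ℕ o))) refl

-- Equivalently 5^(2^r + i) ≡ 5^i + 2^(r+2) (mod 2^(r+3)): multiply 5^(2^r) ≡ 1 + 2^(r+2) by the odd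
-- number 5^i. It supplies the second half of the powers of 5 when r grows by one.
half5^-shift : ∀ r i → ∃ λ s → half5^ (2 ℕ.^ r ℕ.+ i) ≡ s ℕ.* 2 ℕ.^ suc (suc r) ℕ.+ (2 ℕ.^ suc r ℕ.+ half5^ i)
half5^-shift r i with half5^-2^ r
... | s , eq = s ℕ.+ h ℕ.+ 2 ℕ.* s ℕ.* h , (begin
  half5^ (2 ℕ.^ r ℕ.+ i) ≡⟨ half5^-+ (2 ℕ.^ r) i ⟩
  half5^ (2 ℕ.^ r) ℕ.* (2 ℕ.* h ℕ.+ 1) ℕ.+ h   ≡⟨ cong (λ x → x ℕ.* (2 ℕ.* h ℕ.+ 1) ℕ.+ h) eq ⟩
  2 ℕ.* m ℕ.* (1 ℕ.+ 2 ℕ.* s) ℕ.* (2 ℕ.* h ℕ.+ 1) ℕ.+ h ≡⟨ identity m s h ⟩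
  (s ℕ.+ h ℕ.+ 2 ℕ.* s ℕ.* h) ℕ.* (2 ℕ.* (2 ℕ.* m)) ℕ.+ (2 ℕ.* m ℕ.+ h) ∎)
  where
  open ≡-Reasoning
  m h : ℕ
  m = 2 ℕ.^ r
  h = half5^ i
  identity : ∀ m s h → 2 ℕ.* m ℕ.* (1 ℕ.+ 2 ℕ.* s) ℕ.* (2 ℕ.* h ℕ.+ 1) ℕ.+ h
           ≡ (s ℕ.+ h ℕ.+ 2 ℕ.* s ℕ.* h) ℕ.* (2 ℕ.* (2 ℕ.* m)) ℕ.+ (2 ℕ.* m ℕ.+ h)
  identity = solveℕ 3 (λ m s h → conℕ 2 :*ℕ m :*ℕ (conℕ 1 :+ℕ conℕ 2 :*ℕ s) :*ℕ (conℕ 2 :*ℕ h :+ℕ conℕ 1) :+ℕ h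
    :=ℕ (s :+ℕ h :+ℕ conℕ 2 :*ℕ s :*ℕ h) :*ℕ (conℕ 2 :*ℕ (conℕ 2 :*ℕ m)) :+ℕ (conℕ 2 :*ℕ m :+ℕ h)) refl

-- For a = 2b + 1 this is (a² - 1)/8. Its parity is what a^(2ⁿ) retains of a beyond the leading 1.
triangle : ℕ → ℕ
triangle zero    = 0
triangle (suc b) = suc b ℕ.+ triangle b

odd-half5^-ℕ : ∀ i → suc (2 ℕ.* half5^ i) ≡ 5 ℕ.^ i
odd-half5^-ℕ zero    = refl
odd-half5^-ℕ (suc i) = trans (solveℕ 1 (λ h → conℕ 1 :+ℕ conℕ 2 :*ℕ (conℕ 5 :*ℕ h :+ℕ conℕ 2) :=ℕ conℕ 5 :*ℕ (conℕ 1 :+ℕ conℕ 2 :*ℕ h)) refl (half5^ i))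
  (cong (5 ℕ.*_) (odd-half5^-ℕ i))

-- The base case is a² = 1 + 8 · `triangle b`, and each further squaring gains a factor 2. Hence
-- values of characters modulo 8M at odd numbers are 2M-th roots of unity.
odd^2^suc : ∀ b j → ∃ λ s → suc (2 ℕ.* b) ℕ.^ (2 ℕ.^ suc j) ≡ 1 ℕ.+ 8 ℕ.* 2 ℕ.^ j ℕ.* s
odd^2^suc b zero    = triangle b , trans (solveℕ 1 (λ x → x :*ℕ (x :*ℕ conℕ 1) :=ℕ x :*ℕ x) refl (suc (2 ℕ.* b))) (square b)
  where
  square : ∀ b → suc (2 ℕ.* b) ℕ.* suc (2 ℕ.* b) ≡ 1 ℕ.+ 8 ℕ.* triangle b
  square zero    = refl
  square (suc b) = trans (solveℕ 1 (λ b → (conℕ 1 :+ℕ conℕ 2 :*ℕ (conℕ 1 :+ℕ b)) :*ℕ (conℕ 1 :+ℕ conℕ 2 :*ℕ (conℕ 1 :+ℕ b))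
      :=ℕ (conℕ 1 :+ℕ conℕ 2 :*ℕ b) :*ℕ (conℕ 1 :+ℕ conℕ 2 :*ℕ b) :+ℕ conℕ 8 :*ℕ (conℕ 1 :+ℕ b)) refl b)
    (trans (cong (ℕ._+ 8 ℕ.* suc b) (square b))
      (solveℕ 2 (λ b t → conℕ 1 :+ℕ conℕ 8 :*ℕ t :+ℕ conℕ 8 :*ℕ (conℕ 1 :+ℕ b) :=ℕ conℕ 1 :+ℕ conℕ 8 :*ℕ (conℕ 1 :+ℕ b :+ℕ t)) refl b (triangle b)))
odd^2^suc b (suc j) with odd^2^suc b j
... | s , e = s ℕ.+ 4 ℕ.* 2 ℕ.^ j ℕ.* s ℕ.* s , (begin
  x ℕ.^ (2 ℕ.* 2 ℕ.^ suc j) ≡⟨ cong (λ k → x ℕ.^ (2 ℕ.^ suc j ℕ.+ k)) (ℕₚ.+-identityʳ (2 ℕ.^ suc j)) ⟩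
  x ℕ.^ (2 ℕ.^ suc j ℕ.+ 2 ℕ.^ suc j) ≡⟨ ℕₚ.^-distribˡ-+-* x (2 ℕ.^ suc j) (2 ℕ.^ suc j) ⟩
  x ℕ.^ (2 ℕ.^ suc j) ℕ.* x ℕ.^ (2 ℕ.^ suc j)     ≡⟨ cong (λ y → y ℕ.* y) e ⟩
  (1 ℕ.+ 8 ℕ.* 2 ℕ.^ j ℕ.* s) ℕ.* (1 ℕ.+ 8 ℕ.* 2 ℕ.^ j ℕ.* s)
    ≡⟨ solveℕ 2 (λ t s → (conℕ 1 :+ℕ conℕ 8 :*ℕ t :*ℕ s) :*ℕ (conℕ 1 :+ℕ conℕ 8 :*ℕ t :*ℕ s) :=ℕ conℕ 1 :+ℕ conℕ 8 :*ℕ (conℕ 2 :*ℕ t) :*ℕ (s :+ℕ conℕ 4 :*ℕ t :*ℕ s :*ℕ s)) refl (2 ℕ.^ j) s ⟩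
  1 ℕ.+ 8 ℕ.* 2 ℕ.^ suc j ℕ.* (s ℕ.+ 4 ℕ.* 2 ℕ.^ j ℕ.* s ℕ.* s) ∎)
  where
  open ≡-Reasoning
  x : ℕ
  x = suc (2 ℕ.* b)

nC0≡1 : ∀ n → n C 0 ≡ 1
nC0≡1 zero    = refl
nC0≡1 (suc n) = refl

nCk*k![n∸k]!≡n! : ∀ {n k} → k ≤ n → (n C k) ℕ.* (k ! ℕ.* (n ∸ k) !) ≡ n !
nCk*k![n∸k]!≡n! {n} {k} k≤n = trans (cong (ℕ._* (k ! ℕ.* (n ∸ k) !)) (nCk≡n!/k![n-k]! k≤n))
  (m/n*n≡m {{ℕₚ.m*n≢0 (k !) ((n ∸ k) !) {{k !≢0}} {{(n ∸ k) !≢0}}}} (k![n∸k]!∣n! k≤n))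

-- Int stands for the localisation at 2 of a ring of integers.
record DyadicRing : Set₁ where
  infixl 6 _+_
  infixl 7 _*_
  infix  8 -_
  infix  9 #_
  field
    Carrier : Set
    _+_ _*_ : Carrier → Carrier → Carrier
    -_      : Carrier → Carrier
    #_      : ℤ → Carrier
    isCommutativeRing : IsCommutativeRing _≡_ _+_ _*_ -_ (# (+ 0)) (# (+ 1))
    #-+     : ∀ a b → # (a ℤ.+ b) ≡ # a + # b
    #-*     : ∀ a b → # (a ℤ.* b) ≡ # a * # b
    #-neg   : ∀ a → # (ℤ.- a) ≡ - (# a)
    inverse : ∀ n → ∃ λ x → x * # (+ suc n) ≡ # (+ 1)
    Int     : Carrier → Set
    Int-+   : ∀ {x y} → Int x → Int y → Int (x + y)
    Int-*   : ∀ {x y} → Int x → Int y → Int (x * y)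
    Int-#   : ∀ a → Int (# a)

-- Divisibility with 2-integral quotients

module Dyadic (R : DyadicRing) where
  open DyadicRing R public
  open IsCommutativeRing isCommutativeRing public
    using (+-assoc; +-comm; *-assoc; *-comm; +-identityˡ; +-identityʳ; *-identityˡ; *-identityʳ
          ; distribˡ; distribʳ; zeroˡ; zeroʳ; -‿inverseˡ; -‿inverseʳ)

  commutativeRing : CommutativeRing 0ℓ 0ℓ
  commutativeRing = record { isCommutativeRing = isCommutativeRing }

  #-homomorphism : ℤ.+-*-rawRing -Raw-AlmostCommutative⟶ fromCommutativeRing commutativeRing
  #-homomorphism = record { ⟦_⟧ = #_ ; +-homo = #-+ ; *-homo = #-* ; -‿homo = #-neg ; 0-homo = refl ; 1-homo = refl }

  #-equal? : ∀ a b → Maybe (# a ≡ # b)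
  #-equal? a b = Maybe.map (cong #_) (dec⇒maybe (a ℤₚ.≟ b))

  module Solver = RingSolver ℤ.+-*-rawRing (fromCommutativeRing commutativeRing) #-homomorphism #-equal?
  open Solver public using (solve; _:=_; con; _:+_; _:*_; _:-_; :-_)

  infixl 6 _-_
  _-_ : Carrier → Carrier → Carrier
  x - y = x + (- y)

  infix 4 _∣_
  -- Only the quotient has to be integral, not x, so divisibility can be asserted of L-values whose
  -- integrality is still unknown.
  _∣_ : Carrier → Carrier → Set
  c ∣ x = ∃ λ r → Int r × x ≡ c * r

  0# 1# 2# : Carrier
  0# = # (+ 0)
  1# = # (+ 1)
  2# = # (+ 2)

  infixr 8 _^_
  _^_ : Carrier → ℕ → Carrier
  x ^ zero  = 1#
  x ^ suc n = x * x ^ n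

  Int-neg : ∀ {x} → Int x → Int (- x)
  Int-neg {x} ix = subst Int (solve 1 (λ x → con -[1+ 0 ] :* x := :- x) refl x) (Int-* (Int-# -[1+ 0 ]) ix)

  Int-- : ∀ {x y} → Int x → Int y → Int (x - y)
  Int-- ix iy = Int-+ ix (Int-neg iy)

  Int-^ : ∀ {x} → Int x → ∀ n → Int (x ^ n)
  Int-^ ix zero    = Int-# (+ 1)
  Int-^ ix (suc n) = Int-* ix (Int-^ ix n)

  ∣-refl : ∀ {c} → c ∣ c
  ∣-refl {c} = 1# , Int-# _ , solve 1 (λ c → c := c :* con (+ 1)) refl c

  ∣-0 : ∀ {c} → c ∣ 0#
  ∣-0 {c} = 0# , Int-# _ , solve 1 (λ c → con (+ 0) := c :* con (+ 0)) refl c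

  ∣-+ : ∀ {c x y} → c ∣ x → c ∣ y → c ∣ x + y
  ∣-+ {c} (r , ir , refl) (s , is , refl) = r + s , Int-+ ir is , sym (distribˡ c r s)

  ∣-neg : ∀ {c x} → c ∣ x → c ∣ - x
  ∣-neg {c} (r , ir , refl) = - r , Int-neg ir , solve 2 (λ c r → :- (c :* r) := c :* :- r) refl c r

  ∣-- : ∀ {c x y} → c ∣ x → c ∣ y → c ∣ x - y
  ∣-- p q = ∣-+ p (∣-neg q)

  ∣-*ˡ : ∀ {c x y} → Int y → c ∣ x → c ∣ y * x
  ∣-*ˡ {c} {y = y} iy (r , ir , refl) =
    y * r , Int-* iy ir , solve 3 (λ c y r → y :* (c :* r) := c :* (y :* r)) refl c y r

  ∣-*ʳ : ∀ {c x y} → Int y → c ∣ x → c ∣ x * y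
  ∣-*ʳ {x = x} {y} iy p = subst (_ ∣_) (*-comm y x) (∣-*ˡ iy p)

  *-mono-∣ : ∀ {c d x y} → c ∣ x → d ∣ y → c * d ∣ x * y
  *-mono-∣ {c} {d} (r , ir , refl) (s , is , refl) =
    r * s , Int-* ir is , solve 4 (λ c d r s → c :* r :* (d :* s) := c :* d :* (r :* s)) refl c d r s

  ∣-trans : ∀ {c d x} → c ∣ d → d ∣ x → c ∣ x
  ∣-trans {c} (r , ir , refl) (s , is , refl) = r * s , Int-* ir is , *-assoc c r s

  Int⇒∣ : ∀ {c r} → Int r → c ∣ c * r
  Int⇒∣ {r = r} ir = r , ir , refl

  ≡-∣ : ∀ {c x y} → x ≡ y → c ∣ x → c ∣ y
  ≡-∣ refl p = p

  ∣-≡ : ∀ {c d x} → c ≡ d → c ∣ x → d ∣ x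
  ∣-≡ refl p = p

  *-cancel-# : ∀ n {x y} → # (+ suc n) * x ≡ # (+ suc n) * y → x ≡ y
  *-cancel-# n {x} {y} eq with inverse n
  ... | i , i*n≡1 = begin
    x ≡⟨ lem x ⟩
    i * (# (+ suc n) * x)      ≡⟨ cong (i *_) eq ⟩
    i * (# (+ suc n) * y)      ≡⟨ lem y ⟨
    y                          ∎
    where
    open ≡-Reasoning
    lem : ∀ z → z ≡ i * (# (+ suc n) * z)
    lem z = trans (sym (*-identityˡ z)) (trans (cong (_* z) (sym i*n≡1)) (*-assoc i _ z))

  *-cancel-∣ : ∀ n {c x} → # (+ suc n) * c ∣ # (+ suc n) * x → c ∣ x
  *-cancel-∣ n {c} (r , ir , eq) = r , ir , *-cancel-# n (trans eq (*-assoc _ c r))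

  ^-+ : ∀ x m n → x ^ (m ℕ.+ n) ≡ x ^ m * x ^ n
  ^-+ x zero    n = sym (*-identityˡ _)
  ^-+ x (suc m) n = trans (cong (x *_) (^-+ x m n)) (sym (*-assoc x _ _))

  -1# : Carrier
  -1# = # -[1+ 0 ]

  -- Linear functionals on polynomials, given by their moments

  Seq : Set
  Seq = ℕ → Carrier

  -- If Z k = Λ(xᵏ) for a linear functional Λ on polynomials, then F c t Z j = Λ(xʲ (x + c)ᵗ).
  F : Carrier → ℕ → Seq → Seq
  F c zero    Z j = Z j
  F c (suc t) Z j = F c t Z (suc j) + c * F c t Z j

  F-cong : ∀ c t {Y Z : Seq} → (∀ i → Y i ≡ Z i) → ∀ j → F c t Y j ≡ F c t Z j
  F-cong c zero    eq j = eq j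
  F-cong c (suc t) eq j = cong₂ (λ x y → x + c * y) (F-cong c t eq (suc j)) (F-cong c t eq j)

  F-linear : ∀ c a t (Y Z : Seq) j → F c t (λ i → Y i + a * Z i) j ≡ F c t Y j + a * F c t Z j
  F-linear c a zero    Y Z j = refl
  F-linear c a (suc t) Y Z j = trans
    (cong₂ (λ x y → x + c * y) (F-linear c a t Y Z (suc j)) (F-linear c a t Y Z j))
    (solve 6 (λ c a y z y′ z′ → (y :+ a :* z) :+ c :* (y′ :+ a :* z′) := (y :+ c :* y′) :+ a :* (z :+ c :* z′))
       refl c a _ _ _ _)

  F-shift : ∀ c t s (Z : Seq) j → F c t (λ i → Z (s ℕ.+ i)) j ≡ F c t Z (s ℕ.+ j)
  F-shift c zero    s Z j = refl
  F-shift c (suc t) s Z j = cong₂ (λ x y → x + c * y)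
    (trans (F-shift c t s Z (suc j)) (cong (F c t Z) (ℕₚ.+-suc s j))) (F-shift c t s Z j)

  F-+ : ∀ c s t (Z : Seq) j → F c (s ℕ.+ t) Z j ≡ F c s (F c t Z) j
  F-+ c zero    t Z j = refl
  F-+ c (suc s) t Z j = cong₂ (λ x y → x + c * y) (F-+ c s t Z (suc j)) (F-+ c s t Z j)

  -- Translations add up: the sequence `F a i Z j` consists of the moments of f ↦ Λ(xʲ f(x + a)),
  -- and this functional sends yⁿ (y + b)ᵗ to Λ(xʲ (x + a)ⁿ (x + a + b)ᵗ).
  F-F : ∀ a b t (Z : Seq) n j → F b t (λ i → F a i Z j) n ≡ F (a + b) t (F a n Z) j
  F-F a b zero    Z n j = refl
  F-F a b (suc t) Z n j = begin
    F b t (λ i → F a i Z j) (suc n) + b * F b t (λ i → F a i Z j) n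
      ≡⟨ cong₂ (λ x y → x + b * y) (F-F a b t Z (suc n) j) (F-F a b t Z n j) ⟩
    F (a + b) t (F a (suc n) Z) j + b * F (a + b) t (F a n Z) j
      ≡⟨ cong (_+ b * F (a + b) t (F a n Z) j) (F-linear (a + b) a t (λ i → F a n Z (suc i)) (F a n Z) j) ⟩
    F (a + b) t (λ i → F a n Z (suc i)) j + a * F (a + b) t (F a n Z) j + b * F (a + b) t (F a n Z) j
      ≡⟨ cong (λ x → x + a * F (a + b) t (F a n Z) j + b * F (a + b) t (F a n Z) j) (F-shift (a + b) t 1 (F a n Z) j) ⟩
    F (a + b) t (F a n Z) (suc j) + a * F (a + b) t (F a n Z) j + b * F (a + b) t (F a n Z) j
      ≡⟨ solve 4 (λ a b x y → x :+ a :* y :+ b :* y := x :+ (a :+ b) :* y) refl a b _ _ ⟩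
    F (a + b) t (F a n Z) (suc j) + (a + b) * F (a + b) t (F a n Z) j ∎
    where open ≡-Reasoning

  F-pow : ∀ c a t j → F c t (a ^_) j ≡ a ^ j * (a + c) ^ t
  F-pow c a zero    j = sym (*-identityʳ _)
  F-pow c a (suc t) j = trans
    (cong₂ (λ x y → x + c * y) (F-pow c a t (suc j)) (F-pow c a t j))
    (solve 4 (λ a c x y → a :* x :* y :+ c :* (x :* y) := x :* ((a :+ c) :* y)) refl a c _ _)

  F-∣ : ∀ {c d} → Int c → ∀ t {Z : Seq} j → (∀ i → i ≤ t ℕ.+ j → d ∣ Z i) → d ∣ F c t Z j
  F-∣ ic zero    j h = h j ℕₚ.≤-refl
  F-∣ ic (suc t) j h = ∣-+
    (F-∣ ic t (suc j) (λ i i≤ → h i (subst (i ≤_) (ℕₚ.+-suc t j) i≤)))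
    (∣-*ˡ ic (F-∣ ic t j (λ i i≤ → h i (ℕₚ.m≤n⇒m≤1+n i≤))))

  -- Every monomial of xʲ (x + c)ᵗ - xᵗ⁺ʲ has a factor c and degree below t + j. The strict bound on
  -- i lets strong inductions apply this to the very sequence whose next term is being estimated.
  F-leading : ∀ {c d} → Int c → ∀ t {Z : Seq} j → (∀ i → i < t ℕ.+ j → d ∣ Z i) →
              c * d ∣ F c t Z j - Z (t ℕ.+ j)
  F-leading ic zero    {Z} j h = ≡-∣ (sym (-‿inverseʳ (Z j))) ∣-0
  F-leading {c} ic (suc t) {Z} j h = ≡-∣ eq (∣-+
    (F-leading ic t (suc j) (λ i i< → h i (subst (i <_) (ℕₚ.+-suc t j) i<)))
    (*-mono-∣ (∣-refl {c}) (F-∣ ic t j (λ i i≤ → h i (s≤s i≤)))))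
    where
    eq : F c t Z (suc j) - Z (t ℕ.+ suc j) + c * F c t Z j ≡ F c (suc t) Z j - Z (suc t ℕ.+ j)
    eq rewrite ℕₚ.+-suc t j =
      solve 3 (λ x y z → x :- z :+ y := x :+ y :- z) refl (F c t Z (suc j)) (c * F c t Z j) (Z (suc (t ℕ.+ j)))

  F-vanishing : ∀ c t {Z : Seq} j → (∀ i → i < t ℕ.+ j → Z i ≡ 0#) → F c t Z j ≡ Z (t ℕ.+ j)
  F-vanishing c zero    j h = refl
  F-vanishing c (suc t) {Z} j h = begin
    F c t Z (suc j) + c * F c t Z j
      ≡⟨ cong₂ (λ x y → x + c * y)
           (F-vanishing c t (suc j) (λ i i< → h i (subst (i <_) (ℕₚ.+-suc t j) i<)))
           (trans (F-vanishing c t j (λ i i< → h i (ℕₚ.m<n⇒m<1+n i<))) (h (t ℕ.+ j) ℕₚ.≤-refl)) ⟩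
    Z (t ℕ.+ suc j) + c * 0#
      ≡⟨ cong₂ _+_ (cong Z (ℕₚ.+-suc t j)) (zeroʳ c) ⟩
    Z (suc (t ℕ.+ j)) + 0#
      ≡⟨ +-identityʳ _ ⟩
    Z (suc (t ℕ.+ j)) ∎
    where open ≡-Reasoning

  -- When the moments below degree t + j vanish, only the two top terms of xʲ (x + c)ᵗ⁺¹ count, with
  -- coefficients 1 and (t + 1)c.
  F-vanishing-suc : ∀ c t {Z : Seq} j → (∀ i → i < t ℕ.+ j → Z i ≡ 0#) →
                    F c (suc t) Z j ≡ Z (suc (t ℕ.+ j)) + # (+ suc t) * (c * Z (t ℕ.+ j))
  F-vanishing-suc c zero    {Z} j h = cong (λ x → Z (suc j) + x) (sym (*-identityˡ _))
  F-vanishing-suc c (suc t) {Z} j h = begin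
    F c (suc t) Z (suc j) + c * F c (suc t) Z j
      ≡⟨ cong₂ (λ x y → x + c * y)
           (F-vanishing-suc c t (suc j) (λ i i< → h i (subst (i <_) (ℕₚ.+-suc t j) i<)))
           (F-vanishing c (suc t) j h) ⟩
    Z (suc (t ℕ.+ suc j)) + # (+ suc t) * (c * Z (t ℕ.+ suc j)) + c * Z (suc t ℕ.+ j)
      ≡⟨ cong (λ n → Z (suc n) + # (+ suc t) * (c * Z n) + c * Z (suc t ℕ.+ j)) (ℕₚ.+-suc t j) ⟩
    Z (suc (suc t ℕ.+ j)) + # (+ suc t) * (c * Z (suc t ℕ.+ j)) + c * Z (suc t ℕ.+ j)
      ≡⟨ solve 3 (λ z n w → z :+ n :* w :+ w := z :+ (con (+ 1) :+ n) :* w) refl _ _ _ ⟩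
    Z (suc (suc t ℕ.+ j)) + (# (+ 1) + # (+ suc t)) * (c * Z (suc t ℕ.+ j))
      ≡⟨ cong (λ n → Z (suc (suc t ℕ.+ j)) + n * (c * Z (suc t ℕ.+ j))) (sym (#-+ (+ 1) (+ suc t))) ⟩
    Z (suc (suc t ℕ.+ j)) + # (+ suc (suc t)) * (c * Z (suc t ℕ.+ j)) ∎
    where open ≡-Reasoning

  -- A functional invariant under a nonzero integer translation c is zero: if Λ kills the powers
  -- below xⁱ, invariance at xⁱ⁺¹ leaves (i + 1) c Λ(xⁱ) = 0.
  F-fixed : ∀ n {Z : Seq} → (∀ t → F (# (+ suc n)) t Z 0 ≡ Z t) → ∀ t → Z t ≡ 0#
  F-fixed n {Z} fix t = below (suc t) t ℕₚ.≤-refl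
    where
    below : ∀ b i → i < b → Z i ≡ 0#
    below (suc b) i (s≤s i≤b) = *-cancel-# n (*-cancel-# i (begin
      # (+ suc i) * (# (+ suc n) * Z i)
        ≡⟨ solve 2 (λ z w → w := z :+ w :- z) refl (Z (suc i)) _ ⟩
      Z (suc i) + # (+ suc i) * (# (+ suc n) * Z i) - Z (suc i)
        ≡⟨ cong (_- Z (suc i)) (trans (sym step) (fix (suc i))) ⟩
      Z (suc i) - Z (suc i)
        ≡⟨ solve 3 (λ z a b → z :- z := a :* (b :* con (+ 0))) refl _ _ _ ⟩
      # (+ suc i) * (# (+ suc n) * 0#) ∎))
      where
      open ≡-Reasoning
      step : F (# (+ suc n)) (suc i) Z 0 ≡ Z (suc i) + # (+ suc i) * (# (+ suc n) * Z i)
      step = trans (F-vanishing-suc (# (+ suc n)) i 0 (λ j j< → below b j (ℕₚ.≤-trans j< (ℕₚ.≤-trans (ℕₚ.≤-reflexive (ℕₚ.+-identityʳ i)) i≤b))))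
                   (cong (λ k → Z (suc k) + # (+ suc i) * (# (+ suc n) * Z k)) (ℕₚ.+-identityʳ i))

  F₀-leading : ∀ {c d} → Int c → ∀ t {Z : Seq} → (∀ i → i < t → d ∣ Z i) → c * d ∣ F c t Z 0 - Z t
  F₀-leading {c} {d} ic t {Z} h = subst (λ k → c * d ∣ F c t Z 0 - Z k) (ℕₚ.+-identityʳ t)
    (F-leading ic t 0 (λ i i< → h i (subst (i <_) (ℕₚ.+-identityʳ t) i<)))

  Int-2^ : ∀ n → Int (2# ^ n)
  Int-2^ = Int-^ (Int-# (+ 2))

  -- (X + 4z)^(2ⁿ) ≡ X^(2ⁿ) + 2ⁿ⁺² z X^(2ⁿ-1) (mod 2ⁿ⁺³), by repeated squaring.
  F-2^ : ∀ {z} → Int z → ∀ n {d} (Z : Seq) → (∀ i → d ∣ Z i) → ∀ j →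
         2# ^ (3 ℕ.+ n) * d ∣
         F (# (+ 4) * z) (suc 2^ n ∸1) Z j - (Z (suc 2^ n ∸1 ℕ.+ j) + 2# ^ (2 ℕ.+ n) * z * Z (2^ n ∸1 ℕ.+ j))
  F-2^ {z} iz zero    Z h j = ≡-∣
    (solve 3 (λ z x y → con (+ 0) := x :+ con (+ 4) :* z :* y :- (x :+ con (+ 2) :* (con (+ 2) :* con (+ 1)) :* z :* y))
      refl z (Z (suc j)) (Z j)) ∣-0
  F-2^ {z} iz (suc n) {d} Z h j = ≡-∣ (sym total) (∣-+ (∣-+ 2R∣ wY∣) RY∣)
    where
    p t : ℕ
    p = 2^ n ∸1
    t = suc p
    c e w : Carrier
    c = # (+ 4) * z
    e = 2# ^ n
    w = 2# ^ (2 ℕ.+ n) * z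
    Rem : Seq → Seq
    Rem Z i = F c t Z i - (Z (t ℕ.+ i) + w * Z (p ℕ.+ i))
    -- Here (x + c)ᵗ = xᵗ + Y with Y divisible by 2ⁿ⁺² d. The second factor (x + c)ᵗ acts on Y
    -- through the induction hypothesis with that larger divisor, which is why d is arbitrary.
    Y : Seq
    Y i = w * Z (p ℕ.+ i) + Rem Z i
    ie : Int e
    ie = Int-2^ n
    RZ∣ : ∀ i → 2# ^ (3 ℕ.+ n) * d ∣ Rem Z i
    RZ∣ = F-2^ iz n Z h
    Y∣ : ∀ i → 2# ^ (2 ℕ.+ n) * d ∣ Y i
    Y∣ i = ∣-+
      (∣-trans (z , iz , solve 3 (λ a z d → a :* z :* d := a :* d :* z) refl (2# ^ (2 ℕ.+ n)) z d)
        (*-mono-∣ (∣-refl {w}) (h (p ℕ.+ i))))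
      (∣-trans (2# , Int-# _ , solve 2 (λ a d → con (+ 2) :* a :* d := a :* d :* con (+ 2)) refl (2# ^ (2 ℕ.+ n)) d) (RZ∣ i))
    2R∣ : 2# ^ (4 ℕ.+ n) * d ∣ 2# * Rem Z (t ℕ.+ j)
    2R∣ = ∣-≡ (sym (*-assoc 2# (2# ^ (3 ℕ.+ n)) d)) (*-mono-∣ (∣-refl {2#}) (RZ∣ (t ℕ.+ j)))
    wY∣ : 2# ^ (4 ℕ.+ n) * d ∣ w * Y (p ℕ.+ j)
    wY∣ = ∣-trans
      (e * z , Int-* ie iz ,
       solve 3 (λ e z d → con (+ 2) :* (con (+ 2) :* e) :* z :* (con (+ 2) :* (con (+ 2) :* e) :* d)
                       := con (+ 2) :* (con (+ 2) :* (con (+ 2) :* (con (+ 2) :* e))) :* d :* (e :* z)) refl e z d)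
      (*-mono-∣ (∣-refl {w}) (Y∣ (p ℕ.+ j)))
    RY∣ : 2# ^ (4 ℕ.+ n) * d ∣ Rem Y j
    RY∣ = ∣-trans
      (2# * e , Int-* (Int-# _) ie ,
       solve 2 (λ e d → con (+ 2) :* (con (+ 2) :* (con (+ 2) :* e)) :* (con (+ 2) :* (con (+ 2) :* e) :* d)
                     := con (+ 2) :* (con (+ 2) :* (con (+ 2) :* (con (+ 2) :* e))) :* d :* (con (+ 2) :* e)) refl e d)
      (F-2^ iz n Y Y∣ j)
    split : F c (t ℕ.+ t) Z j ≡ F c t Z (t ℕ.+ j) + 1# * F c t Y j
    split = begin
      F c (t ℕ.+ t) Z j
        ≡⟨ F-+ c t t Z j ⟩
      F c t (F c t Z) j
        ≡⟨ F-cong c t (λ i → solve 3 (λ f x y → f := x :+ con (+ 1) :* (y :+ (f :- (x :+ y)))) refl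
             (F c t Z i) (Z (t ℕ.+ i)) (w * Z (p ℕ.+ i))) j ⟩
      F c t (λ i → Z (t ℕ.+ i) + 1# * Y i) j
        ≡⟨ F-linear c 1# t (λ i → Z (t ℕ.+ i)) Y j ⟩
      F c t (λ i → Z (t ℕ.+ i)) j + 1# * F c t Y j
        ≡⟨ cong (λ x → x + 1# * F c t Y j) (F-shift c t t Z j) ⟩
      F c t Z (t ℕ.+ j) + 1# * F c t Y j ∎
      where open ≡-Reasoning
    total : F c (t ℕ.+ t) Z j - (Z (t ℕ.+ t ℕ.+ j) + 2# ^ (3 ℕ.+ n) * z * Z (p ℕ.+ t ℕ.+ j))
          ≡ 2# * Rem Z (t ℕ.+ j) + w * Y (p ℕ.+ j) + Rem Y j
    total = trans
      (cong₂ _-_ split (cong₂ (λ a b → Z a + 2# ^ (3 ℕ.+ n) * z * Z b) (ℕₚ.+-assoc t t j) (ℕₚ.+-assoc p t j)))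
      (identity (F c t Z (t ℕ.+ j)) (F c t Y j) (Z (t ℕ.+ (t ℕ.+ j))) (Z (p ℕ.+ (t ℕ.+ j))) (2# ^ (2 ℕ.+ n)) z (w * Y (p ℕ.+ j)))
      where
      identity : ∀ f g a b e z y → f + 1# * g - (a + 2# * e * z * b)
               ≡ 2# * (f - (a + e * z * b)) + y + (g - (e * z * b + (f - (a + e * z * b)) + y))
      identity = solve 7 (λ f g a b e z y → f :+ con (+ 1) :* g :- (a :+ con (+ 2) :* e :* z :* b)
        := con (+ 2) :* (f :- (a :+ e :* z :* b)) :+ y :+ (g :- (e :* z :* b :+ (f :- (a :+ e :* z :* b)) :+ y))) refl

  -- With c = 4z, t = 2ⁿ and w = 2ⁿ⁺² z, write (x + c)ᵗ - 1 = (xᵗ - 1) + w xᵗ⁻¹ + E and multiply by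
  -- (x + c)ᵏ. By `F₀-leading` the first two parts contribute their leading terms, and E is
  -- negligible. The hypothesis on differences concerns only i < k, so that it can serve as an
  -- induction hypothesis.
  F-difference : ∀ {z} → Int z → ∀ n {d} k (Z : Seq) → (∀ i → d ∣ Z i) →
    (∀ i → i < k → 2# ^ (1 ℕ.+ n) * d ∣ Z (suc 2^ n ∸1 ℕ.+ i) - Z i) →
    2# ^ (3 ℕ.+ n) * d ∣
    (F (# (+ 4) * z) (k ℕ.+ suc 2^ n ∸1) Z 0 - Z (suc 2^ n ∸1 ℕ.+ k)) - (F (# (+ 4) * z) k Z 0 - Z k)
      - 2# ^ (2 ℕ.+ n) * z * Z (2^ n ∸1 ℕ.+ k)
  F-difference {z} iz n {d} k Z h δ = ≡-∣ (sym total) (∣-+ (∣-+ D∣ Q∣) R∣)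
    where
    p t : ℕ
    p = 2^ n ∸1
    t = suc p
    c e w : Carrier
    c = # (+ 4) * z
    e = 2# ^ n
    w = 2# ^ (2 ℕ.+ n) * z
    ie : Int e
    ie = Int-2^ n
    ic : Int c
    ic = Int-* (Int-# _) iz
    D Q E : Seq
    D i = Z (t ℕ.+ i) - Z i
    Q i = Z (p ℕ.+ i)
    E i = F c t Z i - (Z (t ℕ.+ i) + w * Z (p ℕ.+ i))
    D∣ : 2# ^ (3 ℕ.+ n) * d ∣ F c k D 0 - D k
    D∣ = ∣-trans
      (z , iz , solve 3 (λ z e d → con (+ 4) :* z :* (con (+ 2) :* e :* d)
         := con (+ 2) :* (con (+ 2) :* (con (+ 2) :* e)) :* d :* z) refl z e d)
      (F₀-leading ic k δ)
    Q∣ : 2# ^ (3 ℕ.+ n) * d ∣ w * (F c k Q 0 - Q k)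
    Q∣ = ∣-trans
      (2# * z * z , Int-* (Int-* (Int-# _) iz) iz ,
       solve 3 (λ z e d → con (+ 2) :* (con (+ 2) :* e) :* z :* (con (+ 4) :* z :* d)
         := con (+ 2) :* (con (+ 2) :* (con (+ 2) :* e)) :* d :* (con (+ 2) :* z :* z)) refl z e d)
      (*-mono-∣ (∣-refl {w}) (F₀-leading ic k (λ i _ → h (p ℕ.+ i))))
    R∣ : 2# ^ (3 ℕ.+ n) * d ∣ F c k E 0
    R∣ = F-∣ ic k 0 (λ i _ → F-2^ iz n Z h i)
    split : F c (k ℕ.+ t) Z 0 ≡ F c k Z 0 + 1# * F c k D 0 + w * F c k Q 0 + 1# * F c k E 0
    split = begin
      F c (k ℕ.+ t) Z 0
        ≡⟨ F-+ c k t Z 0 ⟩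
      F c k (F c t Z) 0
        ≡⟨ F-cong c k (λ i → solve 4 (λ f x y z → f := z :+ con (+ 1) :* (x :- z) :+ y :+ con (+ 1) :* (f :- (x :+ y))) refl
             (F c t Z i) (Z (t ℕ.+ i)) (w * Q i) (Z i)) 0 ⟩
      F c k (λ i → Z i + 1# * D i + w * Q i + 1# * E i) 0
        ≡⟨ F-linear c 1# k (λ i → Z i + 1# * D i + w * Q i) E 0 ⟩
      F c k (λ i → Z i + 1# * D i + w * Q i) 0 + 1# * F c k E 0
        ≡⟨ cong (λ x → x + 1# * F c k E 0) (F-linear c w k (λ i → Z i + 1# * D i) Q 0) ⟩
      F c k (λ i → Z i + 1# * D i) 0 + w * F c k Q 0 + 1# * F c k E 0
        ≡⟨ cong (λ x → x + w * F c k Q 0 + 1# * F c k E 0) (F-linear c 1# k Z D 0) ⟩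
      F c k Z 0 + 1# * F c k D 0 + w * F c k Q 0 + 1# * F c k E 0 ∎
      where open ≡-Reasoning
    total : (F c (k ℕ.+ t) Z 0 - Z (t ℕ.+ k)) - (F c k Z 0 - Z k) - w * Z (p ℕ.+ k)
          ≡ F c k D 0 - D k + w * (F c k Q 0 - Q k) + F c k E 0
    total = trans
      (cong (λ x → (x - Z (t ℕ.+ k)) - (F c k Z 0 - Z k) - w * Z (p ℕ.+ k)) split)
      (identity (F c k Z 0) (F c k D 0) (F c k Q 0) (F c k E 0) (Z (t ℕ.+ k)) (Z k) w (Z (p ℕ.+ k)))
      where
      identity : ∀ f d q e x y w r → f + 1# * d + w * q + 1# * e - x - (f - y) - w * r
               ≡ d - (x - y) + w * (q - r) + e
      identity = solve 8 (λ f d q e x y w r →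
        f :+ con (+ 1) :* d :+ w :* q :+ con (+ 1) :* e :- x :- (f :- y) :- w :* r
        := d :- (x :- y) :+ w :* (q :- r) :+ e) refl

  -- Finite sums, and passing from odd residues to powers of 5

  ∑ : ℕ → Seq → Carrier
  ∑ zero    f = 0#
  ∑ (suc n) f = ∑ n f + f n

  ∑-cong : ∀ n {f g : Seq} → (∀ i → f i ≡ g i) → ∑ n f ≡ ∑ n g
  ∑-cong zero    h = refl
  ∑-cong (suc n) h = cong₂ _+_ (∑-cong n h) (h n)

  ∑-mod : ∀ {d} n {f g : Seq} → (∀ i → d ∣ f i - g i) → d ∣ ∑ n f - ∑ n g
  ∑-mod zero    h = ≡-∣ (sym (-‿inverseʳ 0#)) ∣-0
  ∑-mod (suc n) {f} {g} h = ≡-∣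
    (solve 4 (λ a b c d → a :- b :+ (c :- d) := a :+ c :- (b :+ d)) refl (∑ n f) (∑ n g) (f n) (g n))
    (∣-+ (∑-mod n h) (h n))

  ∑-Int : ∀ n {f : Seq} → (∀ i → Int (f i)) → Int (∑ n f)
  ∑-Int zero    h = Int-# _
  ∑-Int (suc n) h = Int-+ (∑-Int n h) (h n)

  ∑-+ : ∀ n (f g : Seq) → ∑ n (λ i → f i + g i) ≡ ∑ n f + ∑ n g
  ∑-+ zero    f g = sym (+-identityʳ 0#)
  ∑-+ (suc n) f g = trans (cong (_+ (f n + g n)) (∑-+ n f g))
    (solve 4 (λ a b c d → a :+ b :+ (c :+ d) := a :+ c :+ (b :+ d)) refl (∑ n f) (∑ n g) (f n) (g n))

  ∑-* : ∀ n c (f : Seq) → ∑ n (λ i → c * f i) ≡ c * ∑ n f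
  ∑-* zero    c f = sym (zeroʳ c)
  ∑-* (suc n) c f = trans (cong (_+ c * f n) (∑-* n c f)) (sym (distribˡ c _ _))

  ∑-split : ∀ m n (f : Seq) → ∑ (m ℕ.+ n) f ≡ ∑ m f + ∑ n (λ i → f (m ℕ.+ i))
  ∑-split m zero    f = trans (cong (λ k → ∑ k f) (ℕₚ.+-identityʳ m)) (sym (+-identityʳ _))
  ∑-split m (suc n) f = trans (cong (λ k → ∑ k f) (ℕₚ.+-suc m n))
    (trans (cong (_+ f (m ℕ.+ n)) (∑-split m n f)) (+-assoc _ _ _))

  ∑-head : ∀ n (f : Seq) → ∑ (suc n) f ≡ f 0 + ∑ n (λ i → f (suc i))
  ∑-head zero    f = trans (+-identityˡ _) (sym (+-identityʳ _))
  ∑-head (suc n) f = trans (cong (_+ f (suc n)) (∑-head n f)) (+-assoc _ _ _)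

  ∣-telescope : ∀ {d x y z} → d ∣ x - y → d ∣ y - z → d ∣ x - z
  ∣-telescope {x = x} {y} {z} p q =
    ≡-∣ (solve 3 (λ x y z → x :- y :+ (y :- z) := x :- z) refl x y z) (∣-+ p q)

  ∑-reverse : ∀ {d} n {f g : Seq} → (∀ i j → suc (i ℕ.+ j) ≡ n → d ∣ f i - g j) → d ∣ ∑ n f - ∑ n g
  ∑-reverse zero    h = ≡-∣ (sym (-‿inverseʳ 0#)) ∣-0
  ∑-reverse (suc n) {f} {g} h = subst (λ x → _ ∣ ∑ n f + f n - x) (sym (∑-head n g)) (≡-∣
    (solve 4 (λ a b c d → a :- b :+ (c :- d) := a :+ c :- (d :+ b)) refl (∑ n f) (∑ n (λ i → g (suc i))) (f n) (g 0))
    (∣-+ (∑-reverse n (λ i j e → h i (suc j) (cong suc (trans (ℕₚ.+-suc i j) e))))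
         (h n 0 (cong suc (ℕₚ.+-identityʳ n)))))

  F-zero : ∀ c t j → F c t (λ _ → 0#) j ≡ 0#
  F-zero c zero    j = refl
  F-zero c (suc t) j = trans (cong₂ (λ x y → x + c * y) (F-zero c t (suc j)) (F-zero c t j))
    (trans (+-identityˡ _) (zeroʳ c))

  -- These are the moments of a discrete measure with mass `X b` at the point `a b`; translating the
  -- functional moves the points by c.
  F-∑ : ∀ c t m (X a : Seq) → F c t (λ n → ∑ m (λ b → X b * a b ^ n)) 0 ≡ ∑ m (λ b → X b * (a b + c) ^ t)
  F-∑ c t zero    X a = F-zero c t 0
  F-∑ c t (suc m) X a = trans (F-linear c (X m) t (λ n → ∑ m (λ b → X b * a b ^ n)) (a m ^_) 0)
    (cong₂ (λ x y → x + X m * y) (F-∑ c t m X a) (trans (F-pow c (a m) t 0) (*-identityˡ _)))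

  periodic-* : ∀ {d} N (g : Seq) → (∀ b → d ∣ g (N ℕ.+ b) - g b) → ∀ s b → d ∣ g (s ℕ.* N ℕ.+ b) - g b
  periodic-* N g h zero    b = ≡-∣ (sym (-‿inverseʳ (g b))) ∣-0
  periodic-* {d} N g h (suc s) b = subst (λ k → d ∣ g k - g b) (sym (ℕₚ.+-assoc N (s ℕ.* N) b))
    (≡-∣ (solve 3 (λ x y z → x :- y :+ (y :- z) := x :- z) refl (g (N ℕ.+ (s ℕ.* N ℕ.+ b))) (g (s ℕ.* N ℕ.+ b)) (g b))
      (∣-+ (h (s ℕ.* N ℕ.+ b)) (periodic-* N g h s b)))

  -- The odd numbers below 2ʳ⁺¹ and the powers 5ⁱ, i < 2ʳ, represent the same classes of
  -- (ℤ/2ʳ⁺²)ˣ/{±1}; passing from r to r + 1, fold g into g b + g (b + 2ʳ⁺¹).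
  ∑-powers-of-5 : ∀ {d} r (g : Seq) → (∀ b → d ∣ g (2 ℕ.^ suc r ℕ.+ b) - g b) →
    (∀ b b′ → suc (b ℕ.+ b′) ≡ 2 ℕ.^ suc r → d ∣ g b - g b′) →
    d ∣ ∑ (2 ℕ.^ r) g - ∑ (2 ℕ.^ r) (λ i → g (half5^ i))
  ∑-powers-of-5 zero    g periodic reflective = ≡-∣ (sym (-‿inverseʳ _)) ∣-0
  ∑-powers-of-5 {d} (suc r) g periodic reflective =
    ∣-telescope (≡-∣ (cong (λ x → x - ∑ m G) (sym low)) (≡-∣ (sym fold) (∑-rev))) (∣-telescope ih (≡-∣ (cong (λ x → ∑ m (λ i → G (half5^ i)) - x) (sym high)) shift))
    where
    open ≡-Reasoning
    m : ℕ
    m = 2 ℕ.^ r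
    G : Seq
    G b = g b + g (2 ℕ.* m ℕ.+ b)
    double : 2 ℕ.* m ≡ m ℕ.+ m
    double = cong (m ℕ.+_) (ℕₚ.+-identityʳ m)
    quad : ∀ b → 2 ℕ.* m ℕ.+ (2 ℕ.* m ℕ.+ b) ≡ 2 ℕ.* (2 ℕ.* m) ℕ.+ b
    quad b = trans (sym (ℕₚ.+-assoc (2 ℕ.* m) (2 ℕ.* m) b))
      (cong (λ k → 2 ℕ.* m ℕ.+ k ℕ.+ b) (sym (ℕₚ.+-identityʳ (2 ℕ.* m))))
    low : ∑ (2 ℕ.* m) g ≡ ∑ m g + ∑ m (λ i → g (m ℕ.+ i))
    low = trans (cong (λ k → ∑ k g) double) (∑-split m m g)
    high : ∑ (2 ℕ.* m) (λ i → g (half5^ i)) ≡ ∑ m (λ i → g (half5^ i)) + ∑ m (λ i → g (half5^ (m ℕ.+ i)))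
    high = trans (cong (λ k → ∑ k (λ i → g (half5^ i))) double) (∑-split m m (λ i → g (half5^ i)))
    fold : ∑ m g + ∑ m (λ i → g (m ℕ.+ i)) - ∑ m G ≡ ∑ m (λ i → g (m ℕ.+ i)) - ∑ m (λ i → g (2 ℕ.* m ℕ.+ i))
    fold = trans (cong (λ x → ∑ m g + ∑ m (λ i → g (m ℕ.+ i)) - x) (∑-+ m g (λ i → g (2 ℕ.* m ℕ.+ i))))
      (solve 3 (λ x y z → x :+ y :- (x :+ z) := y :- z) refl (∑ m g) _ _)
    -- Reflection carries the indices from m to 2m - 1 onto those from 2m to 3m - 1, where the
    -- second summand of `G` is evaluated.
    ∑-rev : d ∣ ∑ m (λ i → g (m ℕ.+ i)) - ∑ m (λ i → g (2 ℕ.* m ℕ.+ i))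
    ∑-rev = ∑-reverse m (λ i j e → reflective (m ℕ.+ i) (2 ℕ.* m ℕ.+ j) (begin
      suc (m ℕ.+ i ℕ.+ (2 ℕ.* m ℕ.+ j))  ≡⟨ rearrange m i j ⟩
      m ℕ.+ 2 ℕ.* m ℕ.+ suc (i ℕ.+ j)    ≡⟨ cong (m ℕ.+ 2 ℕ.* m ℕ.+_) e ⟩
      m ℕ.+ 2 ℕ.* m ℕ.+ m ≡⟨ solveℕ 1 (λ m → m :+ℕ conℕ 2 :*ℕ m :+ℕ m :=ℕ conℕ 2 :*ℕ (conℕ 2 :*ℕ m)) refl m ⟩
      2 ℕ.* (2 ℕ.* m)                    ∎))
      where
      rearrange : ∀ m i j → suc (m ℕ.+ i ℕ.+ (2 ℕ.* m ℕ.+ j)) ≡ m ℕ.+ 2 ℕ.* m ℕ.+ suc (i ℕ.+ j)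
      rearrange = solveℕ 3 (λ m i j → conℕ 1 :+ℕ (m :+ℕ i :+ℕ (conℕ 2 :*ℕ m :+ℕ j)) :=ℕ m :+ℕ conℕ 2 :*ℕ m :+ℕ (conℕ 1 :+ℕ (i :+ℕ j))) refl
    ih : d ∣ ∑ m G - ∑ m (λ i → G (half5^ i))
    ih = ∑-powers-of-5 r G
      (λ b → ≡-∣ (identity (g (2 ℕ.* m ℕ.+ (2 ℕ.* m ℕ.+ b))) (g b) (g (2 ℕ.* m ℕ.+ b)))
        (subst (λ k → d ∣ g k - g b) (sym (quad b)) (periodic b)))
      (λ b b′ e → ≡-∣ (swap (g b) (g (2 ℕ.* m ℕ.+ b′)) (g b′) (g (2 ℕ.* m ℕ.+ b)))
        (∣-- (reflective b (2 ℕ.* m ℕ.+ b′) (trans (left b b′) (cong (2 ℕ.* m ℕ.+_) (trans e (sym (ℕₚ.+-identityʳ _))))))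
             (reflective b′ (2 ℕ.* m ℕ.+ b) (trans (left b′ b) (cong (2 ℕ.* m ℕ.+_) (trans (cong suc (ℕₚ.+-comm b′ b)) (trans e (sym (ℕₚ.+-identityʳ _)))))))))
      where
      identity : ∀ x y z → x - y ≡ z + x - (y + z)
      identity = solve 3 (λ x y z → x :- y := z :+ x :- (y :+ z)) refl
      swap : ∀ x y z w → x - y - (z - w) ≡ x + w - (z + y)
      swap = solve 4 (λ x y z w → x :- y :- (z :- w) := x :+ w :- (z :+ y)) refl
      left : ∀ b b′ → suc (b ℕ.+ (2 ℕ.* m ℕ.+ b′)) ≡ 2 ℕ.* m ℕ.+ suc (b ℕ.+ b′)
      left = solveℕ 3 (λ m b b′ → conℕ 1 :+ℕ (b :+ℕ (conℕ 2 :*ℕ m :+ℕ b′)) :=ℕ conℕ 2 :*ℕ m :+ℕ (conℕ 1 :+ℕ (b :+ℕ b′))) refl m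
    shift : d ∣ ∑ m (λ i → G (half5^ i)) - (∑ m (λ i → g (half5^ i)) + ∑ m (λ i → g (half5^ (m ℕ.+ i))))
    shift = ≡-∣ (trans (solve 3 (λ x y z → y :- z := x :+ y :- (x :+ z)) refl (∑ m (λ i → g (half5^ i))) _ _)
        (cong (λ x → x - (∑ m (λ i → g (half5^ i)) + ∑ m (λ i → g (half5^ (m ℕ.+ i)))))
          (sym (∑-+ m (λ i → g (half5^ i)) (λ i → g (2 ℕ.* m ℕ.+ half5^ i))))))
      (∑-mod m (λ i → translate i (half5^-shift r i)))
      where
      translate : ∀ i → (∃ λ s → half5^ (m ℕ.+ i) ≡ s ℕ.* (2 ℕ.* (2 ℕ.* m)) ℕ.+ (2 ℕ.* m ℕ.+ half5^ i)) →
                  d ∣ g (2 ℕ.* m ℕ.+ half5^ i) - g (half5^ (m ℕ.+ i))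
      translate i (s , e) = ≡-∣ (solve 2 (λ x y → :- (x :- y) := y :- x) refl _ _)
        (∣-neg (subst (λ k → d ∣ g k - g (2 ℕ.* m ℕ.+ half5^ i)) (sym e)
          (periodic-* (2 ℕ.* (2 ℕ.* m)) g periodic s (2 ℕ.* m ℕ.+ half5^ i))))

  -- Geometric sums and odd numbers inside the ring

  #-suc : ∀ n → # (+ suc n) ≡ 1# + # (+ n)
  #-suc n = #-+ (+ 1) (+ n)

  #-double : ∀ n → # (+ (2 ℕ.* n)) ≡ 2# * # (+ n)
  #-double n = trans (cong #_ (ℤₚ.pos-* 2 n)) (#-* (+ 2) (+ n))

  geometric : ∀ u n → (1# - u) * ∑ n (u ^_) ≡ 1# - u ^ n
  geometric u zero    = solve 1 (λ u → (con (+ 1) :- u) :* con (+ 0) := con (+ 1) :- con (+ 1)) refl u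
  geometric u (suc n) = trans (distribˡ _ _ _) (trans (cong (λ x → x + (1# - u) * u ^ n) (geometric u n))
    (solve 2 (λ u x → con (+ 1) :- x :+ (con (+ 1) :- u) :* x := con (+ 1) :- u :* x) refl u (u ^ n)))

  weighted-geometric : ∀ u n → (1# - u) * ∑ n (λ i → # (+ i) * u ^ i) ≡ ∑ n (u ^_) - 1# + (1# - # (+ n)) * u ^ n
  weighted-geometric u zero    =
    solve 1 (λ u → (con (+ 1) :- u) :* con (+ 0) := con (+ 0) :- con (+ 1) :+ (con (+ 1) :- con (+ 0)) :* con (+ 1)) refl u
  weighted-geometric u (suc n) = begin
    (1# - u) * (∑ n (λ i → # (+ i) * u ^ i) + k * y)
      ≡⟨ distribˡ _ _ _ ⟩
    (1# - u) * ∑ n (λ i → # (+ i) * u ^ i) + (1# - u) * (k * y)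
      ≡⟨ cong (λ x → x + (1# - u) * (k * y)) (weighted-geometric u n) ⟩
    ∑ n (u ^_) - 1# + (1# - k) * y + (1# - u) * (k * y)
      ≡⟨ solve 4 (λ s k y u → s :- con (+ 1) :+ (con (+ 1) :- k) :* y :+ (con (+ 1) :- u) :* (k :* y)
           := s :+ y :- con (+ 1) :+ (con (+ 1) :- (con (+ 1) :+ k)) :* (u :* y)) refl (∑ n (u ^_)) k y u ⟩
    ∑ n (u ^_) + y - 1# + (1# - (1# + k)) * (u * y)
      ≡⟨ cong (λ x → ∑ n (u ^_) + y - 1# + (1# - x) * (u * y)) (#-suc n) ⟨
    ∑ n (u ^_) + y - 1# + (1# - # (+ suc n)) * (u * y) ∎
    where
    open ≡-Reasoning
    k y : Carrier
    k = # (+ n)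
    y = u ^ n

  odd : ℕ → Carrier
  odd b = 1# + 2# * # (+ b)

  odd-+ : ∀ m b → odd (m ℕ.+ b) ≡ odd b + 2# * # (+ m)
  odd-+ m b = trans (cong (λ x → 1# + 2# * x) (#-+ (+ m) (+ b)))
    (solve 2 (λ m b → con (+ 1) :+ con (+ 2) :* (m :+ b) := con (+ 1) :+ con (+ 2) :* b :+ con (+ 2) :* m) refl _ _)

  odd-reflect : ∀ b b′ n → suc (b ℕ.+ b′) ≡ n → odd b ≡ 2# * # (+ n) - odd b′
  odd-reflect b b′ n refl = trans
    (solve 2 (λ b c → con (+ 1) :+ con (+ 2) :* b := con (+ 2) :* (con (+ 1) :+ (b :+ c)) :- (con (+ 1) :+ con (+ 2) :* c)) refl _ _)
    (cong (λ x → 2# * x - odd b′) (sym (trans (#-suc (b ℕ.+ b′)) (cong (λ x → 1# + x) (#-+ (+ b) (+ b′))))))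

  Int-odd : ∀ b → Int (odd b)
  Int-odd b = Int-+ (Int-# _) (Int-* (Int-# _) (Int-# _))

  odd^-∣ : ∀ b n → 2# ∣ odd b ^ n - 1#
  odd^-∣ b zero    = ≡-∣ (sym (-‿inverseʳ 1#)) ∣-0
  odd^-∣ b (suc n) = ≡-∣
    (solve 2 (λ b y → (con (+ 1) :+ con (+ 2) :* b) :* (y :- con (+ 1)) :+ con (+ 2) :* b := (con (+ 1) :+ con (+ 2) :* b) :* y :- con (+ 1)) refl _ _)
    (∣-+ (∣-*ˡ (Int-odd b) (odd^-∣ b n)) (Int⇒∣ (Int-# (+ b))))

  odd² : ∀ b → odd b * odd b ≡ 1# + # (+ 8) * # (+ triangle b)
  odd² zero    = solve 0 ((con (+ 1) :+ con (+ 2) :* con (+ 0)) :* (con (+ 1) :+ con (+ 2) :* con (+ 0)) := con (+ 1) :+ con (+ 8) :* con (+ 0)) refl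
  odd² (suc b) = begin
    odd (suc b) * odd (suc b)
      ≡⟨ cong (λ x → x * x) (odd-+ 1 b) ⟩
    (odd b + 2# * 1#) * (odd b + 2# * 1#)
      ≡⟨ solve 1 (λ o → (o :+ con (+ 2) :* con (+ 1)) :* (o :+ con (+ 2) :* con (+ 1)) := o :* o :+ con (+ 4) :* (o :+ con (+ 1))) refl (odd b) ⟩
    odd b * odd b + # (+ 4) * (odd b + 1#)
      ≡⟨ cong (λ x → x + # (+ 4) * (odd b + 1#)) (odd² b) ⟩
    1# + # (+ 8) * # (+ triangle b) + # (+ 4) * (odd b + 1#)
      ≡⟨ solve 2 (λ t b → con (+ 1) :+ con (+ 8) :* t :+ con (+ 4) :* (con (+ 1) :+ con (+ 2) :* b :+ con (+ 1))
           := con (+ 1) :+ con (+ 8) :* (con (+ 1) :+ b :+ t)) refl _ _ ⟩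
    1# + # (+ 8) * (1# + # (+ b) + # (+ triangle b))
      ≡⟨ cong (λ x → 1# + # (+ 8) * x) (trans (#-+ (+ suc b) (+ triangle b)) (cong (λ x → x + # (+ triangle b)) (#-suc b))) ⟨
    1# + # (+ 8) * # (+ triangle (suc b)) ∎
    where open ≡-Reasoning

  -- Since a² = 1 + 8 · `triangle b`, differences of triangular numbers are read off from
  -- differences of odd squares by cancelling 8, without halving b(b + 1).
  triangle-difference : ∀ {x b b′} → odd b′ * odd b′ - odd b * odd b ≡ # (+ 8) * x → # (+ triangle b′) - # (+ triangle b) ≡ x
  triangle-difference {x} {b} {b′} e = *-cancel-# 7 (begin
    # (+ 8) * (# (+ triangle b′) - # (+ triangle b))
      ≡⟨ solve 2 (λ t s → con (+ 8) :* (t :- s) := con (+ 1) :+ con (+ 8) :* t :- (con (+ 1) :+ con (+ 8) :* s)) refl _ _ ⟩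
    1# + # (+ 8) * # (+ triangle b′) - (1# + # (+ 8) * # (+ triangle b))
      ≡⟨ cong₂ _-_ (odd² b′) (odd² b) ⟨
    odd b′ * odd b′ - odd b * odd b
      ≡⟨ e ⟩
    # (+ 8) * x ∎)
    where open ≡-Reasoning

  odd-half5^ : ∀ i → odd (half5^ (suc i)) ≡ # (+ 5) * odd (half5^ i)
  odd-half5^ i = begin
    1# + 2# * # (+ (5 ℕ.* h ℕ.+ 2)) ≡⟨ cong (λ x → 1# + 2# * x) (trans (#-+ (+ (5 ℕ.* h)) (+ 2))
                                              (cong (λ x → x + 2#) (trans (cong #_ (ℤₚ.pos-* 5 h)) (#-* (+ 5) (+ h))))) ⟩
    1# + 2# * (# (+ 5) * # (+ h) + 2#)    ≡⟨ solve 1 (λ h → con (+ 1) :+ con (+ 2) :* (con (+ 5) :* h :+ con (+ 2)) := con (+ 5) :* (con (+ 1) :+ con (+ 2) :* h)) refl _ ⟩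
    # (+ 5) * odd h ∎
    where
    open ≡-Reasoning
    h : ℕ
    h = half5^ i

  -- At a = 5ⁱ the number T = (a² - 1)/8 obeys T ↦ 25T + 3, so its parity flips with every step.
  triangle-half5^ : ∀ i → 2# ∣ # (+ triangle (half5^ i)) - # (+ i)
  triangle-half5^ zero    = ≡-∣ (sym (-‿inverseʳ 0#)) ∣-0
  triangle-half5^ (suc i) = ≡-∣ (trans (solve 3 (λ x t i → x :+ (t :- i :- con (+ 1)) := x :+ t :- (con (+ 1) :+ i)) refl _ _ _)
     (cong₂ _-_ (trans (cong (λ x → x + # (+ triangle (half5^ i))) (sym step)) (solve 2 (λ x y → x :- y :+ y := x) refl _ _)) (sym (#-suc i))))
    (≡-∣ (solve 2 (λ t i → con (+ 2) :* (con (+ 12) :* t :+ con (+ 1)) :+ (t :- i) := con (+ 24) :* t :+ con (+ 3) :+ (t :- i :- con (+ 1))) refl _ _)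
      (∣-+ (Int⇒∣ (Int-+ (Int-* (Int-# (+ 12)) (Int-# _)) (Int-# (+ 1)))) (triangle-half5^ i)))
    where
    open ≡-Reasoning
    h : ℕ
    h = half5^ i
    step : # (+ triangle (half5^ (suc i))) - # (+ triangle h) ≡ # (+ 24) * # (+ triangle h) + # (+ 3)
    step = triangle-difference {b = h} {half5^ (suc i)} (begin
      odd (half5^ (suc i)) * odd (half5^ (suc i)) - odd h * odd h
        ≡⟨ cong (λ x → x * x - odd h * odd h) (odd-half5^ i) ⟩
      # (+ 5) * odd h * (# (+ 5) * odd h) - odd h * odd h
        ≡⟨ solve 1 (λ o → con (+ 5) :* o :* (con (+ 5) :* o) :- o :* o := con (+ 24) :* (o :* o)) refl (odd h) ⟩
      # (+ 24) * (odd h * odd h)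
        ≡⟨ cong (λ x → # (+ 24) * x) (odd² h) ⟩
      # (+ 24) * (1# + # (+ 8) * # (+ triangle h))
        ≡⟨ solve 1 (λ t → con (+ 24) :* (con (+ 1) :+ con (+ 8) :* t) := con (+ 8) :* (con (+ 24) :* t :+ con (+ 3))) refl _ ⟩
      # (+ 8) * (# (+ 24) * # (+ triangle h) + # (+ 3)) ∎)

  -- Repeated squaring of a² = 1 + 8T doubles the coefficient of T exactly; the square of the second
  -- summand goes into w. Thus a^(2ⁿ⁺¹) ≡ 1 + 2ⁿ⁺³ T (mod 2ⁿ⁺⁴).
  odd^2^ : ∀ n b → ∃ λ w → Int w × odd b ^ suc 2^ suc n ∸1 ≡ 1# + 2# ^ (3 ℕ.+ n) * (# (+ triangle b) + 2# * w)
  odd^2^ zero b = 0# , Int-# _ , trans (trans (cong (odd b *_) (*-identityʳ _)) (odd² b))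
    (solve 1 (λ t → con (+ 1) :+ con (+ 8) :* t := con (+ 1) :+ con (+ 2) :* (con (+ 2) :* (con (+ 2) :* con (+ 1))) :* (t :+ con (+ 2) :* con (+ 0))) refl _)
  odd^2^ (suc n) b with odd^2^ n b
  ... | w , iw , eq = w + 2# * e * ((t + 2# * w) * (t + 2# * w)) ,
      Int-+ iw (Int-* (Int-* (Int-# _) (Int-2^ n)) (Int-* it it)) ,
      trans (^-+ (odd b) (suc 2^ suc n ∸1) (suc 2^ suc n ∸1)) (trans (cong (λ x → x * x) eq)
        (solve 3 (λ e t w → let y = t :+ con (+ 2) :* w; E = con (+ 2) :* (con (+ 2) :* (con (+ 2) :* e)) in
          (con (+ 1) :+ E :* y) :* (con (+ 1) :+ E :* y) := con (+ 1) :+ con (+ 2) :* E :* (t :+ con (+ 2) :* (w :+ con (+ 2) :* e :* (y :* y))))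
          refl e t w))
    where
    e t : Carrier
    e = 2# ^ n
    t = # (+ triangle b)
    it : Int (t + 2# * w)
    it = Int-+ (Int-# _) (Int-* (Int-# _) iw)

  2^-cancel-∣ : ∀ n {c x} → 2# ^ n * c ∣ 2# ^ n * x → c ∣ x
  2^-cancel-∣ zero    h = ∣-≡ (*-identityˡ _) (≡-∣ (*-identityˡ _) h)
  2^-cancel-∣ (suc n) h = 2^-cancel-∣ n (*-cancel-∣ 1 (∣-≡ (*-assoc 2# _ _) (≡-∣ (*-assoc 2# _ _) h)))

  -- Squaring is additive modulo 2. For u^(2^j) = -1 the right-hand term is 2, so a power of 1 - u
  -- is divisible by 2; this is how 1 - u and 1 - ζ are seen not to be 2-adic units.
  one-minus-^2^ : ∀ {u} → Int u → ∀ j → 2# ∣ (1# - u) ^ (2 ℕ.^ j) - (1# - u ^ (2 ℕ.^ j))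
  one-minus-^2^ {u} iu zero    = ≡-∣ (solve 1 (λ u → con (+ 0) := (con (+ 1) :- u) :* con (+ 1) :- (con (+ 1) :- u :* con (+ 1))) refl u) ∣-0
  one-minus-^2^ {u} iu (suc j) = ≡-∣
    (trans (solve 2 (λ p v → (p :- (con (+ 1) :- v)) :* (p :+ (con (+ 1) :- v)) :+ con (+ 2) :* (v :* v :- v)
         := p :* p :- (con (+ 1) :- v :* v)) refl p′ v)
      (cong₂ (λ x y → x - (1# - y)) (square (1# - u)) (square u)))
    (∣-+ (∣-*ʳ (Int-+ (Int-^ (Int-- (Int-# _) iu) (2 ℕ.^ j)) (Int-- (Int-# _) iv)) (one-minus-^2^ iu j)) (Int⇒∣ (Int-- (Int-* iv iv) iv)))
    where
    v p′ : Carrier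
    v = u ^ (2 ℕ.^ j)
    p′ = (1# - u) ^ (2 ℕ.^ j)
    iv : Int v
    iv = Int-^ iu (2 ℕ.^ j)
    square : ∀ x → x ^ (2 ℕ.^ j) * x ^ (2 ℕ.^ j) ≡ x ^ (2 ℕ.* 2 ℕ.^ j)
    square x = trans (sym (^-+ x (2 ℕ.^ j) (2 ℕ.^ j))) (cong (x ^_) (cong (2 ℕ.^ j ℕ.+_) (sym (ℕₚ.+-identityʳ (2 ℕ.^ j)))))

  ^-mono-∣ : ∀ {c x} n → c ∣ x → c ^ n ∣ x ^ n
  ^-mono-∣ zero    h = ∣-refl
  ^-mono-∣ (suc n) h = *-mono-∣ h (^-mono-∣ n h)

  1^ : ∀ n → 1# ^ n ≡ 1#
  1^ zero    = refl
  1^ (suc n) = trans (*-identityˡ _) (1^ n)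

  ∣-shift : ∀ {d x y} → d ∣ x - y → d ∣ y → d ∣ x
  ∣-shift {x = x} {y} h k = ≡-∣ (solve 2 (λ x y → x :- y :+ y := x) refl x y) (∣-+ h k)

  -- From the Bernoulli recursion to a translation formula

  ∑-cong-< : ∀ n {f g : Seq} → (∀ i → i < n → f i ≡ g i) → ∑ n f ≡ ∑ n g
  ∑-cong-< zero    h = refl
  ∑-cong-< (suc n) h = cong₂ _+_ (∑-cong-< n (λ i i<n → h i (ℕₚ.m<n⇒m<1+n i<n))) (h n ℕₚ.≤-refl)

  #-ℕ* : ∀ m n → # (+ (m ℕ.* n)) ≡ # (+ m) * # (+ n)
  #-ℕ* m n = trans (cong #_ (ℤₚ.pos-* m n)) (#-* (+ m) (+ n))

  #-^ : ∀ a n → # (+ (a ℕ.^ n)) ≡ # (+ a) ^ n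
  #-^ a zero    = refl
  #-^ a (suc n) = trans (#-ℕ* a (a ℕ.^ n)) (cong (# (+ a) *_) (#-^ a n))

  F-binomial : ∀ c t (Z : Seq) j → F c t Z j ≡ ∑ (suc t) (λ i → # (+ (t C i)) * c ^ (t ∸ i) * Z (i ℕ.+ j))
  F-binomial c zero    Z j = solve 1 (λ z → z := con (+ 0) :+ con (+ 1) :* con (+ 1) :* z) refl (Z j)
  F-binomial c (suc t) Z j = begin
    F c t Z (suc j) + c * F c t Z j
      ≡⟨ cong₂ (λ x y → x + c * y) (F-binomial c t Z (suc j)) (F-binomial c t Z j) ⟩
    ∑ (suc t) f + c * ∑ (suc t) (λ i → # (+ (t C i)) * c ^ (t ∸ i) * Z (i ℕ.+ j))
      ≡⟨ cong (λ x → ∑ (suc t) f + x) (trans (sym (∑-* (suc t) c _)) (trans (sym (trans (cong (λ x → ∑ (suc t) h + x) top) (+-identityʳ _))) (∑-head (suc t) h))) ⟩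
    ∑ (suc t) f + (h 0 + ∑ (suc t) (λ i → h (suc i)))
      ≡⟨ solve 3 (λ x y z → x :+ (y :+ z) := y :+ (x :+ z)) refl _ _ _ ⟩
    h 0 + (∑ (suc t) f + ∑ (suc t) (λ i → h (suc i)))
      ≡⟨ cong₂ _+_ first (trans (sym (∑-+ (suc t) f (λ i → h (suc i)))) (∑-cong (suc t) pascal)) ⟩
    g 0 + ∑ (suc t) (λ i → g (suc i))
      ≡⟨ ∑-head (suc t) g ⟨
    ∑ (suc (suc t)) g ∎
    where
    open ≡-Reasoning
    f g h : Seq
    f i = # (+ (t C i)) * c ^ (t ∸ i) * Z (i ℕ.+ suc j)
    g i = # (+ (suc t C i)) * c ^ (suc t ∸ i) * Z (i ℕ.+ j)
    h i = c * (# (+ (t C i)) * c ^ (t ∸ i) * Z (i ℕ.+ j))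
    top : h (suc t) ≡ 0#
    top = trans (cong (λ k → c * (# (+ k) * c ^ (t ∸ suc t) * Z (suc t ℕ.+ j))) (k>n⇒nCk≡0 (ℕₚ.≤-refl {suc t})))
      (solve 3 (λ c x z → c :* (con (+ 0) :* x :* z) := con (+ 0)) refl c _ _)
    first : h 0 ≡ g 0
    first = trans (cong (λ k → c * (# (+ k) * c ^ t * Z j)) (trans (nC0≡1 t) (sym (nC0≡1 (suc t)))))
      (solve 4 (λ c k x z → c :* (k :* x :* z) := k :* (c :* x) :* z) refl c (# (+ (suc t C 0))) (c ^ t) (Z j))
    shift : ∀ i → c * (# (+ (t C suc i)) * c ^ (t ∸ suc i) * Z (suc i ℕ.+ j)) ≡ # (+ (t C suc i)) * c ^ (t ∸ i) * Z (suc i ℕ.+ j)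
    shift i with suc i ℕₚ.≤? t
    ... | yes i<t = trans (solve 4 (λ c k x z → c :* (k :* x :* z) := k :* (c :* x) :* z) refl c (# (+ (t C suc i))) (c ^ (t ∸ suc i)) _)
            (cong (λ k → # (+ (t C suc i)) * c ^ k * Z (suc i ℕ.+ j)) (sym (ℕₚ.+-∸-assoc 1 i<t)))
    -- Here the truncated differences `t ∸ i` and `t ∸ suc i` no longer differ by one, but the
    -- binomial coefficient is 0.
    ... | no  i≮t = trans (cong (λ k → c * (# (+ k) * c ^ (t ∸ suc i) * Z (suc i ℕ.+ j))) C≡0)
            (trans (solve 4 (λ c x y z → c :* (con (+ 0) :* x :* z) := con (+ 0) :* y :* z) refl c _ (c ^ (t ∸ i)) _)
              (cong (λ k → # (+ k) * c ^ (t ∸ i) * Z (suc i ℕ.+ j)) (sym C≡0)))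
      where
      C≡0 : t C suc i ≡ 0
      C≡0 = k>n⇒nCk≡0 (ℕₚ.≰⇒> i≮t)
    pascal : ∀ i → f i + h (suc i) ≡ g (suc i)
    pascal i = begin
      f i + h (suc i)
        ≡⟨ cong₂ _+_ (cong (λ k → # (+ (t C i)) * c ^ (t ∸ i) * Z k) (ℕₚ.+-suc i j)) (shift i) ⟩
      # (+ (t C i)) * c ^ (t ∸ i) * Z (suc i ℕ.+ j) + # (+ (t C suc i)) * c ^ (t ∸ i) * Z (suc i ℕ.+ j)
        ≡⟨ solve 4 (λ a b x z → a :* x :* z :+ b :* x :* z := (a :+ b) :* x :* z) refl (# (+ (t C i))) (# (+ (t C suc i))) (c ^ (t ∸ i)) _ ⟩
      (# (+ (t C i)) + # (+ (t C suc i))) * c ^ (t ∸ i) * Z (suc i ℕ.+ j)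
        ≡⟨ cong (λ x → x * c ^ (t ∸ i) * Z (suc i ℕ.+ j)) (trans (sym (#-+ (+ (t C i)) (+ (t C suc i)))) (cong (λ k → # (+ k)) (nCk+nC[k+1]≡[n+1]C[k+1] t i))) ⟩
      g (suc i) ∎

  -- The modulus is ν = N + 1, and `c n j` stands for νⁿ⁺¹⁻ʲ / (j! (n + 1 - j)!). After
  -- multiplication by n! and substitution of -(j + 1) L(j) for B(j + 1), the coefficient of L(j) is
  -- minus a binomial coefficient times νⁿ⁻ʲ. So the recursion is the expansion of Λ((x + ν)ⁿ)
  -- without its top term. B(0) drops out because the case n = 0 reads ν B(0) = S(0) = 0.
  bernoulli-functional : ∀ N (B L S : Seq) (c : ℕ → ℕ → Carrier) →
    (∀ n j → # (+ (j ! ℕ.* (suc n ∸ j) !)) * c n j ≡ # (+ suc N) ^ (suc n ∸ j)) →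
    (∀ n → # (+ (n !)) * ∑ (suc n) (λ j → c n j * B j) ≡ S n) →
    S 0 ≡ 0# →
    (∀ j → # (+ suc j) * L j ≡ - B (suc j)) →
    ∀ n → F (# (+ suc N)) n L 0 - L n ≡ - S n
  bernoulli-functional N B L S c hc hB S₀ hL n = begin
    F ν n L 0 - L n
      ≡⟨ cong (_- L n) (F-binomial ν n L 0) ⟩
    ∑ n f + f n - L n
      ≡⟨ cong (λ x → ∑ n f + x - L n) last ⟩
    ∑ n f + L n - L n
      ≡⟨ solve 3 (λ x l b → x :+ l :- l := con (+ 0) :+ :- (con -[1+ 0 ] :* x)) refl (∑ n f) (L n) 0# ⟩
    0# + - (-1# * ∑ n f)
      ≡⟨ trans (+-identityˡ _) (cong -_ (trans (sym (∑-* n -1# f)) (∑-cong-< n term))) ⟩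
    - ∑ n (λ j → # (+ (n !)) * (c n (suc j) * B (suc j)))
      ≡⟨ cong -_ (∑-* n (# (+ (n !))) _) ⟩
    - (# (+ (n !)) * ∑ n (λ j → c n (suc j) * B (suc j)))
      ≡⟨ cong (λ x → - (# (+ (n !)) * x)) (sym (trans (∑-head n _) (trans (cong (λ b → c n 0 * b + ∑ n (λ j → c n (suc j) * B (suc j))) B₀)
           (trans (cong (_+ ∑ n (λ j → c n (suc j) * B (suc j))) (zeroʳ _)) (+-identityˡ _))))) ⟩
    - (# (+ (n !)) * ∑ (suc n) (λ j → c n j * B j))
      ≡⟨ cong -_ (hB n) ⟩
    - S n ∎
    where
    open ≡-Reasoning
    ν : Carrier
    ν = # (+ suc N)
    f : Seq
    f j = # (+ (n C j)) * ν ^ (n ∸ j) * L (j ℕ.+ 0)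
    last : f n ≡ L n
    last = trans (cong₂ _*_ (cong₂ (λ k e → # (+ k) * ν ^ e) (nCn≡1 n) (ℕₚ.n∸n≡0 n)) (cong L (ℕₚ.+-identityʳ n)))
      (solve 1 (λ l → con (+ 1) :* con (+ 1) :* l := l) refl (L n))
    B₀ : B 0 ≡ 0#
    B₀ = *-cancel-# N (begin
      ν * B 0 ≡⟨ cong (_* B 0) (trans (sym (*-identityʳ ν)) (trans (sym (hc 0 0)) (*-identityˡ _))) ⟩
      c 0 0 * B 0 ≡⟨ solve 1 (λ x → x := con (+ 1) :* (con (+ 0) :+ x)) refl _ ⟩
      1# * (0# + c 0 0 * B 0) ≡⟨ trans (hB 0) S₀ ⟩
      0# ≡⟨ zeroʳ ν ⟨
      ν * 0#                           ∎)
    term : ∀ j → j < n → -1# * f j ≡ # (+ (n !)) * (c n (suc j) * B (suc j))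
    term j j<n = sym (begin
      # (+ (n !)) * (x * B (suc j))
        ≡⟨ cong₂ (λ a b → a * (x * b)) factorial (trans (solve 1 (λ b → b := :- (:- b)) refl (B (suc j))) (cong -_ (sym (hL j)))) ⟩
      k * (a * d) * (x * - (s * L j))
        ≡⟨ solve 6 (λ k a d x s l → k :* (a :* d) :* (x :* :- (s :* l)) := con -[1+ 0 ] :* (k :* (s :* a :* d :* x) :* l)) refl k a d x s (L j) ⟩
      -1# * (k * (s * a * d * x) * L j)
        ≡⟨ cong (λ y → -1# * (k * y * L j)) (trans (cong (_* x) (trans (cong (_* d) (sym (#-ℕ* (suc j) (j !)))) (sym (#-ℕ* (suc j ℕ.* j !) ((n ∸ j) !))))) (hc n (suc j))) ⟩
      -1# * (k * ν ^ (n ∸ j) * L j)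
        ≡⟨ cong (λ i → -1# * (k * ν ^ (n ∸ j) * L i)) (sym (ℕₚ.+-identityʳ j)) ⟩
      -1# * f j ∎)
      where
      k a d x s : Carrier
      k = # (+ (n C j))
      a = # (+ (j !))
      d = # (+ ((n ∸ j) !))
      x = c n (suc j)
      s = # (+ suc j)
      factorial : # (+ (n !)) ≡ k * (a * d)
      factorial = trans (cong (λ y → # (+ y)) (sym (nCk*k![n∸k]!≡n! (ℕₚ.<⇒≤ j<n))))
        (trans (#-ℕ* (n C j) (j ! ℕ.* (n ∸ j) !)) (cong (k *_) (#-ℕ* (j !) ((n ∸ j) !))))

  -- X b = χ(2b + 1), u = χ(5), ε = -χ(-1) and L k = L(-k, χ) for a character modulo 8 · 2ʳ.
  record LValues : Set where
    field
      r : ℕ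
      u ε : Carrier
      X L : Seq
      Int-u : Int u
      Int-X : ∀ b → Int (X b)
      ε-sign : ε ≡ 1# ⊎ ε ≡ -1#
      u-power : u ^ (2 ℕ.^ r) ≡ -1#
      X-antiperiodic : ∀ b → X (2 ℕ.^ suc r ℕ.+ b) ≡ - X b
      X-reflection : ∀ b b′ → suc (b ℕ.+ b′) ≡ 2 ℕ.^ suc r → X b ≡ ε * X b′
      X-powers : ∀ i → X (half5^ i) ≡ u ^ i
      -- The period 8M is written as 4M + 4M so that `F-F` exhibits it as two successive
      -- translations by 4M.
      L-functional : ∀ n → F (# (+ 4) * # (+ (2 ℕ.^ r)) + # (+ 4) * # (+ (2 ℕ.^ r))) n L 0 - L n
                         ≡ - ∑ (2 ℕ.^ suc (suc r)) (λ b → X b * odd b ^ n)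

  -- The functional equation for translation by 4M, and first congruences

  module LCongruences (D : LValues) where
    open LValues D
    M p₂M : ℕ
    M = 2 ℕ.^ r
    p₂M = 2 ℕ.* M

    z H π β Θ : Carrier
    z = # (+ M)
    H = # (+ 4) * z
    π = 1# - u
    β = ∑ M (u ^_)
    Θ = ∑ M (λ i → # (+ i) * u ^ i)

    P A : Seq
    P n = ∑ M (λ b → X b * odd b ^ n)
    A n = ∑ (2 ℕ.* M) (λ b → X b * odd b ^ n)

    -- s n = 1 if and only if n has the parity opposite to that of χ.
    s : Seq
    s n = ε * -1# ^ n

    Int-π : Int π
    Int-π = Int-- (Int-# _) Int-u

    Int-β : Int β
    Int-β = ∑-Int M (Int-^ Int-u)

    Int-z : Int z
    Int-z = Int-# _

    double : ∀ m → 2 ℕ.* m ≡ m ℕ.+ m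
    double m = cong (m ℕ.+_) (ℕₚ.+-identityʳ m)

    π*β : π * β ≡ 2#
    π*β = trans (geometric u M) (trans (cong (λ x → 1# - x) u-power)
      (solve 0 (con (+ 1) :- con -[1+ 0 ] := con (+ 2)) refl))

    π*Θ : π * Θ ≡ z + β - 2#
    π*Θ = trans (weighted-geometric u M) (trans (cong (λ x → β - 1# + (1# - z) * x) u-power)
      (solve 2 (λ b z → b :- con (+ 1) :+ (con (+ 1) :- z) :* con -[1+ 0 ] := z :+ b :- con (+ 2)) refl β z))

    β∣2 : β ∣ 2#
    β∣2 = π , Int-π , trans (sym π*β) (*-comm π β)

    s-sign : ∀ n → s n ≡ 1# ⊎ s n ≡ -1#
    s-sign zero    with ε-sign
    ... | inj₁ e = inj₁ (trans (*-identityʳ ε) e)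
    ... | inj₂ e = inj₂ (trans (*-identityʳ ε) e)
    s-sign (suc n) with s-sign n
    ... | inj₁ e = inj₂ (trans (solve 3 (λ e m x → e :* (m :* x) := m :* (e :* x)) refl ε -1# (-1# ^ n)) (trans (cong (-1# *_) e) (*-identityʳ -1#)))
    ... | inj₂ e = inj₁ (trans (solve 3 (λ e m x → e :* (m :* x) := m :* (e :* x)) refl ε -1# (-1# ^ n)) (trans (cong (-1# *_) e)
         (solve 0 (con -[1+ 0 ] :* con -[1+ 0 ] := con (+ 1)) refl)))

    s-pred : ∀ n → s (suc n) ≡ 1# → s n ≡ -1#
    s-pred n e = trans (solve 2 (λ e x → e :* x := con -[1+ 0 ] :* (e :* (con -[1+ 0 ] :* x))) refl ε (-1# ^ n)) (trans (cong (-1# *_) e) (*-identityʳ -1#))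

    -1^2^ : ∀ n → -1# ^ suc 2^ suc n ∸1 ≡ 1#
    -1^2^ zero    = solve 0 (con -[1+ 0 ] :* (con -[1+ 0 ] :* con (+ 1)) := con (+ 1)) refl
    -1^2^ (suc n) = trans (^-+ -1# (suc 2^ suc n ∸1) (suc 2^ suc n ∸1))
      (trans (cong₂ _*_ (-1^2^ n) (-1^2^ n)) (*-identityʳ 1#))

    s-periodic : ∀ n k → s (suc 2^ suc n ∸1 ℕ.+ k) ≡ s k
    s-periodic n k = cong (ε *_) (trans (^-+ -1# (suc 2^ suc n ∸1) k) (trans (cong (_* (-1# ^ k)) (-1^2^ n)) (*-identityˡ _)))

    odd-2M+ : ∀ b → odd (2 ℕ.* M ℕ.+ b) ≡ odd b + H
    odd-2M+ b = trans (odd-+ (2 ℕ.* M) b) (cong (λ x → odd b + x) (trans (cong (2# *_) (#-double M))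
      (solve 1 (λ z → con (+ 2) :* (con (+ 2) :* z) := con (+ 4) :* z) refl z)))

    S-split : ∀ n → ∑ (2 ℕ.* (2 ℕ.* M)) (λ b → X b * odd b ^ n) ≡ A n - F H n A 0
    S-split n = begin
      ∑ (2 ℕ.* p₂M) f
        ≡⟨ cong (λ k → ∑ k f) (double p₂M) ⟩
      ∑ (p₂M ℕ.+ p₂M) f
        ≡⟨ ∑-split p₂M p₂M f ⟩
      A n + ∑ p₂M (λ b → f (p₂M ℕ.+ b))
        ≡⟨ cong (λ x → A n + x) (∑-cong p₂M (λ b → trans (cong₂ (λ x y → x * y ^ n) (X-antiperiodic b) (odd-2M+ b))
             (solve 2 (λ x y → :- x :* y := con -[1+ 0 ] :* (x :* y)) refl _ _))) ⟩
      A n + ∑ p₂M (λ b → -1# * (X b * (odd b + H) ^ n))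
        ≡⟨ cong (λ x → A n + x) (∑-* p₂M -1# (λ b → X b * (odd b + H) ^ n)) ⟩
      A n + -1# * ∑ p₂M (λ b → X b * (odd b + H) ^ n)
        ≡⟨ solve 2 (λ x y → x :+ con -[1+ 0 ] :* y := x :- y) refl _ _ ⟩
      A n - ∑ p₂M (λ b → X b * (odd b + H) ^ n)
        ≡⟨ cong (λ x → A n - x) (F-∑ H n p₂M X odd) ⟨
      A n - F H n A 0 ∎
      where
      open ≡-Reasoning
      f : Seq
      f b = X b * odd b ^ n

    F-F₀ : ∀ c n (Z : Seq) → F c n (λ i → F c i Z 0) 0 ≡ F (c + c) n Z 0
    F-F₀ c n Z = F-F c c n Z 0 0

    -- Writing T for translation by 4M, the functional equation reads (T² - 1)Λ = (T - 1)A. Thus (T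
    -- + 1)Λ - A is invariant under T, and `F-fixed` makes it zero.
    L+FL : ∀ n → L n + F H n L 0 ≡ A n
    L+FL n = trans (solve 2 (λ x a → x := (x :+ con -[1+ 0 ] :* a) :+ a) refl (L n + F H n L 0) (A n))
      (trans (cong (_+ A n) (vanish n)) (+-identityˡ _))
      where
      open ≡-Reasoning
      Y : Seq
      Y n = (L n + 1# * F H n L 0) + -1# * A n
      fixed : ∀ n → F H n Y 0 ≡ Y n
      fixed n = begin
        F H n Y 0
          ≡⟨ F-linear H -1# n (λ n → L n + 1# * F H n L 0) A 0 ⟩
        F H n (λ n → L n + 1# * F H n L 0) 0 + -1# * F H n A 0
          ≡⟨ cong (_+ -1# * F H n A 0) (F-linear H 1# n L (λ n → F H n L 0) 0) ⟩
        F H n L 0 + 1# * F H n (λ i → F H i L 0) 0 + -1# * F H n A 0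
          ≡⟨ cong (λ x → F H n L 0 + 1# * x + -1# * F H n A 0) (trans (F-F₀ H n L) (solve 2 (λ x y → x := x :- y :+ y) refl _ (L n))) ⟩
        F H n L 0 + 1# * (F (H + H) n L 0 - L n + L n) + -1# * F H n A 0
          ≡⟨ cong (λ x → F H n L 0 + 1# * (x + L n) + -1# * F H n A 0) (trans (L-functional n) (cong -_ (S-split n))) ⟩
        F H n L 0 + 1# * (- (A n - F H n A 0) + L n) + -1# * F H n A 0
          ≡⟨ identity (F H n L 0) (A n) (F H n A 0) (L n) ⟩
        Y n ∎
        where
        identity : ∀ f a g l → f + 1# * (- (a - g) + l) + -1# * g ≡ (l + 1# * f) + -1# * a
        identity = solve 4 (λ f a g l → f :+ con (+ 1) :* (:- (a :- g) :+ l) :+ con -[1+ 0 ] :* g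
          := (l :+ con (+ 1) :* f) :+ con -[1+ 0 ] :* a) refl
      H-suc : ∃ λ k → H ≡ # (+ suc k)
      H-suc = ℕ.pred (4 ℕ.* M) , trans (sym (#-* (+ 4) (+ M))) (trans (cong #_ (sym (ℤₚ.pos-* 4 M))) (cong (λ k → # (+ k)) (sym (ℕₚ.suc-pred (4 ℕ.* M) {{ℕₚ.m*n≢0 4 M {{_}} {{ℕₚ.m^n≢0 2 r}}}}))))
      vanish : ∀ n → (L n + F H n L 0) + -1# * A n ≡ 0#
      vanish n = trans (cong (λ x → L n + x + -1# * A n) (sym (*-identityˡ _)))
        (F-fixed (proj₁ H-suc) {Y} (λ t → subst (λ h → F h t Y 0 ≡ Y t) (proj₂ H-suc) (fixed t)) n)

    neg-^ : ∀ x n → (- x) ^ n ≡ -1# ^ n * x ^ n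
    neg-^ x zero    = sym (*-identityʳ _)
    neg-^ x (suc n) = trans (cong (- x *_) (neg-^ x n))
      (solve 3 (λ x a b → :- x :* (a :* b) := con -[1+ 0 ] :* a :* (x :* b)) refl x _ _)

    -- Divisibility by 0 is equality, so `∑-reverse`, proved modulo d, also delivers exact
    -- identities.
    0∣⇒≡ : ∀ {x y} → 0# ∣ x - y → x ≡ y
    0∣⇒≡ {x} {y} (q , _ , e) = trans (solve 2 (λ x y → x := x :- y :+ y) refl x y)
      (trans (cong (_+ y) e) (solve 2 (λ q y → con (+ 0) :* q :+ y := y) refl q y))

    -- For a < 2M the weight of 4M - a is ε χ(a), and (4M - a)ⁿ = (-1)ⁿ (a - 4M)ⁿ. This accounts for
    -- the sign `s n` and for the negative translation.
    A-split : ∀ n → A n ≡ P n + s n * F (# (+ 4) * - z) n P 0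
    A-split n = begin
      A n
        ≡⟨ cong (λ k → ∑ k f) (double M) ⟩
      ∑ (M ℕ.+ M) f
        ≡⟨ ∑-split M M f ⟩
      P n + ∑ M (λ b → f (M ℕ.+ b))
        ≡⟨ cong (λ x → P n + x) (0∣⇒≡ (∑-reverse M (λ i j e → ≡-∣ (sym (trans (cong (λ x → x - g j) (reflect i j e)) (-‿inverseʳ (g j)))) ∣-0))) ⟩
      P n + ∑ M g
        ≡⟨ cong (λ x → P n + x) (∑-* M (s n) (λ b → X b * (odd b + # (+ 4) * - z) ^ n)) ⟩
      P n + s n * ∑ M (λ b → X b * (odd b + # (+ 4) * - z) ^ n)
        ≡⟨ cong (λ x → P n + s n * x) (F-∑ (# (+ 4) * - z) n M X odd) ⟨
      P n + s n * F (# (+ 4) * - z) n P 0 ∎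
      where
      open ≡-Reasoning
      f g : Seq
      f b = X b * odd b ^ n
      g b = s n * (X b * (odd b + # (+ 4) * - z) ^ n)
      reflect : ∀ i j → suc (i ℕ.+ j) ≡ M → f (M ℕ.+ i) ≡ g j
      reflect i j e = begin
        X (M ℕ.+ i) * odd (M ℕ.+ i) ^ n
          ≡⟨ cong₂ (λ x y → x * y ^ n) (X-reflection (M ℕ.+ i) j e′)
               (trans (odd-reflect (M ℕ.+ i) j p₂M e′) (trans (cong (λ x → 2# * x - odd j) (#-double M))
                 (solve 2 (λ z o → con (+ 2) :* (con (+ 2) :* z) :- o := :- (o :+ con (+ 4) :* (:- z))) refl z (odd j)))) ⟩
        ε * X j * (- (odd j + # (+ 4) * - z)) ^ n
          ≡⟨ cong (ε * X j *_) (neg-^ _ n) ⟩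
        ε * X j * (-1# ^ n * (odd j + # (+ 4) * - z) ^ n)
          ≡⟨ solve 4 (λ e x m o → e :* x :* (m :* o) := e :* m :* (x :* o)) refl ε (X j) _ _ ⟩
        g j ∎
        where
        e′ : suc (M ℕ.+ i ℕ.+ j) ≡ p₂M
        e′ = trans (cong suc (ℕₚ.+-assoc M i j)) (trans (sym (ℕₚ.+-suc M (i ℕ.+ j))) (trans (cong (M ℕ.+_) e) (sym (double M))))

    L-equation : ∀ n → L n + F (# (+ 4) * z) n L 0 ≡ P n + s n * F (# (+ 4) * - z) n P 0
    L-equation n = trans (L+FL n) (A-split n)

    Int-z′ : Int (- z)
    Int-z′ = Int-neg Int-z

    Int-H : Int H
    Int-H = Int-* (Int-# _) Int-z

    Int-H′ : Int (# (+ 4) * - z)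
    Int-H′ = Int-* (Int-# _) Int-z′

    ε²-odd : 2# ∣ 1# - ε
    ε²-odd with ε-sign
    ... | inj₁ e = ≡-∣ (trans (sym (-‿inverseʳ 1#)) (cong (λ x → 1# - x) (sym e))) ∣-0
    ... | inj₂ e = ≡-∣ (trans (solve 0 (con (+ 2) := con (+ 1) :- con -[1+ 0 ]) refl) (cong (λ x → 1# - x) (sym e))) ∣-refl

    -- Modulo 2 the character is even and 4M-periodic.
    ∑X-powers-of-5 : ∀ (w : Seq) → (∀ b → Int (w b)) →
      (∀ b → 2# ∣ w (2 ℕ.* M ℕ.+ b) - w b) → (∀ b b′ → suc (b ℕ.+ b′) ≡ 2 ℕ.* M → 2# ∣ w b - w b′) →
      2# ∣ ∑ M (λ b → X b * w b) - ∑ M (λ i → u ^ i * w (half5^ i))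
    ∑X-powers-of-5 w iw per ref = ≡-∣
      (cong (λ x → ∑ M (λ b → X b * w b) - x) (∑-cong M (λ i → cong (_* w (half5^ i)) (X-powers i))))
      (∑-powers-of-5 r (λ b → X b * w b)
        (λ b → ≡-∣ (trans
            (solve 3 (λ x v w → x :* (w :- v) :+ con (+ 2) :* (:- x :* w) := :- x :* w :- x :* v) refl (X b) (w b) (w (2 ℕ.* M ℕ.+ b)))
            (cong (λ x → x * w (2 ℕ.* M ℕ.+ b) - X b * w b) (sym (X-antiperiodic b))))
          (∣-+ (∣-*ˡ (Int-X b) (per b)) (Int⇒∣ (Int-* (Int-neg (Int-X b)) (iw _)))))
        (λ b b′ e → ≡-∣ (trans
            (solve 4 (λ x v w e → (x :* e) :* (v :- w) :- (x :* w) :* (con (+ 1) :- e) := e :* x :* v :- x :* w) refl (X b′) (w b) (w b′) ε)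
            (cong (λ x → x * w b - X b′ * w b′) (sym (X-reflection b b′ e))))
          (∣-- (∣-*ˡ (Int-* (Int-X b′) Int-ε) (ref b b′ e)) (∣-*ˡ (Int-* (Int-X b′) (iw b′)) ε²-odd))))
      where
      Int-ε : Int ε
      Int-ε with ε-sign
      ... | inj₁ e = subst Int (sym e) (Int-# _)
      ... | inj₂ e = subst Int (sym e) (Int-# _)

    P≡β : ∀ n → 2# ∣ P n - β
    P≡β n = ∣-telescope
      (∑-mod M {λ b → X b * odd b ^ n} {λ b → X b * 1#} (λ b → ≡-∣ (solve 2 (λ x y → x :* (y :- con (+ 1)) := x :* y :- x :* con (+ 1)) refl (X b) _)
        (∣-*ˡ (Int-X b) (odd^-∣ b n))))
      (≡-∣ (cong (λ x → ∑ M (λ b → X b * 1#) - x) (∑-cong M (λ i → *-identityʳ (u ^ i))))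
        (∑X-powers-of-5 (λ _ → 1#) (λ _ → Int-# _) (λ _ → trivial) (λ _ _ _ → trivial)))
      where
      trivial : 2# ∣ 1# - 1#
      trivial = ≡-∣ (sym (-‿inverseʳ 1#)) ∣-0

    β∣P : ∀ n → β ∣ P n
    β∣P n = ∣-shift (∣-trans β∣2 (P≡β n)) ∣-refl

    M-cases : r ≡ 0 ⊎ 2# ∣ z
    M-cases with r
    ... | zero  = inj₁ refl
    ... | suc k = inj₂ (# (+ (2 ℕ.^ k)) , Int-# _ , #-double (2 ℕ.^ k))

    -- For r = 0 both sides are 1; otherwise β divides 2 and 2 divides M.
    β∣z : β ∣ z
    β∣z = go r refl
      where
      go : ∀ k → k ≡ r → ∑ (2 ℕ.^ k) (u ^_) ∣ # (+ (2 ℕ.^ k))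
      go zero    e = 1# , Int-# _ , solve 0 (con (+ 1) := (con (+ 0) :+ con (+ 1)) :* con (+ 1)) refl
      go (suc k) e = subst (λ j → ∑ (2 ℕ.^ j) (u ^_) ∣ # (+ (2 ℕ.^ suc k))) (sym e)
        (∣-trans β∣2 (# (+ (2 ℕ.^ k)) , Int-# _ , #-double (2 ℕ.^ k)))

    -- Under a ↦ a + 4M and a ↦ 4M - a the number (a² - 1)/8 changes by an odd multiple of M, up to
    -- sign, so its parity has the symmetries needed to pass to powers of 5 only for even M. For M =
    -- 1 each sum has one term, and that term is 0.
    ∑X-triangle : 2# ∣ ∑ M (λ b → X b * # (+ triangle b)) - Θ
    ∑X-triangle = ∣-telescope {y = ∑ M (λ i → u ^ i * # (+ triangle (half5^ i)))} (reduce M-cases)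
      (∑-mod M (λ i → ≡-∣ (solve 3 (λ t i u → u :* (t :- i) := u :* t :- i :* u) refl _ _ _)
        (∣-*ˡ (Int-^ Int-u i) (triangle-half5^ i))))
      where
      w : Seq
      w b = # (+ triangle b)
      diff : ∀ {o o′ x y : Carrier} → o′ ≡ x → x * x - o * o ≡ y → o′ * o′ - o * o ≡ y
      diff refl e = e
      reduce : r ≡ 0 ⊎ 2# ∣ z → 2# ∣ ∑ M (λ b → X b * w b) - ∑ M (λ i → u ^ i * w (half5^ i))
      reduce (inj₁ e) = subst (λ k → 2# ∣ ∑ (2 ℕ.^ k) (λ b → X b * w b) - ∑ (2 ℕ.^ k) (λ i → u ^ i * w (half5^ i))) (sym e)
        (≡-∣ (solve 2 (λ x y → con (+ 0) := con (+ 0) :+ x :* con (+ 0) :- (con (+ 0) :+ y :* con (+ 0))) refl (X 0) 1#) ∣-0)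
      reduce (inj₂ 2∣z) = ∑X-powers-of-5 w (λ _ → Int-# _)
        (λ b → ≡-∣ (sym (triangle-difference {b = b} {2 ℕ.* M ℕ.+ b} (diff (odd-2M+ b)
            (solve 2 (λ o z → (o :+ con (+ 4) :* z) :* (o :+ con (+ 4) :* z) :- o :* o := con (+ 8) :* ((o :+ con (+ 2) :* z) :* z)) refl (odd b) z))))
          (∣-*ˡ (Int-+ (Int-odd b) (Int-* (Int-# _) Int-z)) 2∣z))
        (λ b b′ e → ≡-∣ (sym (triangle-difference {b = b′} {b} (diff
            (trans (odd-reflect b b′ (2 ℕ.* M) e) (cong (λ x → 2# * x - odd b′) (#-double M)))
            (solve 2 (λ o z → (con (+ 2) :* (con (+ 2) :* z) :- o) :* (con (+ 2) :* (con (+ 2) :* z) :- o) :- o :* o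
               := con (+ 8) :* ((con (+ 2) :* z :- o) :* z)) refl (odd b′) z))))
          (∣-*ˡ (Int-- (Int-* (Int-# _) Int-z) (Int-odd b′)) 2∣z))

    -- By `odd^2^` the term of a = 2b + 1 changes by 2ⁿ⁺³ χ(a) T aᵏ modulo 2ⁿ⁺⁴, where T = (a² -
    -- 1)/8. The factor aᵏ is odd, and `∑X-triangle` evaluates what remains modulo 2.
    P-difference : ∀ n k → 2# ^ (4 ℕ.+ n) ∣ P (suc 2^ suc n ∸1 ℕ.+ k) - P k - 2# ^ (3 ℕ.+ n) * Θ
    P-difference n k = ≡-∣ regroup (∣-+ termwise reduced)
      where
      t : ℕ
      t = suc 2^ suc n ∸1
      E : Carrier
      E = 2# ^ (3 ℕ.+ n)
      T : Seq
      T b = X b * # (+ triangle b)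
      *2 : ∀ {x} → 2# ∣ x → 2# ^ (4 ℕ.+ n) ∣ E * x
      *2 h = ∣-≡ (*-comm E 2#) (*-mono-∣ (∣-refl {E}) h)
      term : ∀ b → 2# ^ (4 ℕ.+ n) ∣ X b * odd b ^ (t ℕ.+ k) - (X b * odd b ^ k + E * T b)
      term b with odd^2^ n b
      ... | w , iw , eq = ≡-∣
        (trans (identity (X b) (odd b ^ k) E (# (+ triangle b)) w)
          (cong (λ y → X b * y - (X b * odd b ^ k + E * T b)) (trans (cong (_* odd b ^ k) (sym eq)) (sym (^-+ (odd b) t k)))))
        (*2 (∣-*ˡ (Int-X b) (∣-+ (∣-*ˡ (Int-# _) (odd^-∣ b k)) (Int⇒∣ (Int-* iw (Int-^ (Int-odd b) k))))))
        where
        identity : ∀ x o E t w → E * (x * (t * (o - 1#) + 2# * (w * o))) ≡ x * ((1# + E * (t + 2# * w)) * o) - (x * o + E * (x * t))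
        identity = solve 5 (λ x o E t w → E :* (x :* (t :* (o :- con (+ 1)) :+ con (+ 2) :* (w :* o)))
          := x :* ((con (+ 1) :+ E :* (t :+ con (+ 2) :* w)) :* o) :- (x :* o :+ E :* (x :* t))) refl
      termwise : 2# ^ (4 ℕ.+ n) ∣ P (t ℕ.+ k) - (P k + E * ∑ M T)
      termwise = ≡-∣ (cong (λ x → P (t ℕ.+ k) - x) (trans (∑-+ M (λ b → X b * odd b ^ k) (λ b → E * T b)) (cong (λ x → P k + x) (∑-* M E T))))
        (∑-mod M term)
      reduced : 2# ^ (4 ℕ.+ n) ∣ E * (∑ M T - Θ)
      reduced = *2 ∑X-triangle
      regroup : P (t ℕ.+ k) - (P k + E * ∑ M T) + E * (∑ M T - Θ) ≡ P (t ℕ.+ k) - P k - E * Θ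
      regroup = solve 5 (λ x y e s t → x :- (y :+ e :* s) :+ e :* (s :- t) := x :- y :- e :* t) refl _ _ _ _ _

    -- The three claims are proved together because `F₀-leading` at n asks for β ∣ L(i) at all i <
    -- n, whatever their parity. By `L-equation`, 2(L - P) = ΔP - ΔL if `s n` is 1 and 2L = -ΔP - ΔL
    -- if it is -1. Both Δ are divisible by 4β, and cancelling 2 leaves 2β.
    L-good : ∀ n → β ∣ L n × (s n ≡ 1# → 2# * β ∣ L n - P n) × (s n ≡ -1# → 2# * β ∣ L n)
    L-good = <-rec _ step
      where
      step : ∀ n → (∀ {i} → i < n → β ∣ L i × (s i ≡ 1# → 2# * β ∣ L i - P i) × (s i ≡ -1# → 2# * β ∣ L i)) →
             β ∣ L n × (s n ≡ 1# → 2# * β ∣ L n - P n) × (s n ≡ -1# → 2# * β ∣ L n)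
      step n ih = good (s-sign n) , plus , minus
        where
        ΔL ΔP : Carrier
        ΔL = F H n L 0 - L n
        ΔP = F (# (+ 4) * - z) n P 0 - P n
        quarter : ∀ {y} → Int y → 2# * (2# * β) ∣ # (+ 4) * y * β
        quarter {y} iy = y , iy , solve 2 (λ y b → con (+ 4) :* y :* b := con (+ 2) :* (con (+ 2) :* b) :* y) refl y β
        ΔL∣ : 2# * (2# * β) ∣ ΔL
        ΔL∣ = ∣-trans (quarter Int-z) (F₀-leading Int-H n (λ i i<n → proj₁ (ih i<n)))
        ΔP∣ : 2# * (2# * β) ∣ ΔP
        ΔP∣ = ∣-trans (quarter Int-z′) (F₀-leading Int-H′ n (λ i _ → β∣P i))
        equation : ∀ {c} → s n ≡ c → L n + F H n L 0 ≡ P n + c * F (# (+ 4) * - z) n P 0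
        equation refl = L-equation n
        move : ∀ {x y d e} → x ≡ y → e ≡ d + (x - y) → d ≡ e
        move {x} {d = d} refl e = trans (solve 2 (λ d x → d := d :+ (x :- x)) refl d x) (sym e)
        plus : s n ≡ 1# → 2# * β ∣ L n - P n
        plus e = *-cancel-∣ 1 (≡-∣ (move (equation e)
            (solve 4 (λ l f p g → con (+ 2) :* (l :- p) := g :- p :- (f :- l) :+ (l :+ f :- (p :+ con (+ 1) :* g))) refl _ _ _ _))
          (∣-- ΔP∣ ΔL∣))
        minus : s n ≡ -1# → 2# * β ∣ L n
        minus e = *-cancel-∣ 1 (≡-∣ (move (equation e)
            (solve 4 (λ l f p g → con (+ 2) :* l := :- (g :- p) :- (f :- l) :+ (l :+ f :- (p :+ con -[1+ 0 ] :* g))) refl _ _ _ _))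
          (∣-- (∣-neg ΔP∣) ΔL∣))
        2β : β ∣ 2# * β
        2β = 2# , Int-# _ , *-comm 2# β
        good : s n ≡ 1# ⊎ s n ≡ -1# → β ∣ L n
        good (inj₁ e) = ∣-shift (∣-trans 2β (plus e)) (β∣P n)
        good (inj₂ e) = ∣-trans 2β (minus e)

    L≡β : ∀ n → s n ≡ 1# → 2# ∣ L n - β
    L≡β n e = ∣-telescope (∣-trans (β , Int-β , refl) (proj₁ (proj₂ (L-good n)) e)) (P≡β n)

    Int-Θ : Int Θ
    Int-Θ = ∑-Int M (λ i → Int-* (Int-# _) (Int-^ Int-u i))

    -- Differences of L-values at exponents 2ⁿ⁺¹ apart

    module Difference (n : ℕ) where
      p t : ℕ
      p = 2^ suc n ∸1
      t = suc p

      -- Since the exponent of the theorem is n + 1 here, the moduli of its second and first claims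
      -- are 2e and 4e.
      e : Carrier
      e = 2# ^ (2 ℕ.+ n)

      ΔL ΔP δL δP : Seq
      ΔL k = (F H (k ℕ.+ t) L 0 - L (t ℕ.+ k)) - (F H k L 0 - L k)
      ΔP k = (F (# (+ 4) * - z) (k ℕ.+ t) P 0 - P (t ℕ.+ k)) - (F (# (+ 4) * - z) k P 0 - P k)
      δL k = L (t ℕ.+ k) - L k
      δP k = P (t ℕ.+ k) - P k

      2e∣⇒eβ∣ : ∀ {x} → 2# * e ∣ x → e * β ∣ x
      2e∣⇒eβ∣ = ∣-trans (π , Int-π , trans (*-comm 2# e) (trans (cong (e *_) (sym π*β)) (solve 3 (λ e p b → e :* (p :* b) := e :* b :* p) refl e π β)))

      P-weak : ∀ k → e * β ∣ δP k
      P-weak k = 2e∣⇒eβ∣ (∣-shift (∣-trans (2# , Int-# _ , *-comm 2# (2# * e)) (P-difference n k)) (Int⇒∣ Int-Θ))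

      ΔP∣ : ∀ k → 2# * (2# * e) * β ∣ ΔP k - 2# * e * - z * P (p ℕ.+ k)
      ΔP∣ k = F-difference Int-z′ (suc n) k P β∣P (λ i _ → P-weak i)

      -- Subtract `L-equation` at k from the one at k + t; the sign is the same in both since t is
      -- even.
      equation : ∀ k {c} → s k ≡ c → 2# * δL k + ΔL k ≡ δP k + c * (ΔP k + δP k)
      equation k refl = begin
        2# * δL k + ΔL k
          ≡⟨ solve 4 (λ l m f g → con (+ 2) :* (l :- m) :+ (f :- l :- (g :- m)) := (l :+ f) :- (m :+ g)) refl (L (t ℕ.+ k)) (L k) (F H (k ℕ.+ t) L 0) (F H k L 0) ⟩
        (L (t ℕ.+ k) + F H (k ℕ.+ t) L 0) - (L k + F H k L 0)
          ≡⟨ cong₂ _-_ (trans (cong (λ i → L i + F H (k ℕ.+ t) L 0) (ℕₚ.+-comm t k)) (L-equation (k ℕ.+ t))) (L-equation k) ⟩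
        (P (k ℕ.+ t) + s (k ℕ.+ t) * f) - (P k + s k * g)
          ≡⟨ cong (λ i → (P i + s i * f) - (P k + s k * g)) (ℕₚ.+-comm k t) ⟩
        (P (t ℕ.+ k) + s (t ℕ.+ k) * f) - (P k + s k * g)
          ≡⟨ cong (λ c → (P (t ℕ.+ k) + c * f) - (P k + s k * g)) (s-periodic n k) ⟩
        (P (t ℕ.+ k) + s k * f) - (P k + s k * g)
          ≡⟨ solve 5 (λ p q f g s → p :+ s :* f :- (q :+ s :* g) := p :- q :+ s :* (f :- p :- (g :- q) :+ (p :- q))) refl (P (t ℕ.+ k)) (P k) f g (s k) ⟩
        δP k + s k * (ΔP k + δP k) ∎
        where
        open ≡-Reasoning
        f g : Carrier
        f = F (# (+ 4) * - z) (k ℕ.+ t) P 0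
        g = F (# (+ 4) * - z) k P 0

      move : ∀ {x y a b} → x ≡ y → b ≡ a + (x - y) → a ≡ b
      move {x} {a = a} refl eq = trans (solve 2 (λ a x → a := a :+ (x :- x)) refl a x) (sym eq)

      plus-equation : ∀ k → s k ≡ 1# → 2# * δL k ≡ 2# * δP k + ΔP k - ΔL k
      plus-equation k sk = sym (move (equation k sk)
        (solve 4 (λ l m p q → con (+ 2) :* l := con (+ 2) :* p :+ q :- m :+ (con (+ 2) :* l :+ m :- (p :+ con (+ 1) :* (q :+ p)))) refl (δL k) (ΔL k) (δP k) (ΔP k)))

      minus-equation : ∀ k → s k ≡ -1# → 2# * δL k ≡ - (ΔP k) - ΔL k
      minus-equation k sk = sym (move (equation k sk)
        (solve 4 (λ l m p q → con (+ 2) :* l := :- q :- m :+ (con (+ 2) :* l :+ m :- (p :+ con -[1+ 0 ] :* (q :+ p)))) refl (δL k) (ΔL k) (δP k) (ΔP k)))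

      -- A crude bound whose purpose is to feed `F-difference` applied to L. At k that lemma
      -- consults only smaller indices, which have both parities, hence strong induction with both
      -- signs.
      L-weak : ∀ k → e * β ∣ δL k
      L-weak = <-rec _ step
        where
        step : ∀ k → (∀ {i} → i < k → e * β ∣ δL i) → e * β ∣ δL k
        step k ih = by-sign (s-sign k)
          where
          4→2 : ∀ {x} → 2# * (2# * e) * β ∣ x → 2# * (e * β) ∣ x
          4→2 = ∣-trans (2# , Int-# _ , solve 2 (λ e b → con (+ 2) :* (con (+ 2) :* e) :* b := con (+ 2) :* (e :* b) :* con (+ 2)) refl e β)
          main : ∀ {y x} → Int y → β ∣ x → 2# * (e * β) ∣ 2# * e * y * x
          main {y} iy h = ∣-trans (y , iy , solve 3 (λ e b y → con (+ 2) :* e :* y :* b := con (+ 2) :* (e :* b) :* y) refl e β y)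
            (*-mono-∣ (∣-refl {2# * e * y}) h)
          L′ : 2# * (e * β) ∣ ΔL k
          L′ = ∣-shift (4→2 (F-difference Int-z (suc n) k L (λ i → proj₁ (L-good i)) (λ i i<k → ih i<k))) (main Int-z (proj₁ (L-good (p ℕ.+ k))))
          P′ : 2# * (e * β) ∣ ΔP k
          P′ = ∣-shift (4→2 (ΔP∣ k)) (main Int-z′ (β∣P (p ℕ.+ k)))
          by-sign : s k ≡ 1# ⊎ s k ≡ -1# → e * β ∣ δL k
          by-sign (inj₁ sk) = *-cancel-∣ 1 (≡-∣ (sym (plus-equation k sk)) (∣-- (∣-+ (*-mono-∣ (∣-refl {2#}) (P-weak k)) P′) L′))
          by-sign (inj₂ sk) = *-cancel-∣ 1 (≡-∣ (sym (minus-equation k sk)) (∣-- (∣-neg P′) L′))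

      ΔL∣ : ∀ k → 2# * (2# * e) * β ∣ ΔL k - 2# * e * z * L (p ℕ.+ k)
      ΔL∣ k = F-difference Int-z (suc n) k L (λ i → proj₁ (L-good i)) (λ i _ → L-weak i)

      -- This is half of `plus-equation`. ΔP contributes -2e M P(p + k); its counterpart 2e M L(p +
      -- k) in ΔL is negligible, because p is odd and so 2β ∣ L(p + k) by the opposite-sign case of
      -- `L-good`.
      δL≡δP : ∀ k → s k ≡ 1# → 2# * e * β ∣ δL k - δP k + e * z * P (p ℕ.+ k)
      δL≡δP k sk = *-cancel-∣ 1 (∣-≡ (*-assoc 2# (2# * e) β) (≡-∣ (sym total) (∣-- (∣-- (ΔP∣ k) (ΔL∣ k)) wL)))
        where
        q l : Carrier
        q = P (p ℕ.+ k)
        l = L (p ℕ.+ k)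
        wL : 2# * (2# * e) * β ∣ 2# * e * z * l
        wL = ∣-trans (z , Int-z , solve 3 (λ e b z → con (+ 2) :* e :* z :* (con (+ 2) :* b) := con (+ 2) :* (con (+ 2) :* e) :* b :* z) refl e β z)
          (*-mono-∣ (∣-refl {2# * e * z}) (proj₂ (proj₂ (L-good (p ℕ.+ k))) (s-pred (p ℕ.+ k) (trans (s-periodic n k) sk))))
        total : 2# * (δL k - δP k + e * z * q) ≡ (ΔP k - 2# * e * - z * q) - (ΔL k - 2# * e * z * l) - 2# * e * z * l
        total = trans (lhs (δL k) (δP k) e z q) (trans (cong (λ x → x - 2# * δP k + 2# * e * z * q) (plus-equation k sk)) (rhs (δP k) (ΔP k) (ΔL k) e z q l))
          where
          lhs : ∀ x y e z q → 2# * (x - y + e * z * q) ≡ 2# * x - 2# * y + 2# * e * z * q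
          lhs = solve 5 (λ x y e z q → con (+ 2) :* (x :- y :+ e :* z :* q) := con (+ 2) :* x :- con (+ 2) :* y :+ con (+ 2) :* e :* z :* q) refl
          rhs : ∀ d x y e z q l → (2# * d + x - y) - 2# * d + 2# * e * z * q ≡ (x - 2# * e * - z * q) - (y - 2# * e * z * l) - 2# * e * z * l
          rhs = solve 7 (λ d x y e z q l → (con (+ 2) :* d :+ x :- y) :- con (+ 2) :* d :+ con (+ 2) :* e :* z :* q
            := (x :- con (+ 2) :* e :* (:- z) :* q) :- (y :- con (+ 2) :* e :* z :* l) :- con (+ 2) :* e :* z :* l) refl

      -- Insert δP ≡ 2eΘ and P ≡ β. As 2Θ = πβΘ = β(M + β - 2), the summand eMβ of 2eΘ cancels the
      -- correction from `δL≡δP`, and eβ² survives modulo 2eβ.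
      δL≡ : ∀ k → s k ≡ 1# → 2# * e * β ∣ δL k - e * (β * β)
      δL≡ k sk = ≡-∣ (regroup (δL k) (δP k) e z (P (p ℕ.+ k)) β Θ) (∣-+ (∣-+ (∣-- (δL≡δP k sk) P≡) (4e (P-difference n k))) leading)
        where
        4e : ∀ {x} → 2# * (2# * e) ∣ x → 2# * e * β ∣ x
        4e = ∣-trans (π , Int-π , trans (*-comm 2# (2# * e)) (trans (cong (2# * e *_) (sym π*β)) (solve 3 (λ e p b → e :* (p :* b) := e :* b :* p) refl (2# * e) π β)))
        -- The congruence P ≡ β holds only modulo 2; the missing factor β comes from β ∣ M.
        P≡ : 2# * e * β ∣ e * z * (P (p ℕ.+ k) - β)
        P≡ = ∣-trans (≡-∣ (solve 2 (λ e z → con (+ 2) :* e :* z := e :* z :* con (+ 2)) refl e z) (*-mono-∣ (∣-refl {2# * e}) β∣z))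
          (*-mono-∣ (∣-refl {e * z}) (P≡β (p ℕ.+ k)))
        leading : 2# * e * β ∣ 2# * e * Θ - e * z * β - e * (β * β)
        leading = - 1# , Int-neg (Int-# _) , (begin
          2# * e * Θ - e * z * β - e * (β * β)
            ≡⟨ cong (λ x → x * e * Θ - e * z * β - e * (β * β)) (sym π*β) ⟩
          π * β * e * Θ - e * z * β - e * (β * β)
            ≡⟨ solve 5 (λ π β e z Θ → π :* β :* e :* Θ :- e :* z :* β :- e :* (β :* β) := β :* e :* (π :* Θ) :- e :* z :* β :- e :* (β :* β)) refl π β e z Θ ⟩
          β * e * (π * Θ) - e * z * β - e * (β * β)
            ≡⟨ cong (λ x → β * e * x - e * z * β - e * (β * β)) π*Θ ⟩
          β * e * (z + β - 2#) - e * z * β - e * (β * β)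
            ≡⟨ solve 3 (λ β e z → β :* e :* (z :+ β :- con (+ 2)) :- e :* z :* β :- e :* (β :* β) := con (+ 2) :* e :* β :* (:- con (+ 1))) refl β e z ⟩
          2# * e * β * - 1# ∎)
          where open ≡-Reasoning
        regroup : ∀ x y e z q β Θ → ((x - y + e * z * q) - e * z * (q - β)) + (y - 2# * e * Θ) + (2# * e * Θ - e * z * β - e * (β * β)) ≡ x - e * (β * β)
        regroup = solve 7 (λ x y e z q β Θ → ((x :- y :+ e :* z :* q) :- e :* z :* (q :- β)) :+ (y :- con (+ 2) :* e :* Θ)
          :+ (con (+ 2) :* e :* Θ :- e :* z :* β :- e :* (β :* β)) := x :- e :* (β :* β)) refl

      L-multiple : ∀ q k → s k ≡ 1# → 2# * e * β ∣ L (q ℕ.* t ℕ.+ k) - L k - # (+ q) * (e * (β * β))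
      L-multiple zero    k sk = ≡-∣ (solve 2 (λ l x → con (+ 0) := l :- l :- con (+ 0) :* x) refl (L k) _) ∣-0
      L-multiple (suc q) k sk = ≡-∣
        (trans (identity (L (t ℕ.+ (q ℕ.* t ℕ.+ k))) (L (q ℕ.* t ℕ.+ k)) (L k) (# (+ q)) (e * (β * β)))
          (cong₂ (λ i c → L i - L k - c * (e * (β * β))) (sym (ℕₚ.+-assoc t (q ℕ.* t) k)) (sym (#-suc q))))
        (∣-+ (δL≡ (q ℕ.* t ℕ.+ k) (s-multiple q)) (L-multiple q k sk))
        where
        identity : ∀ x y l q b → x - y - b + (y - l - q * b) ≡ x - l - (1# + q) * b
        identity = solve 5 (λ x y l q b → x :- y :- b :+ (y :- l :- q :* b) := x :- l :- (con (+ 1) :+ q) :* b) refl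
        s-multiple : ∀ q → s (q ℕ.* t ℕ.+ k) ≡ 1#
        s-multiple zero    = sk
        s-multiple (suc q) = trans (cong s (ℕₚ.+-assoc t (q ℕ.* t) k)) (trans (s-periodic n (q ℕ.* t ℕ.+ k)) (s-multiple q))

      -- Multiplying by π trades one β for a 2, in the modulus (π · 2eβ = 4e) and in the main term
      -- (π · eβ² = 2eβ).
      πL-multiple : ∀ q k → s k ≡ 1# → 2# * (2# * e) ∣ π * L (q ℕ.* t ℕ.+ k) - π * L k - # (+ q) * (2# * e * β)
      πL-multiple q k sk = ≡-∣
        (trans (identity π (L (q ℕ.* t ℕ.+ k)) (L k) (# (+ q)) e β) (cong (λ x → π * L (q ℕ.* t ℕ.+ k) - π * L k - # (+ q) * (x * e * β)) π*β))
        (∣-≡ (trans (solve 3 (λ π e β → π :* (con (+ 2) :* e :* β) := π :* β :* (con (+ 2) :* e)) refl π e β) (cong (_* (2# * e)) π*β))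
          (*-mono-∣ (∣-refl {π}) (L-multiple q k sk)))
        where
        identity : ∀ π x y q e β → π * (x - y - q * (e * (β * β))) ≡ π * x - π * y - q * (π * β * e * β)
        identity = solve 6 (λ π x y q e β → π :* (x :- y :- q :* (e :* (β :* β))) := π :* x :- π :* y :- q :* (π :* β :* e :* β)) refl

      #-odd : ∀ q → # (+ suc (2 ℕ.* q)) ≡ 1# + 2# * # (+ q)
      #-odd q = trans (#-suc (2 ℕ.* q)) (cong (λ x → 1# + x) (#-double q))

      -- An odd multiple of 2eβ is 2eβ modulo 4e. From (1 - u)β = 2 one gets β ≡ uβ ≡ -uβ (mod 2),
      -- and L(d) ≡ β (mod 2) turns this into -u L(d), the form that the quotient by 1 - ū takes.
      πL-odd-multiple : ∀ q k d → s k ≡ 1# → s d ≡ 1# →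
        2# * (2# * e) ∣ π * L (suc (2 ℕ.* q) ℕ.* t ℕ.+ k) - π * L k - - (u * (2# * e * L d))
      πL-odd-multiple q k d sk sd = ≡-∣ total (∣-+ (∣-+ πL (∣-*ˡ Int-u u2eL)) (Int⇒∣ (Int-- (Int-* (Int-+ (Int-# _) (Int-# _)) Int-β) (Int-# (+ 1)))))
        where
        x c : Carrier
        x = π * L (suc (2 ℕ.* q) ℕ.* t ℕ.+ k) - π * L k
        c = 1# + 2# * # (+ q)
        πL : 2# * (2# * e) ∣ x - c * (2# * e * β)
        πL = subst (λ c → 2# * (2# * e) ∣ x - c * (2# * e * β)) (#-odd q) (πL-multiple (suc (2 ℕ.* q)) k sk)
        u2eL : 2# * (2# * e) ∣ 2# * e * (L d - β)
        u2eL = ∣-≡ (*-comm (2# * e) 2#) (*-mono-∣ (∣-refl {2# * e}) (L≡β d sd))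
        identity : ∀ x c u e l β → x - c * (2# * e * β) + u * (2# * e * (l - β)) + ((c + 1#) * (2# * e * β) - (1# - u) * β * (2# * e)) ≡ x - - (u * (2# * e * l))
        identity = solve 6 (λ x c u e l β → x :- c :* (con (+ 2) :* e :* β) :+ u :* (con (+ 2) :* e :* (l :- β))
          :+ ((c :+ con (+ 1)) :* (con (+ 2) :* e :* β) :- (con (+ 1) :- u) :* β :* (con (+ 2) :* e)) := x :- :- (u :* (con (+ 2) :* e :* l))) refl
        total : x - c * (2# * e * β) + u * (2# * e * (L d - β)) + 2# * (2# * e) * ((1# + # (+ q)) * β - 1#) ≡ x - - (u * (2# * e * L d))
        total = trans (cong (λ y → x - c * (2# * e * β) + u * (2# * e * (L d - β)) + y)
          (trans (solve 3 (λ q e β → con (+ 2) :* (con (+ 2) :* e) :* ((con (+ 1) :+ q) :* β :- con (+ 1))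
              := (con (+ 1) :+ con (+ 2) :* q :+ con (+ 1)) :* (con (+ 2) :* e :* β) :- con (+ 2) :* (con (+ 2) :* e)) refl (# (+ q)) e β)
            (cong (λ y → (c + 1#) * (2# * e * β) - y * (2# * e)) (sym π*β))))
          (identity x c u e (L d) β)

      2∣π^M : 2# ∣ π ^ M
      2∣π^M = ∣-shift (one-minus-^2^ Int-u r) (≡-∣ (trans (solve 0 (con (+ 2) := con (+ 1) :- con -[1+ 0 ]) refl) (cong (λ x → 1# - x) (sym u-power))) ∣-refl)

      π∣1⇒2∣1 : π ∣ 1# → 2# ∣ 1#
      π∣1⇒2∣1 h = ∣-trans 2∣π^M (≡-∣ (1^ M) (^-mono-∣ M h))

      -- If 2 divides β, then 2π divides πβ = 2, so π has an integral inverse. So has π^M, which is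
      -- divisible by 2.
      2∣β⇒2∣1 : 2# ∣ β → 2# ∣ 1#
      2∣β⇒2∣1 h = π∣1⇒2∣1 (*-cancel-∣ 1 (∣-≡ (*-comm π 2#) (≡-∣ (trans π*β (sym (*-identityʳ 2#))) (*-mono-∣ (∣-refl {π}) h))))

      -- By `πL-multiple` such a congruence forces 4e ∣ 2eβ, hence 2 ∣ β.
      πL-separated : ∀ q k → s k ≡ 1# → 2# * (2# * e) ∣ π * L (suc (2 ℕ.* q) ℕ.* t ℕ.+ k) - π * L k → 2# ∣ 1#
      πL-separated q k sk h = 2∣β⇒2∣1 (2^-cancel-∣ (3 ℕ.+ n) (∣-≡ (*-comm 2# (2# * e)) (≡-∣ total
        (∣-- (∣-- h (subst (λ c → 2# * (2# * e) ∣ x - c * (2# * e * β)) (#-odd q) (πL-multiple (suc (2 ℕ.* q)) k sk)))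
             (Int⇒∣ (Int-* (Int-# _) Int-β))))))
        where
        x : Carrier
        x = π * L (suc (2 ℕ.* q) ℕ.* t ℕ.+ k) - π * L k
        total : x - (x - (1# + 2# * # (+ q)) * (2# * e * β)) - 2# * (2# * e) * (# (+ q) * β) ≡ 2# * e * β
        total = solve 4 (λ x q e β → x :- (x :- (con (+ 1) :+ con (+ 2) :* q) :* (con (+ 2) :* e :* β)) :- con (+ 2) :* (con (+ 2) :* e) :* (q :* β)
          := con (+ 2) :* e :* β) refl x (# (+ q)) e β

      πL-congruent : ∀ q k → s k ≡ 1# → 2# * e ∣ π * L (q ℕ.* t ℕ.+ k) - π * L k
      πL-congruent q k sk = ∣-shift (∣-trans (2# , Int-# _ , *-comm 2# (2# * e)) (πL-multiple q k sk))
        (∣-*ˡ (Int-# _) (Int⇒∣ Int-β))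

    s-suc : ∀ n → s (suc n) ≡ -1# * s n
    s-suc n = solve 2 (λ e x → e :* (con -[1+ 0 ] :* x) := con -[1+ 0 ] :* (e :* x)) refl ε (-1# ^ n)

    s-suc-suc : ∀ n → s (suc (suc n)) ≡ s n
    s-suc-suc n = trans (s-suc (suc n)) (trans (cong (-1# *_) (s-suc n))
      (solve 1 (λ x → con -[1+ 0 ] :* (con -[1+ 0 ] :* x) := x) refl (s n)))

    s-double : ∀ q l → s (2 ℕ.* q ℕ.+ l) ≡ s l
    s-double zero    l = refl
    s-double (suc q) l = trans (cong (λ i → s (suc i ℕ.+ l)) (ℕₚ.+-suc q (q ℕ.+ 0))) (trans (s-suc-suc (2 ℕ.* q ℕ.+ l)) (s-double q l))

    s-%2 : ∀ k → s (k % 2) ≡ s k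
    s-%2 k = sym (trans (cong s (trans (m≡m%n+[m/n]*n k 2) (trans (ℕₚ.+-comm (k % 2) (k / 2 ℕ.* 2)) (cong (ℕ._+ k % 2) (ℕₚ.*-comm (k / 2) 2)))))
      (s-double (k / 2) (k % 2)))

    t≡2^ : ∀ n → suc 2^ suc n ∸1 ≡ 2 ℕ.^ suc n
    t≡2^ n = suc-2^∸1 (suc n)

    π-cancel : ∀ {x} → π * x ≡ 0# → x ≡ 0#
    π-cancel {x} e = *-cancel-# 1 (begin
      2# * x ≡⟨ cong (_* x) (sym π*β) ⟩
      π * β * x      ≡⟨ solve 3 (λ p b x → p :* b :* x := b :* (p :* x)) refl π β x ⟩
      β * (π * x)    ≡⟨ cong (β *_) e ⟩
      β * 0# ≡⟨ zeroʳ β ⟩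
      0# ≡⟨ zeroʳ 2# ⟨
      2# * 0#        ∎)
      where open ≡-Reasoning

    -- Since 1 - ū = -ū π, the quotient π / (1 - ū) is -u.
    quotient : ∀ {ū y c l} → u * ū ≡ 1# → (1# - ū) * y ≡ c * (π * l) → y ≡ - (u * (c * l))
    quotient {ū} {y} {c} {l} uū e = begin
      y ≡⟨ solve 2 (λ y w → y := y :+ w :- w) refl y (u * (c * l)) ⟩
      y + u * (c * l) - u * (c * l) ≡⟨ cong (_- u * (c * l)) (π-cancel vanish) ⟩
      0# - u * (c * l) ≡⟨ +-identityˡ _ ⟩
      - (u * (c * l))                          ∎
      where
      open ≡-Reasoning
      vanish : π * (y + u * (c * l)) ≡ 0#
      vanish = begin
        (1# - u) * (y + u * (c * l))
          ≡⟨ solve 5 (λ u ū y c l → (con (+ 1) :- u) :* (y :+ u :* (c :* l))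
               := (con (+ 1) :- u :* ū) :* y :- u :* ((con (+ 1) :- ū) :* y) :+ u :* (c :* ((con (+ 1) :- u) :* l))) refl u ū y c l ⟩
        (1# - u * ū) * y - u * ((1# - ū) * y) + u * (c * (π * l))
          ≡⟨ cong₂ (λ a b → (1# - a) * y - u * b + u * (c * (π * l))) uū e ⟩
        (1# - 1#) * y - u * (c * (π * l)) + u * (c * (π * l))
          ≡⟨ solve 2 (λ y w → (con (+ 1) :- con (+ 1)) :* y :- w :+ w := con (+ 0)) refl y (u * (c * (π * l))) ⟩
        0# ∎

    𝓛 : Seq
    𝓛 k = π * L k

    -- The quotient by 1 - ū enters as a solution y of an equation, so no inverse has to be
    -- constructed; `quotient` identifies y.
    𝓛-difference : ∀ n q k {ū y} → u * ū ≡ 1# → ¬ 2 ∣ℕ q → s k ≡ 1# →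
      (1# - ū) * y ≡ 2# ^ (3 ℕ.+ n) * 𝓛 (k % 2) → 2# ^ (4 ℕ.+ n) ∣ 𝓛 (k ℕ.+ 2 ℕ.^ suc n ℕ.* q) - 𝓛 k - y
    𝓛-difference n q k {ū} {y} uū q-odd sk e with parity q
    ... | p , inj₁ q≡ = ⊥-elim (q-odd (divides p (trans q≡ (ℕₚ.*-comm 2 p))))
    ... | p , inj₂ refl = subst₂ (λ i y → 2# ^ (4 ℕ.+ n) ∣ 𝓛 i - 𝓛 k - y) index (sym (quotient uū e))
        (πL-odd-multiple p k (k % 2) sk (trans (s-%2 k) sk))
      where
      open Difference n using (t; πL-odd-multiple)
      index : suc (2 ℕ.* p) ℕ.* t ℕ.+ k ≡ k ℕ.+ 2 ℕ.^ suc n ℕ.* suc (2 ℕ.* p)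
      index = trans (ℕₚ.+-comm _ k) (cong (k ℕ.+_) (trans (ℕₚ.*-comm (suc (2 ℕ.* p)) t) (cong (ℕ._* suc (2 ℕ.* p)) (t≡2^ n))))

    2^-weaken : ∀ {a b x} → a ≤ b → 2# ^ b ∣ x → 2# ^ a ∣ x
    2^-weaken {a} {b} a≤b = ∣-trans (2# ^ (b ℕ.∸ a) , Int-2^ (b ℕ.∸ a) , trans (cong (2# ^_) (sym (ℕₚ.m+[n∸m]≡n a≤b))) (^-+ 2# a (b ℕ.∸ a)))

    𝓛-congruent : ∀ n d l → s l ≡ 1# → 2 ℕ.^ suc n ∣ℕ d → 2# ^ (3 ℕ.+ n) ∣ 𝓛 (d ℕ.+ l) - 𝓛 l
    𝓛-congruent n d l sl (divides q refl) = subst (λ i → 2# ^ (3 ℕ.+ n) ∣ 𝓛 (q ℕ.* i ℕ.+ l) - 𝓛 l) (t≡2^ n) (πL-congruent q l sl)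
      where open Difference n using (πL-congruent)

    -- The power of 2 dividing d is raised one step at a time. Were d an odd multiple of 2^j with j
    -- ≤ n, then for j = 0 the parities of d + l and l would differ, and for j ≥ 1 the given
    -- congruence, weakened to modulus 2^(j+3), would contradict `πL-separated`.
    𝓛-separated : ¬ 2# ∣ 1# → ∀ n d l → s l ≡ 1# → s (d ℕ.+ l) ≡ 1# → 2# ^ (3 ℕ.+ n) ∣ 𝓛 (d ℕ.+ l) - 𝓛 l → 2 ℕ.^ suc n ∣ℕ d
    𝓛-separated 2∤1 n d l sl sdl h = powers (suc n) ℕₚ.≤-refl
      where
      1≢-1 : 1# ≢ -1#
      1≢-1 e = 2∤1 (≡-∣ (sym (*-cancel-# 1 (trans (solve 0 (con (+ 2) :* con (+ 1) := con (+ 1) :- con -[1+ 0 ]) refl)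
        (trans (cong (_- -1#) e) (trans (-‿inverseʳ -1#) (sym (zeroʳ 2#))))))) ∣-0)
      powers : ∀ j → j ≤ suc n → 2 ℕ.^ j ∣ℕ d
      powers zero    _   = ℕ∣.1∣ d
      powers (suc j) j≤n with powers j (ℕₚ.≤-trans (ℕₚ.n≤1+n j) j≤n)
      ... | divides q d≡ with parity q
      ...   | p , inj₁ refl = divides p (trans d≡ (trans (cong (ℕ._* 2 ℕ.^ j) (ℕₚ.*-comm 2 p)) (ℕₚ.*-assoc p 2 (2 ℕ.^ j))))
      powers (suc zero)    j≤n | divides q d≡ | p , inj₂ refl = ⊥-elim (1≢-1 (begin
          1# ≡⟨ sdl ⟨
          s (d ℕ.+ l) ≡⟨ cong (λ i → s (i ℕ.+ l)) (trans d≡ (ℕₚ.*-identityʳ (suc (2 ℕ.* p)))) ⟩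
          s (suc (2 ℕ.* p ℕ.+ l)) ≡⟨ s-suc (2 ℕ.* p ℕ.+ l) ⟩
          -1# * s (2 ℕ.* p ℕ.+ l) ≡⟨ cong (-1# *_) (trans (s-double p l) sl) ⟩
          -1# * 1# ≡⟨ *-identityʳ -1# ⟩
          -1#                             ∎))
        where open ≡-Reasoning
      powers (suc (suc j)) (s≤s j<n) | divides q d≡ | p , inj₂ refl = ⊥-elim (2∤1 (πL-separated p l sl
          (subst (λ i → 2# ^ (4 ℕ.+ j) ∣ 𝓛 (i ℕ.+ l) - 𝓛 l) (trans d≡ (cong (suc (2 ℕ.* p) ℕ.*_) (sym (t≡2^ j))))
            (2^-weaken (s≤s (s≤s (s≤s j<n))) h))))
        where open Difference j using (πL-separated)

  -- Primitive characters modulo 8M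

  record PrimitiveCharacter : Set where
    field
      r : ℕ
      χ : ℤ → Carrier
      χ-periodic : ∀ a → χ (a ℤ.+ + (2 ℕ.^ (3 ℕ.+ r))) ≡ χ a
      χ-* : ∀ a b → χ (a ℤ.* b) ≡ χ a * χ b
      χ-1 : χ (+ 1) ≡ 1#
      χ-even : ∀ b → χ (+ (2 ℕ.* b)) ≡ 0#
      χ-primitive : ¬ (∀ c → χ (+ 1 ℤ.+ + (2 ℕ.^ (2 ℕ.+ r)) ℤ.* c) ≡ 1#)
      -- This and `root-Int` are what the character argument asks of the coefficient ring beyond its
      -- dyadic structure; both rest on the absence of zero divisors.
      ±1 : ∀ {v} → v * v ≡ 1# → v ≡ 1# ⊎ v ≡ # -[1+ 0 ]
      root-Int : ∀ {v} → v ^ (2 ℕ.^ suc r) ≡ 1# → Int v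
      B L : Seq
      c : ℕ → ℕ → Carrier
      c-factorial : ∀ n j → # (+ (j ! ℕ.* (suc n ∸ j) !)) * c n j ≡ # (+ (2 ℕ.^ (3 ℕ.+ r))) ^ (suc n ∸ j)
      B-generating : ∀ n → # (+ (n !)) * ∑ (suc n) (λ j → c n j * B j) ≡ ∑ (2 ℕ.^ (3 ℕ.+ r)) (λ i → # (+ (suc i ℕ.^ n)) * χ (+ suc i))
      L-B : ∀ j → # (+ suc j) * L j ≡ - B (suc j)

  module CharacterFacts (D : PrimitiveCharacter) where
    open PrimitiveCharacter D

    M : ℕ
    M = 2 ℕ.^ r
    m : ℤ
    m = + M

    u ε : Carrier
    u = χ (+ 5)
    ε = - χ -[1+ 0 ]

    X : Seq
    X b = χ (+ suc (2 ℕ.* b))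

    2^2+r : + (2 ℕ.^ (2 ℕ.+ r)) ≡ + 4 ℤ.* m
    2^2+r = trans (cong +_ (solveℕ 1 (λ m → conℕ 2 :*ℕ (conℕ 2 :*ℕ m) :=ℕ conℕ 4 :*ℕ m) refl M)) (ℤₚ.pos-* 4 M)

    2^3+r : + (2 ℕ.^ (3 ℕ.+ r)) ≡ + 8 ℤ.* m
    2^3+r = trans (cong +_ (solveℕ 1 (λ m → conℕ 2 :*ℕ (conℕ 2 :*ℕ (conℕ 2 :*ℕ m)) :=ℕ conℕ 8 :*ℕ m) refl M)) (ℤₚ.pos-* 8 M)

    odd-ℤ : ∀ b → + suc (2 ℕ.* b) ≡ + 1 ℤ.+ + 2 ℤ.* + b
    odd-ℤ b = cong (λ x → + 1 ℤ.+ x) (ℤₚ.pos-* 2 b)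

    χ-period : ∀ a → χ (a ℤ.+ + 8 ℤ.* m) ≡ χ a
    χ-period a = trans (cong (λ x → χ (a ℤ.+ x)) (sym 2^3+r)) (χ-periodic a)

    χ-periods-ℕ : ∀ k a → χ (a ℤ.+ + 8 ℤ.* m ℤ.* + k) ≡ χ a
    χ-periods-ℕ zero    a = cong χ (trans (cong (λ x → a ℤ.+ x) (ℤₚ.*-zeroʳ (+ 8 ℤ.* m))) (ℤₚ.+-identityʳ a))
    χ-periods-ℕ (suc k) a = trans (cong χ (solveℤ 3 (λ a n k → a :+ℤ n :*ℤ (conℤ (+ 1) :+ℤ k) :=ℤ a :+ℤ n :*ℤ k :+ℤ n) refl a (+ 8 ℤ.* m) (+ k)))
      (trans (χ-period (a ℤ.+ + 8 ℤ.* m ℤ.* + k)) (χ-periods-ℕ k a))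

    χ-periods : ∀ k a → χ (a ℤ.+ + 8 ℤ.* m ℤ.* k) ≡ χ a
    χ-periods (+ k)    a = χ-periods-ℕ k a
    χ-periods -[1+ k ] a = trans (sym (χ-periods-ℕ (suc k) (a ℤ.+ + 8 ℤ.* m ℤ.* -[1+ k ])))
      (cong χ (solveℤ 3 (λ a n k → a :+ℤ n :*ℤ (:-ℤ k) :+ℤ n :*ℤ k :=ℤ a) refl a (+ 8 ℤ.* m) (+ suc k)))

    χ-mod : ∀ {a b} k → a ≡ b ℤ.+ + 8 ℤ.* m ℤ.* k → χ a ≡ χ b
    χ-mod {b = b} k e = trans (cong χ e) (χ-periods k b)

    χ-^ : ∀ a n → χ (+ (a ℕ.^ n)) ≡ χ (+ a) ^ n
    χ-^ a zero    = χ-1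
    χ-^ a (suc n) = trans (cong χ (ℤₚ.pos-* a (a ℕ.^ n))) (trans (χ-* (+ a) (+ (a ℕ.^ n))) (cong (χ (+ a) *_) (χ-^ a n)))

    X-powers : ∀ i → X (half5^ i) ≡ u ^ i
    X-powers i = trans (cong (λ k → χ (+ k)) (odd-half5^-ℕ i)) (χ-^ 5 i)

    X-root : ∀ b → X b ^ (2 ℕ.^ suc r) ≡ 1#
    X-root b with odd^2^suc b r
    ... | s , e = trans (sym (χ-^ (suc (2 ℕ.* b)) (2 ℕ.^ suc r))) (trans (χ-mod {b = + 1} (+ s) (begin
        + (suc (2 ℕ.* b) ℕ.^ (2 ℕ.^ suc r))    ≡⟨ cong +_ e ⟩
        + 1 ℤ.+ + (8 ℕ.* M ℕ.* s) ≡⟨ cong (λ x → + 1 ℤ.+ x) (trans (ℤₚ.pos-* (8 ℕ.* M) s) (cong (ℤ._* + s) (ℤₚ.pos-* 8 M))) ⟩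
        + 1 ℤ.+ + 8 ℤ.* m ℤ.* + s              ∎)) χ-1)
      where open ≡-Reasoning

    Int-X : ∀ b → Int (X b)
    Int-X b = root-Int (X-root b)

    -- The reason is 5^M ≡ 1 + 4M (mod 8M), which is `half5^-2^`.
    χ[1+4M] : χ (+ 1 ℤ.+ + 4 ℤ.* m) ≡ u ^ M
    χ[1+4M] with half5^-2^ r
    ... | s , e = sym (trans (sym (X-powers M)) (χ-mod (+ s) (begin
        + suc (2 ℕ.* half5^ M) ≡⟨ cong (λ k → + suc (2 ℕ.* k)) e ⟩
        + suc (2 ℕ.* (2 ℕ.* M ℕ.* (1 ℕ.+ 2 ℕ.* s)))   ≡⟨ cong +_ (solveℕ 2 (λ m s → conℕ 1 :+ℕ conℕ 2 :*ℕ (conℕ 2 :*ℕ m :*ℕ (conℕ 1 :+ℕ conℕ 2 :*ℕ s)) :=ℕ conℕ 1 :+ℕ conℕ 4 :*ℕ m :+ℕ conℕ 8 :*ℕ m :*ℕ s) refl M s) ⟩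
        + 1 ℤ.+ + (4 ℕ.* M) ℤ.+ + (8 ℕ.* M ℕ.* s)     ≡⟨ cong₂ (λ x y → + 1 ℤ.+ x ℤ.+ y) (ℤₚ.pos-* 4 M) (trans (ℤₚ.pos-* (8 ℕ.* M) s) (cong (ℤ._* + s) (ℤₚ.pos-* 8 M))) ⟩
        + 1 ℤ.+ + 4 ℤ.* m ℤ.+ + 8 ℤ.* m ℤ.* + s       ∎)))
      where open ≡-Reasoning

    even-or-odd : ∀ (a : ℤ) → ∃ λ k → a ≡ + 2 ℤ.* k ⊎ a ≡ + 1 ℤ.+ + 2 ℤ.* k
    even-or-odd = parityℤ

    -- As (1 + 4M)² ≡ 1 (mod 8M), χ(1 + 4M) is ±1. The value 1 would make χ trivial on all residues
    -- congruent to 1 modulo 4M, against primitivity.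
    u-power : u ^ M ≡ -1#
    u-power with ±1 {u ^ M} (trans (cong₂ _*_ (sym χ[1+4M]) (sym χ[1+4M])) (trans (sym (χ-* (+ 1 ℤ.+ + 4 ℤ.* m) (+ 1 ℤ.+ + 4 ℤ.* m)))
         (trans (χ-mod {b = + 1} (+ 1 ℤ.+ + 2 ℤ.* m) (solveℤ 1 (λ m → (conℤ (+ 1) :+ℤ conℤ (+ 4) :*ℤ m) :*ℤ (conℤ (+ 1) :+ℤ conℤ (+ 4) :*ℤ m)
            :=ℤ conℤ (+ 1) :+ℤ conℤ (+ 8) :*ℤ m :*ℤ (conℤ (+ 1) :+ℤ conℤ (+ 2) :*ℤ m)) refl m)) χ-1)))
    ... | inj₂ e = e
    ... | inj₁ e = ⊥-elim (χ-primitive (λ c → trans (cong (λ x → χ (+ 1 ℤ.+ x ℤ.* c)) 2^2+r) (trivial c (even-or-odd c))))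
      where
      trivial : ∀ c → (∃ λ k → c ≡ + 2 ℤ.* k ⊎ c ≡ + 1 ℤ.+ + 2 ℤ.* k) → χ (+ 1 ℤ.+ + 4 ℤ.* m ℤ.* c) ≡ 1#
      trivial c (k , inj₁ refl) = trans (χ-mod {b = + 1} k (solveℤ 2 (λ m k → conℤ (+ 1) :+ℤ conℤ (+ 4) :*ℤ m :*ℤ (conℤ (+ 2) :*ℤ k)
        :=ℤ conℤ (+ 1) :+ℤ conℤ (+ 8) :*ℤ m :*ℤ k) refl m k)) χ-1
      trivial c (k , inj₂ refl) = trans (χ-mod {b = + 1 ℤ.+ + 4 ℤ.* m} k (solveℤ 2 (λ m k → conℤ (+ 1) :+ℤ conℤ (+ 4) :*ℤ m :*ℤ (conℤ (+ 1) :+ℤ conℤ (+ 2) :*ℤ k)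
        :=ℤ conℤ (+ 1) :+ℤ conℤ (+ 4) :*ℤ m :+ℤ conℤ (+ 8) :*ℤ m :*ℤ k) refl m k)) (trans χ[1+4M] e)

    -- For odd a one has a + 4M ≡ a(1 + 4M) (mod 8M).
    χ-+4M : ∀ b → χ (+ 1 ℤ.+ + 2 ℤ.* b ℤ.+ + 4 ℤ.* m) ≡ - χ (+ 1 ℤ.+ + 2 ℤ.* b)
    χ-+4M b = trans (χ-mod {b = (+ 1 ℤ.+ + 2 ℤ.* b) ℤ.* (+ 1 ℤ.+ + 4 ℤ.* m)} (ℤ.- b)
        (solveℤ 2 (λ b m → conℤ (+ 1) :+ℤ conℤ (+ 2) :*ℤ b :+ℤ conℤ (+ 4) :*ℤ m
          :=ℤ (conℤ (+ 1) :+ℤ conℤ (+ 2) :*ℤ b) :*ℤ (conℤ (+ 1) :+ℤ conℤ (+ 4) :*ℤ m) :+ℤ conℤ (+ 8) :*ℤ m :*ℤ (:-ℤ b)) refl b m))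
      (trans (χ-* (+ 1 ℤ.+ + 2 ℤ.* b) (+ 1 ℤ.+ + 4 ℤ.* m)) (trans (cong (χ (+ 1 ℤ.+ + 2 ℤ.* b) *_) (trans χ[1+4M] u-power))
        (solve 1 (λ x → x :* con -[1+ 0 ] := :- x) refl _)))

    X-antiperiodic : ∀ b → X (2 ℕ.^ suc r ℕ.+ b) ≡ - X b
    X-antiperiodic b = trans (cong χ (trans (odd-ℤ (2 ℕ.* M ℕ.+ b)) (trans (cong (λ x → + 1 ℤ.+ + 2 ℤ.* (x ℤ.+ + b)) (ℤₚ.pos-* 2 M))
        (solveℤ 2 (λ b m → conℤ (+ 1) :+ℤ conℤ (+ 2) :*ℤ (conℤ (+ 2) :*ℤ m :+ℤ b) :=ℤ conℤ (+ 1) :+ℤ conℤ (+ 2) :*ℤ b :+ℤ conℤ (+ 4) :*ℤ m) refl (+ b) m))))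
      (trans (χ-+4M (+ b)) (cong (λ x → - χ x) (sym (odd-ℤ b))))

    -- Modulo 8M, 4M - a is -(a + 4M). The sign from translation by 4M is the reason for ε = -χ(-1).
    X-reflection : ∀ b b′ → suc (b ℕ.+ b′) ≡ 2 ℕ.^ suc r → X b ≡ ε * X b′
    X-reflection b b′ e = trans (χ-mod {b = -[1+ 0 ] ℤ.* (+ 1 ℤ.+ + 2 ℤ.* + b′ ℤ.+ + 4 ℤ.* m)} (+ 1) (trans (odd-ℤ b)
        (trans (solveℤ 2 (λ b b′ → conℤ (+ 1) :+ℤ conℤ (+ 2) :*ℤ b :=ℤ conℤ (+ 2) :*ℤ (conℤ (+ 1) :+ℤ (b :+ℤ b′)) :+ℤ :-ℤ (conℤ (+ 1) :+ℤ conℤ (+ 2) :*ℤ b′)) refl (+ b) (+ b′))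
          (trans (cong (λ x → + 2 ℤ.* x ℤ.+ ℤ.- (+ 1 ℤ.+ + 2 ℤ.* + b′)) (trans (cong +_ e) (ℤₚ.pos-* 2 M)))
            (solveℤ 2 (λ b′ m → conℤ (+ 2) :*ℤ (conℤ (+ 2) :*ℤ m) :+ℤ :-ℤ (conℤ (+ 1) :+ℤ conℤ (+ 2) :*ℤ b′)
              :=ℤ conℤ -[1+ 0 ] :*ℤ (conℤ (+ 1) :+ℤ conℤ (+ 2) :*ℤ b′ :+ℤ conℤ (+ 4) :*ℤ m) :+ℤ conℤ (+ 8) :*ℤ m :*ℤ conℤ (+ 1)) refl (+ b′) m)))))
      (trans (χ-* -[1+ 0 ] (+ 1 ℤ.+ + 2 ℤ.* + b′ ℤ.+ + 4 ℤ.* m)) (trans (cong (χ -[1+ 0 ] *_) (χ-+4M (+ b′)))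
        (trans (solve 2 (λ x y → x :* (:- y) := (:- x) :* y) refl _ _) (cong (λ x → ε * χ x) (sym (odd-ℤ b′))))))

    χ[-1] : χ -[1+ 0 ] ≡ 1# ⊎ χ -[1+ 0 ] ≡ -1#
    χ[-1] = ±1 (trans (sym (χ-* -[1+ 0 ] -[1+ 0 ])) χ-1)

    ε-sign : ε ≡ 1# ⊎ ε ≡ -1#
    ε-sign with χ[-1]
    ... | inj₁ e = inj₂ (trans (cong -_ e) (solve 0 (:- con (+ 1) := con -[1+ 0 ]) refl))
    ... | inj₂ e = inj₁ (trans (cong -_ e) (solve 0 (:- con -[1+ 0 ] := con (+ 1)) refl))

    -- The index i stands for the residue a = i + 1, so the terms at odd indices belong to even a,
    -- where χ vanishes.
    ∑-evens : ∀ k (g : Seq) → (∀ b → g (suc (2 ℕ.* b)) ≡ 0#) → ∑ (2 ℕ.* k) g ≡ ∑ k (λ b → g (2 ℕ.* b))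
    ∑-evens zero    g h = refl
    ∑-evens (suc k) g h = trans (cong (λ j → ∑ (suc j) g) (ℕₚ.+-suc k (k ℕ.+ 0)))
      (trans (cong (λ x → ∑ (2 ℕ.* k) g + g (2 ℕ.* k) + x) (h k)) (trans (+-identityʳ _) (cong (_+ g (2 ℕ.* k)) (∑-evens k g h))))

    odd-# : ∀ b → # (+ suc (2 ℕ.* b)) ≡ odd b
    odd-# b = trans (#-suc (2 ℕ.* b)) (cong (λ x → 1# + x) (#-double b))

    S : Seq
    S n = ∑ (2 ℕ.^ suc (suc r)) (λ b → X b * odd b ^ n)

    S-odd : ∀ n → ∑ (2 ℕ.^ (3 ℕ.+ r)) (λ i → # (+ (suc i ℕ.^ n)) * χ (+ suc i)) ≡ S n
    S-odd n = trans (∑-evens (2 ℕ.^ suc (suc r)) (λ i → # (+ (suc i ℕ.^ n)) * χ (+ suc i))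
        (λ b → trans (cong (# (+ (suc (suc (2 ℕ.* b)) ℕ.^ n)) *_) (trans (cong (λ k → χ (+ k)) (cong suc (sym (ℕₚ.+-suc b (b ℕ.+ 0))))) (χ-even (suc b)))) (zeroʳ _)))
      (∑-cong (2 ℕ.^ suc (suc r)) (λ b → trans (*-comm _ (X b)) (cong (X b *_) (trans (#-^ (suc (2 ℕ.* b)) n) (cong (_^ n) (odd-# b))))))

    S₀ : S 0 ≡ 0#
    S₀ = begin
      ∑ (2 ℕ.* (2 ℕ.* M)) f ≡⟨ cong (λ k → ∑ (2 ℕ.* M ℕ.+ k) f) (ℕₚ.+-identityʳ (2 ℕ.* M)) ⟩
      ∑ (2 ℕ.* M ℕ.+ 2 ℕ.* M) f ≡⟨ ∑-split (2 ℕ.* M) (2 ℕ.* M) f ⟩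
      ∑ (2 ℕ.* M) f + ∑ (2 ℕ.* M) (λ b → f (2 ℕ.* M ℕ.+ b))
        ≡⟨ cong (λ x → ∑ (2 ℕ.* M) f + x) (trans (∑-cong (2 ℕ.* M) (λ b → trans (cong (_* 1#) (X-antiperiodic b)) (solve 1 (λ x → :- x :* con (+ 1) := con -[1+ 0 ] :* (x :* con (+ 1))) refl (X b))))
             (∑-* (2 ℕ.* M) -1# f)) ⟩
      ∑ (2 ℕ.* M) f + -1# * ∑ (2 ℕ.* M) f ≡⟨ solve 1 (λ x → x :+ con -[1+ 0 ] :* x := con (+ 0)) refl _ ⟩
      0#                                             ∎
      where
      open ≡-Reasoning
      f : Seq
      f b = X b * 1#

    period : ∃ λ N → 2 ℕ.^ (3 ℕ.+ r) ≡ suc N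
    period = ℕ.pred (2 ℕ.^ (3 ℕ.+ r)) , sym (ℕₚ.suc-pred (2 ℕ.^ (3 ℕ.+ r)) {{ℕₚ.m^n≢0 2 (3 ℕ.+ r)}})

    functional : ∀ n → F (# (+ 4) * # (+ M) + # (+ 4) * # (+ M)) n L 0 - L n ≡ - S n
    functional n = trans (cong (λ x → F x n L 0 - L n) (trans (solve 1 (λ z → con (+ 4) :* z :+ con (+ 4) :* z := con (+ 8) :* z) refl (# (+ M)))
        (trans (sym (#-* (+ 8) (+ M))) (trans (cong #_ (sym 2^3+r)) (cong (λ k → # (+ k)) (proj₂ period))))))
      (bernoulli-functional (proj₁ period) B L S c
        (λ n j → trans (c-factorial n j) (cong (λ k → # (+ k) ^ (suc n ∸ j)) (proj₂ period)))
        (λ n → trans (B-generating n) (S-odd n)) S₀ L-B n)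

    lvalues : LValues
    lvalues = record
      { r = r ; u = u ; ε = ε ; X = X ; L = L
      ; Int-u = subst Int (trans (X-powers 1) (*-identityʳ u)) (Int-X (half5^ 1))
      ; Int-X = Int-X ; ε-sign = ε-sign ; u-power = u-power
      ; X-antiperiodic = X-antiperiodic ; X-reflection = X-reflection ; X-powers = X-powers
      ; L-functional = functional }

    open LCongruences lvalues using (s; s-sign)

    -- Here `s k` = -χ(-1)(-1)ᵏ, and the value -1 would mean χ(-1) = (-1)ᵏ.
    parity-sign : ∀ k → χ -[1+ 0 ] ≢ -1# ^ k → s k ≡ 1#
    parity-sign k χ≢ with s-sign k
    ... | inj₁ e = e
    ... | inj₂ e = ⊥-elim (χ≢ (begin
        v ≡⟨ *-identityʳ v ⟨
        v * 1# ≡⟨ cong (v *_) (square k) ⟨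
        v * (w * w) ≡⟨ solve 2 (λ v w → v :* (w :* w) := con -[1+ 0 ] :* (:- v :* w) :* w) refl v w ⟩
        -1# * s k * w ≡⟨ cong (λ x → -1# * x * w) e ⟩
        -1# * -1# * w ≡⟨ solve 1 (λ w → con -[1+ 0 ] :* con -[1+ 0 ] :* w := w) refl w ⟩
        w                      ∎))
      where
      open ≡-Reasoning
      v w : Carrier
      v = χ -[1+ 0 ]
      w = -1# ^ k
      square : ∀ k → -1# ^ k * -1# ^ k ≡ 1#
      square zero    = *-identityʳ 1#
      square (suc k) = trans (solve 1 (λ w → con -[1+ 0 ] :* w :* (con -[1+ 0 ] :* w) := w :* w) refl (-1# ^ k)) (square k)

  -- Absence of zero divisors, and roots of unity

  record CyclotomicData : Set where
    field
      r : ℕ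
      ζ : Carrier
      Int-ζ : Int ζ
      ζ-power : ζ ^ (2 ℕ.^ r) ≡ # -[1+ 0 ]
      _≟_ : (x y : Carrier) → Dec (x ≡ y)
      denominator : ∀ x → ∃ λ n → Int (# (+ suc n) * x)
      separated : ∀ x → x ≢ 0# → ∃ λ N → ¬ 2# ^ N ∣ x
      span : ∀ x → Int x → ∃ λ (a : Seq) → (∀ i → Int (a i) × (2# ∣ a i ⊎ 2# ∣ a i - 1#)) × x ≡ ∑ (2 ℕ.^ r) (λ i → a i * ζ ^ i)
      2∤1 : ¬ 2# ∣ 1#

  module Cyclotomic (D : CyclotomicData) where
    open CyclotomicData D
    M : ℕ
    M = 2 ℕ.^ r
    ϖ : Carrier
    ϖ = 1# - ζ

    ϖ∣2 : ϖ ∣ 2#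
    ϖ∣2 = ∑ M (ζ ^_) , ∑-Int M (Int-^ Int-ζ) , sym (trans (geometric ζ M) (trans (cong (λ x → 1# - x) ζ-power)
      (solve 0 (con (+ 1) :- con -[1+ 0 ] := con (+ 2)) refl)))

    Residue : Carrier → Set
    Residue x = (ϖ ∣ x) ⊎ (ϖ ∣ x - 1#)

    residue-+ : ∀ {x y} → Residue x → Residue y → Residue (x + y)
    residue-+ (inj₁ p) (inj₁ q) = inj₁ (∣-+ p q)
    residue-+ {x} {y} (inj₁ p) (inj₂ q) = inj₂ (≡-∣ (sym (+-assoc x y (- 1#))) (∣-+ p q))
    residue-+ {x} {y} (inj₂ p) (inj₁ q) = inj₂ (≡-∣ (solve 2 (λ x y → x :- con (+ 1) :+ y := x :+ y :- con (+ 1)) refl x y) (∣-+ p q))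
    residue-+ {x} {y} (inj₂ p) (inj₂ q) = inj₁ (≡-∣ (solve 2 (λ x y → x :- con (+ 1) :+ (y :- con (+ 1)) :+ con (+ 2) := x :+ y) refl x y) (∣-+ (∣-+ p q) ϖ∣2))

    residue-*ζ^ : ∀ {x} → Int x → Residue x → ∀ i → Residue (x * ζ ^ i)
    residue-*ζ^ ix (inj₁ p) i = inj₁ (∣-*ʳ (Int-^ Int-ζ i) p)
    residue-*ζ^ {x} ix (inj₂ p) i = inj₂ (≡-∣
      (solve 2 (λ x z → (x :- con (+ 1)) :* z :- (con (+ 1) :- z) := x :* z :- con (+ 1)) refl x (ζ ^ i))
      (∣-- (∣-*ʳ (Int-^ Int-ζ i) p) (≡-∣ (geometric ζ i) (Int⇒∣ (∑-Int i (Int-^ Int-ζ))))))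

    -- Modulo ϖ one has ζ ≡ 1 and 2 ≡ 0, so x reduces to the sum of its coordinates, each of which
    -- is 0 or 1.
    residue : ∀ x → Int x → Residue x
    residue x ix with span x ix
    ... | a , ha , refl = sum M
      where
      coefficient : ∀ i → Residue (a i)
      coefficient i with proj₂ (ha i)
      ... | inj₁ p = inj₁ (∣-trans ϖ∣2 p)
      ... | inj₂ p = inj₂ (∣-trans ϖ∣2 p)
      sum : ∀ n → Residue (∑ n (λ i → a i * ζ ^ i))
      sum zero    = inj₁ ∣-0
      sum (suc n) = residue-+ (sum n) (residue-*ζ^ (proj₁ (ha n)) (coefficient n) n)

    2∣ϖ^M : 2# ∣ ϖ ^ M
    2∣ϖ^M = ∣-shift (one-minus-^2^ Int-ζ r) (≡-∣ (trans (solve 0 (con (+ 2) := con (+ 1) :- con -[1+ 0 ]) refl) (cong (λ x → 1# - x) (sym ζ-power))) ∣-refl)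

    ^-* : ∀ x m n → x ^ (n ℕ.* m) ≡ (x ^ m) ^ n
    ^-* x m zero    = refl
    ^-* x m (suc n) = trans (^-+ x m (n ℕ.* m)) (cong (x ^ m *_) (^-* x m n))

    2^∣ϖ^ : ∀ N {x} → ϖ ^ (N ℕ.* M) ∣ x → 2# ^ N ∣ x
    2^∣ϖ^ N = ∣-trans (≡-∣ (sym (^-* ϖ M N)) (^-mono-∣ N 2∣ϖ^M))

    ϖ∤1 : ¬ ϖ ∣ 1#
    ϖ∤1 h = 2∤1 (∣-trans 2∣ϖ^M (≡-∣ (1^ M) (^-mono-∣ M h)))

    2-cancel : ∀ {x} → 2# * x ≡ 0# → x ≡ 0#
    2-cancel {x} e = *-cancel-# 1 (trans e (sym (zeroʳ 2#)))

    ϖ-cancel : ∀ {x} → ϖ * x ≡ 0# → x ≡ 0#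
    ϖ-cancel {x} e = 2-cancel (begin
      2# * x ≡⟨ cong (_* x) (trans (solve 0 (con (+ 2) := con (+ 1) :- con -[1+ 0 ]) refl) (cong (λ x → 1# - x) (sym ζ-power))) ⟩
      (1# - ζ ^ M) * x ≡⟨ cong (_* x) (geometric ζ M) ⟨
      ϖ * ∑ M (ζ ^_) * x ≡⟨ solve 3 (λ p s x → p :* s :* x := s :* (p :* x)) refl ϖ (∑ M (ζ ^_)) x ⟩
      ∑ M (ζ ^_) * (ϖ * x) ≡⟨ cong (∑ M (ζ ^_) *_) e ⟩
      ∑ M (ζ ^_) * 0# ≡⟨ zeroʳ _ ⟩
      0#                             ∎)
      where open ≡-Reasoning

    -- The residue field is 𝔽₂, so ϖ divides a factor of a vanishing product; divide it out and repeat.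
    zero-product-ϖ : ∀ a b {x y} → Int x → Int y → x * y ≡ 0# → ϖ ^ a ∣ x ⊎ ϖ ^ b ∣ y
    zero-product-ϖ zero    b       {x} ix iy e = inj₁ (x , ix , sym (*-identityˡ x))
    zero-product-ϖ (suc a) zero    {y = y} ix iy e = inj₂ (y , iy , sym (*-identityˡ y))
    zero-product-ϖ (suc a) (suc b) {x} {y} ix iy e with residue x ix | residue y iy
    ... | inj₁ (x′ , ix′ , refl) | _ with zero-product-ϖ a (suc b) ix′ iy (ϖ-cancel (trans (sym (*-assoc ϖ x′ y)) e))
    ...   | inj₁ h = inj₁ (*-mono-∣ (∣-refl {ϖ}) h)
    ...   | inj₂ h = inj₂ h
    zero-product-ϖ (suc a) (suc b) {x} {y} ix iy e | inj₂ _ | inj₁ (y′ , iy′ , refl)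
      with zero-product-ϖ (suc a) b ix iy′ (ϖ-cancel (trans (solve 3 (λ p x y → p :* (x :* y) := x :* (p :* y)) refl ϖ x y′) e))
    ...   | inj₁ h = inj₁ h
    ...   | inj₂ h = inj₂ (*-mono-∣ (∣-refl {ϖ}) h)
    zero-product-ϖ (suc a) (suc b) {x} {y} ix iy e | inj₂ p | inj₂ q = ⊥-elim (ϖ∤1 (≡-∣ (begin
        - (y * (x - 1#) + (y - 1#))  ≡⟨ solve 2 (λ x y → :- (y :* (x :- con (+ 1)) :+ (y :- con (+ 1))) := con (+ 1) :- x :* y) refl x y ⟩
        1# - x * y ≡⟨ cong (λ z → 1# - z) e ⟩
        1# - 0# ≡⟨ solve 0 (con (+ 1) :- con (+ 0) := con (+ 1)) refl ⟩
        1#                           ∎)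
      (∣-neg (∣-+ (∣-*ˡ iy p) q))))
      where open ≡-Reasoning

    -- A nonzero element is divisible by only finitely many powers of 2, hence of ϖ because 2 ∣ ϖ^M.
    -- The exponents are chosen beyond both bounds, so `zero-product-ϖ` contradicts one of them.
    zero-product-Int : ∀ {x y} → Int x → Int y → x * y ≡ 0# → x ≡ 0# ⊎ y ≡ 0#
    zero-product-Int {x} {y} ix iy e with x ≟ 0# | y ≟ 0#
    ... | yes p | _     = inj₁ p
    ... | no _  | yes q = inj₂ q
    ... | no p  | no q with separated x p | separated y q
    ...   | a , ¬a | b , ¬b with zero-product-ϖ (a ℕ.* M) (b ℕ.* M) ix iy e
    ...     | inj₁ h = ⊥-elim (¬a (2^∣ϖ^ a h))
    ...     | inj₂ h = ⊥-elim (¬b (2^∣ϖ^ b h))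

    zero-product : ∀ {x y} → x * y ≡ 0# → x ≡ 0# ⊎ y ≡ 0#
    zero-product {x} {y} e with denominator x | denominator y
    ... | a , ia | b , ib with zero-product-Int ia ib (begin
          # (+ suc a) * x * (# (+ suc b) * y)     ≡⟨ solve 4 (λ a b x y → a :* x :* (b :* y) := a :* b :* (x :* y)) refl _ _ x y ⟩
          # (+ suc a) * # (+ suc b) * (x * y)     ≡⟨ cong (# (+ suc a) * # (+ suc b) *_) e ⟩
          # (+ suc a) * # (+ suc b) * 0# ≡⟨ zeroʳ _ ⟩
          0#                                      ∎)
      where open ≡-Reasoning
    ...   | inj₁ h = inj₁ (*-cancel-# a (trans h (sym (zeroʳ _))))
    ...   | inj₂ h = inj₂ (*-cancel-# b (trans h (sym (zeroʳ _))))

    square-roots : ∀ {x y} → x * x ≡ y * y → x ≡ y ⊎ x ≡ - y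
    square-roots {x} {y} e with zero-product {x - y} {x + y} (trans
        (solve 2 (λ x y → (x :- y) :* (x :+ y) := x :* x :- y :* y) refl x y)
        (trans (cong (λ z → z - y * y) e) (-‿inverseʳ _)))
    ... | inj₁ h = inj₁ (trans (solve 2 (λ x y → x := x :- y :+ y) refl x y) (trans (cong (_+ y) h) (+-identityˡ y)))
    ... | inj₂ h = inj₂ (trans (solve 2 (λ x y → x := x :+ y :- y) refl x y) (trans (cong (_- y) h) (+-identityˡ _)))

    *-^ : ∀ x y n → (x * y) ^ n ≡ x ^ n * y ^ n
    *-^ x y zero    = sym (*-identityˡ _)
    *-^ x y (suc n) = trans (cong (x * y *_) (*-^ x y n))
      (solve 4 (λ x y a b → x :* y :* (a :* b) := x :* a :* (y :* b)) refl x y _ _)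

    ^-2^-suc : ∀ x n → x ^ (2 ℕ.^ suc n) ≡ x ^ (2 ℕ.^ n) * x ^ (2 ℕ.^ n)
    ^-2^-suc x n = trans (cong (λ k → x ^ (2 ℕ.^ n ℕ.+ k)) (ℕₚ.+-identityʳ (2 ℕ.^ n))) (^-+ x (2 ℕ.^ n) (2 ℕ.^ n))

    -- Extract square roots one at a time, the sign being absorbed by -1 = ζ^(2ʳ).
    roots-of-unity′ : ∀ s → s ≤ suc r → ∀ {v} j → v ^ (2 ℕ.^ s) ≡ (ζ ^ j) ^ (2 ℕ.^ s) → ∃ λ j → v ≡ ζ ^ j
    roots-of-unity′ zero    _   {v} j e = j , trans (sym (*-identityʳ v)) (trans e (*-identityʳ _))
    roots-of-unity′ (suc s) (s≤s s≤r) {v} j e with square-roots (trans (sym (^-2^-suc v s)) (trans e (^-2^-suc (ζ ^ j) s)))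
    ... | inj₁ h = roots-of-unity′ s (ℕₚ.m≤n⇒m≤1+n s≤r) j h
    ... | inj₂ h = roots-of-unity′ s (ℕₚ.m≤n⇒m≤1+n s≤r) (2 ℕ.^ (r ℕ.∸ s) ℕ.+ j) (begin
        v ^ (2 ℕ.^ s)
          ≡⟨ h ⟩
        - (ζ ^ j) ^ (2 ℕ.^ s)
          ≡⟨ solve 1 (λ x → :- x := con -[1+ 0 ] :* x) refl _ ⟩
        # -[1+ 0 ] * (ζ ^ j) ^ (2 ℕ.^ s)
          ≡⟨ cong (_* (ζ ^ j) ^ (2 ℕ.^ s)) (trans (sym ζ-power) (trans (cong (ζ ^_) split) (^-* ζ (2 ℕ.^ (r ℕ.∸ s)) (2 ℕ.^ s)))) ⟩
        (ζ ^ (2 ℕ.^ (r ℕ.∸ s))) ^ (2 ℕ.^ s) * (ζ ^ j) ^ (2 ℕ.^ s)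
          ≡⟨ *-^ _ _ (2 ℕ.^ s) ⟨
        (ζ ^ (2 ℕ.^ (r ℕ.∸ s)) * ζ ^ j) ^ (2 ℕ.^ s)
          ≡⟨ cong (_^ (2 ℕ.^ s)) (^-+ ζ (2 ℕ.^ (r ℕ.∸ s)) j) ⟨
        (ζ ^ (2 ℕ.^ (r ℕ.∸ s) ℕ.+ j)) ^ (2 ℕ.^ s) ∎)
      where
      open ≡-Reasoning
      split : 2 ℕ.^ r ≡ 2 ℕ.^ s ℕ.* 2 ℕ.^ (r ℕ.∸ s)
      split = trans (cong (2 ℕ.^_) (sym (ℕₚ.m+[n∸m]≡n s≤r))) (ℕₚ.^-distribˡ-+-* 2 s (r ℕ.∸ s))

    roots-of-unity : ∀ {v} → v ^ (2 ℕ.^ suc r) ≡ 1# → ∃ λ j → v ≡ ζ ^ j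
    roots-of-unity e = roots-of-unity′ (suc r) ℕₚ.≤-refl 0 (trans e (sym (1^ (2 ℕ.^ suc r))))

-- Rational numbers with odd denominator

ι : ℤ → ℚ
ι z = z ℚ./ 1

fromℚᵘ-+ : ∀ x y → fromℚᵘ (x ℚᵘ.+ y) ≡ fromℚᵘ x ℚ.+ fromℚᵘ y
fromℚᵘ-+ x y = ℚₚ.toℚᵘ-injective (ℚᵘₚ.≃-trans (ℚₚ.toℚᵘ-fromℚᵘ (x ℚᵘ.+ y))
  (ℚᵘₚ.≃-sym (ℚᵘₚ.≃-trans (ℚₚ.toℚᵘ-homo-+ (fromℚᵘ x) (fromℚᵘ y)) (ℚᵘₚ.+-cong (ℚₚ.toℚᵘ-fromℚᵘ x) (ℚₚ.toℚᵘ-fromℚᵘ y)))))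

fromℚᵘ-* : ∀ x y → fromℚᵘ (x ℚᵘ.* y) ≡ fromℚᵘ x ℚ.* fromℚᵘ y
fromℚᵘ-* x y = ℚₚ.toℚᵘ-injective (ℚᵘₚ.≃-trans (ℚₚ.toℚᵘ-fromℚᵘ (x ℚᵘ.* y))
  (ℚᵘₚ.≃-sym (ℚᵘₚ.≃-trans (ℚₚ.toℚᵘ-homo-* (fromℚᵘ x) (fromℚᵘ y)) (ℚᵘₚ.*-cong (ℚₚ.toℚᵘ-fromℚᵘ x) (ℚₚ.toℚᵘ-fromℚᵘ y)))))

ι-+ : ∀ a b → ι (a ℤ.+ b) ≡ ι a ℚ.+ ι b
ι-+ a b = trans (ℚₚ.fromℚᵘ-cong {mkℚᵘ (a ℤ.+ b) 0} {mkℚᵘ a 0 ℚᵘ.+ mkℚᵘ b 0}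
    (*≡* (cong (ℤ._* (+ 1)) (cong₂ ℤ._+_ (sym (ℤₚ.*-identityʳ a)) (sym (ℤₚ.*-identityʳ b))))))
  (fromℚᵘ-+ (mkℚᵘ a 0) (mkℚᵘ b 0))

ι-* : ∀ a b → ι (a ℤ.* b) ≡ ι a ℚ.* ι b
ι-* a b = fromℚᵘ-* (mkℚᵘ a 0) (mkℚᵘ b 0)

ι-injective : ∀ {a b} → ι a ≡ ι b → a ≡ b
ι-injective {a} {b} e with ℚₚ.fromℚᵘ-injective {mkℚᵘ a 0} {mkℚᵘ b 0} e
... | *≡* e′ = trans (sym (ℤₚ.*-identityʳ a)) (trans e′ (ℤₚ.*-identityʳ b))

ι-neg : ∀ a → ι (ℤ.- a) ≡ ℚ.- ι a
ι-neg a = begin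
  ι (ℤ.- a) ≡⟨ ℚₚ.+-identityʳ _ ⟨
  ι (ℤ.- a) ℚ.+ 0ℚ ≡⟨ cong (ι (ℤ.- a) ℚ.+_) (ℚₚ.+-inverseʳ (ι a)) ⟨
  ι (ℤ.- a) ℚ.+ (ι a ℚ.+ ℚ.- ι a) ≡⟨ ℚₚ.+-assoc (ι (ℤ.- a)) (ι a) (ℚ.- ι a) ⟨
  ι (ℤ.- a) ℚ.+ ι a ℚ.+ ℚ.- ι a ≡⟨ cong (ℚ._+ ℚ.- ι a) (trans (sym (ι-+ (ℤ.- a) a)) (cong ι (ℤₚ.+-inverseˡ a))) ⟩
  0ℚ ℚ.+ ℚ.- ι a ≡⟨ ℚₚ.+-identityˡ _ ⟩
  ℚ.- ι a ∎
  where open ≡-Reasoning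

/-*-ι : ∀ z n .{{_ : ℕ.NonZero n}} → z ℚ./ n ℚ.* ι (+ n) ≡ ι z
/-*-ι z n@(suc n-1) = trans (sym (fromℚᵘ-* (mkℚᵘ z n-1) (mkℚᵘ (+ n) 0)))
  (ℚₚ.fromℚᵘ-cong {mkℚᵘ z n-1 ℚᵘ.* mkℚᵘ (+ n) 0} {mkℚᵘ z 0} (*≡* (ℤₚ.*-assoc z (+ n) (+ 1))))

*-ι-↧ : ∀ q → q ℚ.* ι (+ (↧ₙ q)) ≡ ι (↥ q)
*-ι-↧ q = trans (cong (ℚ._* ι (+ (↧ₙ q))) (sym (ℚₚ.↥p/↧p≡p q))) (/-*-ι (↥ q) (↧ₙ q))

record Z₂ (q : ℚ) : Set where
  constructor mkZ₂
  field odd-denominator : Odd (↧ₙ q)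
open Z₂

-- The fraction a/n need not be reduced: the reduced denominator of q divides the numerator times n
-- and is coprime to the numerator, so it divides the odd number n.
Z₂-intro : ∀ {q} n a → Odd n → q ℚ.* ι (+ n) ≡ ι a → Z₂ q
Z₂-intro {q} n a on e = mkZ₂ (λ h → on (ℕ∣.∣-trans h (coprime-divisor (coprime q) (divides ℤ.∣ a ∣ (begin
    ℤ.∣ ↥ q ∣ ℕ.* n ≡⟨ ℤₚ.abs-* (↥ q) (+ n) ⟨
    ℤ.∣ ↥ q ℤ.* + n ∣ ≡⟨ cong ℤ.∣_∣ integers ⟩
    ℤ.∣ a ℤ.* + (↧ₙ q) ∣      ≡⟨ ℤₚ.abs-* a (+ (↧ₙ q)) ⟩
    ℤ.∣ a ∣ ℕ.* ↧ₙ q          ∎)))))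
  where
  open ≡-Reasoning
  coprime : ∀ q → Coprime (↧ₙ q) ℤ.∣ ↥ q ∣
  coprime (mkℚ n d-1 c) = Coprime.sym (Coprime.recompute c)
  integers : ↥ q ℤ.* + n ≡ a ℤ.* + (↧ₙ q)
  integers = ι-injective (begin
    ι (↥ q ℤ.* + n) ≡⟨ ι-* (↥ q) (+ n) ⟩
    ι (↥ q) ℚ.* ι (+ n) ≡⟨ cong (ℚ._* ι (+ n)) (*-ι-↧ q) ⟨
    q ℚ.* ι (+ (↧ₙ q)) ℚ.* ι (+ n) ≡⟨ ℚₚ.*-assoc q _ _ ⟩
    q ℚ.* (ι (+ (↧ₙ q)) ℚ.* ι (+ n))      ≡⟨ cong (q ℚ.*_) (ℚₚ.*-comm _ (ι (+ n))) ⟩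
    q ℚ.* (ι (+ n) ℚ.* ι (+ (↧ₙ q)))      ≡⟨ ℚₚ.*-assoc q _ _ ⟨
    q ℚ.* ι (+ n) ℚ.* ι (+ (↧ₙ q)) ≡⟨ cong (ℚ._* ι (+ (↧ₙ q))) e ⟩
    ι a ℚ.* ι (+ (↧ₙ q)) ≡⟨ ι-* a (+ (↧ₙ q)) ⟨
    ι (a ℤ.* + (↧ₙ q))                    ∎)

ι-ℕ* : ∀ m n → ι (+ (m ℕ.* n)) ≡ ι (+ m) ℚ.* ι (+ n)
ι-ℕ* m n = trans (cong ι (ℤₚ.pos-* m n)) (ι-* (+ m) (+ n))

Z₂-ι : ∀ a → Z₂ (ι a)
Z₂-ι a = Z₂-intro 1 a odd-1 (ℚₚ.*-identityʳ (ι a))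

Z₂-* : ∀ {p q} → Z₂ p → Z₂ q → Z₂ (p ℚ.* q)
Z₂-* {p} {q} zp zq = Z₂-intro (↧ₙ p ℕ.* ↧ₙ q) (↥ p ℤ.* ↥ q) (odd-* (odd-denominator zp) (odd-denominator zq)) (begin
  p ℚ.* q ℚ.* ι (+ (↧ₙ p ℕ.* ↧ₙ q)) ≡⟨ cong (p ℚ.* q ℚ.*_) (ι-ℕ* (↧ₙ p) (↧ₙ q)) ⟩
  p ℚ.* q ℚ.* (ι (+ (↧ₙ p)) ℚ.* ι (+ (↧ₙ q)))    ≡⟨ rearrange p q _ _ ⟩
  p ℚ.* ι (+ (↧ₙ p)) ℚ.* (q ℚ.* ι (+ (↧ₙ q)))    ≡⟨ cong₂ ℚ._*_ (*-ι-↧ p) (*-ι-↧ q) ⟩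
  ι (↥ p) ℚ.* ι (↥ q) ≡⟨ ι-* (↥ p) (↥ q) ⟨
  ι (↥ p ℤ.* ↥ q)                                ∎)
  where
  open ≡-Reasoning
  rearrange : ∀ p q a b → p ℚ.* q ℚ.* (a ℚ.* b) ≡ p ℚ.* a ℚ.* (q ℚ.* b)
  rearrange = solveℚ 4 (λ p q a b → p :*ℚ q :*ℚ (a :*ℚ b) :=ℚ p :*ℚ a :*ℚ (q :*ℚ b)) refl

Z₂-+ : ∀ {p q} → Z₂ p → Z₂ q → Z₂ (p ℚ.+ q)
Z₂-+ {p} {q} zp zq = Z₂-intro (↧ₙ p ℕ.* ↧ₙ q) (↥ p ℤ.* ↧ q ℤ.+ ↥ q ℤ.* ↧ p) (odd-* (odd-denominator zp) (odd-denominator zq)) (begin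
  (p ℚ.+ q) ℚ.* ι (+ (↧ₙ p ℕ.* ↧ₙ q)) ≡⟨ cong ((p ℚ.+ q) ℚ.*_) (ι-ℕ* (↧ₙ p) (↧ₙ q)) ⟩
  (p ℚ.+ q) ℚ.* (ι (↧ p) ℚ.* ι (↧ q)) ≡⟨ rearrange p q _ _ ⟩
  p ℚ.* ι (↧ p) ℚ.* ι (↧ q) ℚ.+ q ℚ.* ι (↧ q) ℚ.* ι (↧ p)
    ≡⟨ cong₂ (λ x y → x ℚ.* ι (↧ q) ℚ.+ y ℚ.* ι (↧ p)) (*-ι-↧ p) (*-ι-↧ q) ⟩
  ι (↥ p) ℚ.* ι (↧ q) ℚ.+ ι (↥ q) ℚ.* ι (↧ p)    ≡⟨ cong₂ ℚ._+_ (ι-* (↥ p) (↧ q)) (ι-* (↥ q) (↧ p)) ⟨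
  ι (↥ p ℤ.* ↧ q) ℚ.+ ι (↥ q ℤ.* ↧ p) ≡⟨ ι-+ (↥ p ℤ.* ↧ q) (↥ q ℤ.* ↧ p) ⟨
  ι (↥ p ℤ.* ↧ q ℤ.+ ↥ q ℤ.* ↧ p)                ∎)
  where
  open ≡-Reasoning
  rearrange : ∀ p q a b → (p ℚ.+ q) ℚ.* (a ℚ.* b) ≡ p ℚ.* a ℚ.* b ℚ.+ q ℚ.* b ℚ.* a
  rearrange = solveℚ 4 (λ p q a b → (p :+ℚ q) :*ℚ (a :*ℚ b) :=ℚ p :*ℚ a :*ℚ b :+ℚ q :*ℚ b :*ℚ a) refl

ℚ-dyadic : DyadicRing
ℚ-dyadic = record
  { Carrier = ℚ ; _+_ = ℚ._+_ ; _*_ = ℚ._*_ ; -_ = ℚ.-_ ; #_ = ι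
  ; isCommutativeRing = ℚₚ.+-*-isCommutativeRing
  ; #-+ = ι-+ ; #-* = ι-* ; #-neg = ι-neg
  ; inverse = λ n → (+ 1) ℚ./ suc n , /-*-ι (+ 1) (suc n)
  ; Int = Z₂ ; Int-+ = Z₂-+ ; Int-* = Z₂-* ; Int-# = Z₂-ι }

module 𝕢 = Dyadic ℚ-dyadic

½*2* : ∀ x → ½ ℚ.* (ι (+ 2) ℚ.* x) ≡ x
½*2* x = trans (sym (ℚₚ.*-assoc ½ (ι (+ 2)) x)) (ℚₚ.*-identityˡ x)

2*½* : ∀ x → ι (+ 2) ℚ.* (½ ℚ.* x) ≡ x
2*½* x = trans (sym (ℚₚ.*-assoc (ι (+ 2)) ½ x)) (ℚₚ.*-identityˡ x)

-- The parity of the numerator decides; for odd numerator and odd denominator, q - 1 has the even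
-- difference of the two as numerator.
Z₂-residue : ∀ q → Z₂ q → ι (+ 2) 𝕢.∣ q ⊎ ι (+ 2) 𝕢.∣ (q 𝕢.- ι (+ 1))
Z₂-residue q zq with parityℤ (↥ q) | parityℤ (↧ q)
... | k , inj₁ e | _ = inj₁ (½ ℚ.* q , Z₂-intro (↧ₙ q) k (odd-denominator zq) (begin
    ½ ℚ.* q ℚ.* ι (↧ q) ≡⟨ ℚₚ.*-assoc ½ q _ ⟩
    ½ ℚ.* (q ℚ.* ι (↧ q))      ≡⟨ cong (½ ℚ.*_) (trans (*-ι-↧ q) (trans (cong ι e) (ι-* (+ 2) k))) ⟩
    ½ ℚ.* (ι (+ 2) ℚ.* ι k)    ≡⟨ ½*2* (ι k) ⟩
    ι k                        ∎) , sym (2*½* q))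
  where
  open ≡-Reasoning
... | k , inj₂ e | l , inj₁ f = ⊥-elim (odd-denominator zq (divides ℤ.∣ l ∣ (trans (cong ℤ.∣_∣ f) (trans (ℤₚ.abs-* (+ 2) l) (ℕₚ.*-comm 2 ℤ.∣ l ∣)))))
... | k , inj₂ e | l , inj₂ f = inj₂ (½ ℚ.* (q 𝕢.- ι (+ 1)) , Z₂-intro (↧ₙ q) (k ℤ.- l) (odd-denominator zq) (begin
    ½ ℚ.* (q 𝕢.- ι (+ 1)) ℚ.* ι (↧ q) ≡⟨ 𝕢.solve 3 (λ h q d → h 𝕢.:* (q 𝕢.:- 𝕢.con (+ 1)) 𝕢.:* d 𝕢.:= h 𝕢.:* (q 𝕢.:* d 𝕢.:- d)) refl ½ q (ι (↧ q)) ⟩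
    ½ ℚ.* (q ℚ.* ι (↧ q) 𝕢.- ι (↧ q)) ≡⟨ cong₂ (λ x y → ½ ℚ.* (x 𝕢.- y)) (trans (*-ι-↧ q) (trans (cong ι e) (odd-ι k))) (trans (cong ι f) (odd-ι l)) ⟩
    ½ ℚ.* ((ι (+ 1) ℚ.+ ι (+ 2) ℚ.* ι k) 𝕢.- (ι (+ 1) ℚ.+ ι (+ 2) ℚ.* ι l))
      ≡⟨ 𝕢.solve 3 (λ h k l → h 𝕢.:* ((𝕢.con (+ 1) 𝕢.:+ 𝕢.con (+ 2) 𝕢.:* k) 𝕢.:- (𝕢.con (+ 1) 𝕢.:+ 𝕢.con (+ 2) 𝕢.:* l)) 𝕢.:= h 𝕢.:* (𝕢.con (+ 2) 𝕢.:* (k 𝕢.:- l))) refl ½ (ι k) (ι l) ⟩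
    ½ ℚ.* (ι (+ 2) ℚ.* (ι k 𝕢.- ι l)) ≡⟨ ½*2* _ ⟩
    ι k 𝕢.- ι l ≡⟨ cong (ι k ℚ.+_) (ι-neg l) ⟨
    ι k ℚ.+ ι (ℤ.- l) ≡⟨ ι-+ k (ℤ.- l) ⟨
    ι (k ℤ.- l)                                 ∎) , sym (2*½* _))
  where
  open ≡-Reasoning
  odd-ι : ∀ k → ι (+ 1 ℤ.+ + 2 ℤ.* k) ≡ ι (+ 1) ℚ.+ ι (+ 2) ℚ.* ι k
  odd-ι k = trans (ι-+ (+ 1) (+ 2 ℤ.* k)) (cong (ι (+ 1) ℚ.+_) (ι-* (+ 2) k))

2∤1 : ¬ ι (+ 2) 𝕢.∣ ι (+ 1)
2∤1 (r , zr , e) = odd-denominator (subst Z₂ (trans (sym (ℚₚ.*-identityˡ r)) (trans (ℚₚ.*-assoc ½ (ι (+ 2)) r) (cong (½ ℚ.*_) (sym e)))) zr) ℕ∣.∣-refl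

Z₂-separated : ∀ q → q ≢ 0ℚ → ∃ λ N → ¬ ι (+ (2 ℕ.^ N)) 𝕢.∣ q
-- The size N of the numerator serves as exponent: 2^N would have to divide a nonzero number of size
-- N < 2^N.
Z₂-separated q q≢0 = ℤ.∣ ↥ q ∣ , too-large
  where
  numerator≢0 : ℤ.∣ ↥ q ∣ ≢ 0
  numerator≢0 h = q≢0 (ℚₚ.↥p≡0⇒p≡0 q (ℤₚ.∣i∣≡0⇒i≡0 h))
  integers : ∀ r → q ≡ ι (+ (2 ℕ.^ ℤ.∣ ↥ q ∣)) ℚ.* r → ↧ₙ r ℕ.* ℤ.∣ ↥ q ∣ ≡ ℤ.∣ ↥ r ∣ ℕ.* ↧ₙ q ℕ.* 2 ℕ.^ ℤ.∣ ↥ q ∣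
  integers r e = begin
    ↧ₙ r ℕ.* ℤ.∣ ↥ q ∣ ≡⟨ ℤₚ.abs-* (↧ r) (↥ q) ⟨
    ℤ.∣ ↧ r ℤ.* ↥ q ∣ ≡⟨ cong ℤ.∣_∣ (ι-injective {↧ r ℤ.* ↥ q} {↥ r ℤ.* ↧ q ℤ.* + T} rational) ⟩
    ℤ.∣ ↥ r ℤ.* ↧ q ℤ.* + T ∣ ≡⟨ ℤₚ.abs-* (↥ r ℤ.* ↧ q) (+ T) ⟩
    ℤ.∣ ↥ r ℤ.* ↧ q ∣ ℕ.* T ≡⟨ cong (ℕ._* T) (ℤₚ.abs-* (↥ r) (↧ q)) ⟩
    ℤ.∣ ↥ r ∣ ℕ.* ↧ₙ q ℕ.* T                      ∎
    where
    open ≡-Reasoning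
    T : ℕ
    T = 2 ℕ.^ ℤ.∣ ↥ q ∣
    rational : ι (↧ r ℤ.* ↥ q) ≡ ι (↥ r ℤ.* ↧ q ℤ.* + T)
    rational = begin
      ι (↧ r ℤ.* ↥ q) ≡⟨ ι-* (↧ r) (↥ q) ⟩
      ι (↧ r) ℚ.* ι (↥ q) ≡⟨ cong (ι (↧ r) ℚ.*_) (*-ι-↧ q) ⟨
      ι (↧ r) ℚ.* (q ℚ.* ι (↧ q)) ≡⟨ cong (λ x → ι (↧ r) ℚ.* (x ℚ.* ι (↧ q))) e ⟩
      ι (↧ r) ℚ.* (ι (+ T) ℚ.* r ℚ.* ι (↧ q))   ≡⟨ 𝕢.solve 4 (λ d t r q → d 𝕢.:* (t 𝕢.:* r 𝕢.:* q) 𝕢.:= r 𝕢.:* d 𝕢.:* q 𝕢.:* t) refl (ι (↧ r)) (ι (+ T)) r (ι (↧ q)) ⟩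
      r ℚ.* ι (↧ r) ℚ.* ι (↧ q) ℚ.* ι (+ T)     ≡⟨ cong (λ x → x ℚ.* ι (↧ q) ℚ.* ι (+ T)) (*-ι-↧ r) ⟩
      ι (↥ r) ℚ.* ι (↧ q) ℚ.* ι (+ T) ≡⟨ trans (ι-* (↥ r ℤ.* ↧ q) (+ T)) (cong (ℚ._* ι (+ T)) (ι-* (↥ r) (↧ q))) ⟨
      ι (↥ r ℤ.* ↧ q ℤ.* + T)                   ∎
  too-large : ¬ ι (+ (2 ℕ.^ ℤ.∣ ↥ q ∣)) 𝕢.∣ q
  too-large (r , zr , e) = ℕₚ.<⇒≱ (n<2^n ℤ.∣ ↥ q ∣) (ℕ∣.∣⇒≤ {{ℕ.≢-nonZero numerator≢0}}
    (coprime-divisor (Coprime.sym (odd-coprime-2^ (odd-denominator zr) ℤ.∣ ↥ q ∣)) (divides (ℤ.∣ ↥ r ∣ ℕ.* ↧ₙ q) (integers r e))))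

-- The commutative ring ℚ[x]/(x^M + 1) in coordinates

module PowerBasis (M : ℕ) (0<M : 0 < M) where
  open 𝕢 using (solve; _:=_; con; _:+_; _:*_; _:-_; :-_; ∑; ∑-cong; ∑-+; ∑-*; ∑-head; ∑-Int)

  coord-tabulate : ∀ {n} (f : ℕ → ℚ) i → i < n → coord (tabulate {n = n} (f ∘ toℕ)) i ≡ f i
  coord-tabulate {suc n} f zero    _         = refl
  coord-tabulate {suc n} f (suc i) (s≤s i<n) = coord-tabulate (f ∘ suc) i i<n

  coord-ext : ∀ {n} {a b : K n} → (∀ i → i < n → coord a i ≡ coord b i) → a ≡ b
  coord-ext {a = []}    {[]}    h = refl
  coord-ext {a = x ∷ a} {y ∷ b} h = cong₂ _∷_ (h 0 (s≤s z≤n)) (coord-ext (λ i i<n → h (suc i) (s≤s i<n)))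

  coord-⊕ : ∀ {n} (a b : K n) i → coord (a ⊕ b) i ≡ coord a i ℚ.+ coord b i
  coord-⊕ []      []      i       = refl
  coord-⊕ (x ∷ a) (y ∷ b) zero    = refl
  coord-⊕ (x ∷ a) (y ∷ b) (suc i) = coord-⊕ a b i

  coord-⊖ : ∀ {n} (a b : K n) i → coord (a ⊖ b) i ≡ coord a i ℚ.- coord b i
  coord-⊖ []      []      i       = refl
  coord-⊖ (x ∷ a) (y ∷ b) zero    = refl
  coord-⊖ (x ∷ a) (y ∷ b) (suc i) = coord-⊖ a b i

  coord-• : ∀ {n} r (a : K n) i → coord (r • a) i ≡ r ℚ.* coord a i
  coord-• r []      i       = sym (ℚₚ.*-zeroʳ r)
  coord-• r (x ∷ a) zero    = refl
  coord-• r (x ∷ a) (suc i) = coord-• r a i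

  coord-zero : ∀ {n} i → coord {n} zeroK i ≡ 0ℚ
  coord-zero {zero}  i       = refl
  coord-zero {suc n} zero    = refl
  coord-zero {suc n} (suc i) = coord-zero {n} i

  coord-embed-suc : ∀ {n} r i → coord {n} (embed r) (suc i) ≡ 0ℚ
  coord-embed-suc {zero}  r i = refl
  coord-embed-suc {suc n} r i = coord-zero {n} i

  coord-embed-zero : ∀ r → coord {M} (embed r) 0 ≡ r
  coord-embed-zero r = coord-tabulate (λ j → if j ≡ᵇ 0 then r else 0ℚ) 0 0<M

  sumQ-applyUpTo : ∀ (f g : ℕ → ℚ) n → (∀ i → f i ≡ g i) → sumQ (applyUpTo f n) ≡ ∑ n g
  sumQ-applyUpTo f g zero    h = refl
  sumQ-applyUpTo f g (suc n) h = trans (cong₂ ℚ._+_ (h 0) (sumQ-applyUpTo (f ∘ suc) (g ∘ suc) n (h ∘ suc))) (sym (∑-head n g))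

  map-applyUpTo : ∀ {A B : Set} (h : A → B) (f : ℕ → A) n → List.map h (applyUpTo f n) ≡ applyUpTo (h ∘ f) n
  map-applyUpTo h f zero    = refl
  map-applyUpTo h f (suc n) = cong (h (f 0) List.∷_) (map-applyUpTo h (f ∘ suc) n)

  -- Coordinates of ζⁱ b for i ≤ M.
  shifted : K M → ℕ → ℕ → ℚ
  shifted b i k = if i ≤ᵇ k then coord b (k ∸ i) else ℚ.- coord b ((M ℕ.+ k) ∸ i)

  coord-⊛ : ∀ a b k → k < M → coord (a ⊛ b) k ≡ ∑ M (λ i → coord a i ℚ.* shifted b i k)
  coord-⊛ a b k k<M = trans (coord-tabulate (λ k → sumQ (List.map (λ i → coord a i ℚ.* shifted b i k) (upTo M))) k k<M)
    (trans (cong sumQ (map-applyUpTo (λ i → coord a i ℚ.* shifted b i k) id M))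
      (sumQ-applyUpTo (λ i → coord a i ℚ.* shifted b i k) _ M (λ _ → refl)))

  -- Multiplication by ζ. The ring laws are derived from this operator and `σ^M`, which expresses
  -- ζ^M = -1.
  σ : K M → K M
  σ b = tabulate (λ k → shifted b 1 (toℕ k))

  coord-σ-zero : ∀ b → coord (σ b) 0 ≡ ℚ.- coord b (M ∸ 1)
  coord-σ-zero b = trans (coord-tabulate (shifted b 1) 0 0<M) (cong (λ k → ℚ.- coord b (k ∸ 1)) (ℕₚ.+-identityʳ M))

  coord-σ-suc : ∀ b k → suc k < M → coord (σ b) (suc k) ≡ coord b k
  coord-σ-suc b k k<M = coord-tabulate (shifted b 1) (suc k) k<M

  σ^ : ℕ → K M → K M
  σ^ zero    b = b
  σ^ (suc i) b = σ (σ^ i b)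

  shifted-suc : ∀ b i k → shifted b (suc i) (suc k) ≡ shifted b i k
  shifted-suc b zero    k = refl
  shifted-suc b (suc i) k = cong (λ j → if i ℕ.<ᵇ k then coord b (k ∸ suc i) else ℚ.- coord b (j ∸ suc (suc i))) (ℕₚ.+-suc M k)

  ≤⇒≤ᵇ-true : ∀ {i k} → i ≤ k → (i ≤ᵇ k) ≡ true
  ≤⇒≤ᵇ-true {zero}        _         = refl
  ≤⇒≤ᵇ-true {suc zero}    (s≤s _)   = refl
  ≤⇒≤ᵇ-true {suc (suc i)} (s≤s i≤k) = ≤⇒≤ᵇ-true i≤k

  <⇒≤ᵇ-false : ∀ {i k} → k < i → (i ≤ᵇ k) ≡ false
  <⇒≤ᵇ-false {suc zero}    {zero}  _         = refl
  <⇒≤ᵇ-false {suc zero}    {suc k} (s≤s ())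
  <⇒≤ᵇ-false {suc (suc i)} {zero}  _         = refl
  <⇒≤ᵇ-false {suc (suc i)} {suc k} (s≤s k<i) = <⇒≤ᵇ-false k<i

  coord-σ^ : ∀ i b k → i ≤ M → k < M → coord (σ^ i b) k ≡ shifted b i k
  coord-σ^ zero    b k       _   _   = refl
  coord-σ^ (suc i) b zero    i<M k<M = begin
    coord (σ (σ^ i b)) 0 ≡⟨ coord-σ-zero (σ^ i b) ⟩
    ℚ.- coord (σ^ i b) (M ∸ 1) ≡⟨ cong ℚ.-_ (coord-σ^ i b (M ∸ 1) (ℕₚ.<⇒≤ i<M) (ℕₚ.∸-monoʳ-< {M} (s≤s z≤n) 0<M)) ⟩
    ℚ.- shifted b i (M ∸ 1) ≡⟨ cong (λ c → ℚ.- (if c then coord b (M ∸ 1 ∸ i) else ℚ.- coord b ((M ℕ.+ (M ∸ 1)) ∸ i))) (≤⇒≤ᵇ-true (ℕₚ.∸-monoˡ-≤ 1 i<M)) ⟩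
    ℚ.- coord b (M ∸ 1 ∸ i) ≡⟨ cong (λ j → ℚ.- coord b j) (trans (ℕₚ.∸-+-assoc M 1 i) (cong (_∸ suc i) (sym (ℕₚ.+-identityʳ M)))) ⟩
    ℚ.- coord b ((M ℕ.+ 0) ∸ suc i)      ∎
    where open ≡-Reasoning
  coord-σ^ (suc i) b (suc k) i<M k<M = trans (coord-σ-suc (σ^ i b) k k<M)
    (trans (coord-σ^ i b k (ℕₚ.<⇒≤ i<M) (ℕₚ.<⇒≤ k<M)) (sym (shifted-suc b i k)))

  neg : K M → K M
  neg a = ℚ.- 1ℚ • a

  coord-neg : ∀ a i → coord (neg a) i ≡ ℚ.- coord a i
  coord-neg a i = trans (coord-• (ℚ.- 1ℚ) a i) (solve 1 (λ x → con -[1+ 0 ] :* x := :- x) refl (coord a i))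

  σ^M : ∀ b → σ^ M b ≡ neg b
  σ^M b = coord-ext (λ k k<M → trans (coord-σ^ M b k ℕₚ.≤-refl k<M)
    (trans (cong (λ c → if c then coord b (k ∸ M) else ℚ.- coord b ((M ℕ.+ k) ∸ M)) (<⇒≤ᵇ-false k<M))
      (trans (cong (λ j → ℚ.- coord b j) (ℕₚ.m+n∸m≡n M k)) (sym (coord-neg b k)))))

  ⊕-assoc : ∀ (a b c : K M) → (a ⊕ b) ⊕ c ≡ a ⊕ (b ⊕ c)
  ⊕-assoc a b c = coord-ext (λ i _ → trans (trans (coord-⊕ (a ⊕ b) c i) (cong (ℚ._+ coord c i) (coord-⊕ a b i)))
    (trans (ℚₚ.+-assoc (coord a i) (coord b i) (coord c i)) (sym (trans (coord-⊕ a (b ⊕ c) i) (cong (coord a i ℚ.+_) (coord-⊕ b c i))))))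

  ⊕-comm : ∀ (a b : K M) → a ⊕ b ≡ b ⊕ a
  ⊕-comm a b = coord-ext (λ i _ → trans (coord-⊕ a b i) (trans (ℚₚ.+-comm (coord a i) (coord b i)) (sym (coord-⊕ b a i))))

  ⊕-identityˡ : ∀ (a : K M) → zeroK ⊕ a ≡ a
  ⊕-identityˡ a = coord-ext (λ i _ → trans (coord-⊕ zeroK a i) (trans (cong (ℚ._+ coord a i) (coord-zero {M} i)) (ℚₚ.+-identityˡ (coord a i))))

  ⊕-inverseˡ : ∀ (a : K M) → neg a ⊕ a ≡ zeroK
  ⊕-inverseˡ a = coord-ext (λ i _ → trans (coord-⊕ (neg a) a i) (trans (cong (ℚ._+ coord a i) (coord-neg a i))
    (trans (ℚₚ.+-inverseˡ (coord a i)) (sym (coord-zero {M} i)))))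

  •-⊕ : ∀ r (a b : K M) → r • (a ⊕ b) ≡ r • a ⊕ r • b
  •-⊕ r a b = coord-ext (λ i _ → trans (coord-• r (a ⊕ b) i) (trans (cong (r ℚ.*_) (coord-⊕ a b i))
    (trans (ℚₚ.*-distribˡ-+ r (coord a i) (coord b i)) (sym (trans (coord-⊕ (r • a) (r • b) i) (cong₂ ℚ._+_ (coord-• r a i) (coord-• r b i)))))))

  +-• : ∀ r s (a : K M) → (r ℚ.+ s) • a ≡ r • a ⊕ s • a
  +-• r s a = coord-ext (λ i _ → trans (coord-• (r ℚ.+ s) a i)
    (trans (ℚₚ.*-distribʳ-+ (coord a i) r s) (sym (trans (coord-⊕ (r • a) (s • a) i) (cong₂ ℚ._+_ (coord-• r a i) (coord-• s a i))))))

  *-• : ∀ r s (a : K M) → (r ℚ.* s) • a ≡ r • (s • a)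
  *-• r s a = coord-ext (λ i _ → trans (coord-• (r ℚ.* s) a i) (trans (ℚₚ.*-assoc r s (coord a i))
    (sym (trans (coord-• r (s • a) i) (cong (r ℚ.*_) (coord-• s a i))))))

  1-• : ∀ (a : K M) → 1ℚ • a ≡ a
  1-• a = coord-ext (λ i _ → trans (coord-• 1ℚ a i) (ℚₚ.*-identityˡ (coord a i)))

  0-• : ∀ (a : K M) → 0ℚ • a ≡ zeroK
  0-• a = coord-ext (λ i _ → trans (coord-• 0ℚ a i) (trans (ℚₚ.*-zeroˡ (coord a i)) (sym (coord-zero {M} i))))

  record Linear (f : K M → K M) : Set where
    field
      map-⊕ : ∀ a b → f (a ⊕ b) ≡ f a ⊕ f b
      map-• : ∀ r a → f (r • a) ≡ r • f a
  open Linear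

  σ-by-coords : ∀ {a b} → coord a 0 ≡ ℚ.- coord b (M ∸ 1) → (∀ k → suc k < M → coord a (suc k) ≡ coord b k) → a ≡ σ b
  σ-by-coords {a} {b} h₀ h = coord-ext λ where
    zero    _   → trans h₀ (sym (coord-σ-zero b))
    (suc k) k<M → trans (h k k<M) (sym (coord-σ-suc b k k<M))

  σ-linear : Linear σ
  σ-linear = record
    { map-⊕ = λ a b → sym (σ-by-coords {σ a ⊕ σ b} {a ⊕ b}
        (trans (coord-⊕ (σ a) (σ b) 0) (trans (cong₂ ℚ._+_ (coord-σ-zero a) (coord-σ-zero b))
          (trans (sym (ℚₚ.neg-distrib-+ (coord a (M ∸ 1)) (coord b (M ∸ 1)))) (cong ℚ.-_ (sym (coord-⊕ a b (M ∸ 1)))))))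
        (λ k k<M → trans (coord-⊕ (σ a) (σ b) (suc k)) (trans (cong₂ ℚ._+_ (coord-σ-suc a k k<M) (coord-σ-suc b k k<M)) (sym (coord-⊕ a b k)))))
    ; map-• = λ r a → sym (σ-by-coords {r • σ a} {r • a}
        (trans (coord-• r (σ a) 0) (trans (cong (r ℚ.*_) (coord-σ-zero a))
          (trans (sym (ℚₚ.neg-distribʳ-* r (coord a (M ∸ 1)))) (cong ℚ.-_ (sym (coord-• r a (M ∸ 1)))))))
        (λ k k<M → trans (coord-• r (σ a) (suc k)) (trans (cong (r ℚ.*_) (coord-σ-suc a k k<M)) (sym (coord-• r a k))))) }

  sumV : ℕ → (ℕ → K M) → K M
  sumV zero    f = zeroK
  sumV (suc n) f = sumV n f ⊕ f n

  coord-sumV : ∀ n f k → coord (sumV n f) k ≡ ∑ n (λ i → coord (f i) k)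
  coord-sumV zero    f k = coord-zero {M} k
  coord-sumV (suc n) f k = trans (coord-⊕ (sumV n f) (f n) k) (cong (ℚ._+ coord (f n) k) (coord-sumV n f k))

  sumV-cong : ∀ n {f g : ℕ → K M} → (∀ i → i < n → f i ≡ g i) → sumV n f ≡ sumV n g
  sumV-cong zero    h = refl
  sumV-cong (suc n) h = cong₂ _⊕_ (sumV-cong n (λ i i<n → h i (ℕₚ.m<n⇒m<1+n i<n))) (h n ℕₚ.≤-refl)

  sumV-⊕ : ∀ n (f g : ℕ → K M) → sumV n (λ i → f i ⊕ g i) ≡ sumV n f ⊕ sumV n g
  sumV-⊕ zero    f g = sym (⊕-identityˡ zeroK)
  sumV-⊕ (suc n) f g = trans (cong (_⊕ (f n ⊕ g n)) (sumV-⊕ n f g)) (interchange (sumV n f) (sumV n g) (f n) (g n))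
    where
    interchange : ∀ a b c d → (a ⊕ b) ⊕ (c ⊕ d) ≡ (a ⊕ c) ⊕ (b ⊕ d)
    interchange a b c d = trans (⊕-assoc a b (c ⊕ d)) (trans (cong (a ⊕_) (trans (sym (⊕-assoc b c d))
      (trans (cong (_⊕ d) (⊕-comm b c)) (⊕-assoc c b d)))) (sym (⊕-assoc a c (b ⊕ d))))

  linear-zero : ∀ {f} → Linear f → f zeroK ≡ zeroK
  linear-zero {f} lf = trans (cong f (sym (0-• zeroK))) (trans (map-• lf 0ℚ zeroK) (0-• (f zeroK)))

  linear-sumV : ∀ {f} → Linear f → ∀ n g → f (sumV n g) ≡ sumV n (f ∘ g)
  linear-sumV lf zero    g = linear-zero lf
  linear-sumV lf (suc n) g = trans (map-⊕ lf (sumV n g) (g n)) (cong (_⊕ _) (linear-sumV lf n g))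

  sumV-head : ∀ n (f : ℕ → K M) → sumV (suc n) f ≡ f 0 ⊕ sumV n (f ∘ suc)
  sumV-head zero    f = ⊕-comm zeroK (f 0)
  sumV-head (suc n) f = trans (cong (_⊕ f (suc n)) (sumV-head n f)) (⊕-assoc _ _ _)

  -- The product is a polynomial in σ with the coordinates of a as coefficients, applied to b. In
  -- this form bilinearity and commutation with ζ need little index arithmetic.
  ⊛-sumV : ∀ a b → a ⊛ b ≡ sumV M (λ i → coord a i • σ^ i b)
  ⊛-sumV a b = coord-ext (λ k k<M → trans (coord-⊛ a b k k<M) (sym (trans (coord-sumV M _ k)
    (coords M ℕₚ.≤-refl k k<M))))
    where
    coords : ∀ n → n ≤ M → ∀ k → k < M → ∑ n (λ i → coord (coord a i • σ^ i b) k) ≡ ∑ n (λ i → coord a i ℚ.* shifted b i k)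
    coords zero    _   k k<M = refl
    coords (suc n) n<M k k<M = cong₂ ℚ._+_ (coords n (ℕₚ.<⇒≤ n<M) k k<M)
      (trans (coord-• (coord a n) (σ^ n b) k) (cong (coord a n ℚ.*_) (coord-σ^ n b k (ℕₚ.<⇒≤ n<M) k<M)))

  compose-linear : ∀ {f g} → Linear f → Linear g → Linear (f ∘ g)
  compose-linear {f} lf lg = record
    { map-⊕ = λ a b → trans (cong f (map-⊕ lg a b)) (map-⊕ lf _ _)
    ; map-• = λ r a → trans (cong f (map-• lg r a)) (map-• lf r _) }

  σ^-linear : ∀ i → Linear (σ^ i)
  σ^-linear zero    = record { map-⊕ = λ _ _ → refl ; map-• = λ _ _ → refl }
  σ^-linear (suc i) = compose-linear σ-linear (σ^-linear i)

  •-comm : ∀ r s (a : K M) → r • (s • a) ≡ s • (r • a)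
  •-comm r s a = trans (sym (*-• r s a)) (trans (cong (_• a) (ℚₚ.*-comm r s)) (*-• s r a))

  •-linear : ∀ r → Linear (r •_)
  •-linear r = record { map-⊕ = •-⊕ r ; map-• = λ s a → •-comm r s a }

  ⊛-linearʳ : ∀ a → Linear (a ⊛_)
  ⊛-linearʳ a = record
    { map-⊕ = λ b c → trans (⊛-sumV a (b ⊕ c)) (trans
        (sumV-cong M (λ i _ → trans (cong (coord a i •_) (map-⊕ (σ^-linear i) b c)) (•-⊕ (coord a i) (σ^ i b) (σ^ i c))))
        (trans (sumV-⊕ M _ _) (sym (cong₂ _⊕_ (⊛-sumV a b) (⊛-sumV a c)))))
    ; map-• = λ r b → trans (⊛-sumV a (r • b)) (trans
        (sumV-cong M (λ i _ → trans (cong (coord a i •_) (map-• (σ^-linear i) r b)) (•-comm (coord a i) r (σ^ i b))))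
        (trans (sym (linear-sumV (•-linear r) M _)) (cong (r •_) (sym (⊛-sumV a b))))) }

  ⊛-linearˡ : ∀ b → Linear (_⊛ b)
  ⊛-linearˡ b = record
    { map-⊕ = λ a c → trans (⊛-sumV (a ⊕ c) b) (trans
        (sumV-cong M (λ i _ → trans (cong (_• σ^ i b) (coord-⊕ a c i)) (+-• (coord a i) (coord c i) (σ^ i b))))
        (trans (sumV-⊕ M _ _) (sym (cong₂ _⊕_ (⊛-sumV a b) (⊛-sumV c b)))))
    ; map-• = λ r a → trans (⊛-sumV (r • a) b) (trans
        (sumV-cong M (λ i _ → trans (cong (_• σ^ i b) (coord-• r a i)) (*-• r (coord a i) (σ^ i b))))
        (trans (sym (linear-sumV (•-linear r) M _)) (cong (r •_) (sym (⊛-sumV a b))))) }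

  ⊛-σʳ : ∀ a b → a ⊛ σ b ≡ σ (a ⊛ b)
  ⊛-σʳ a b = trans (⊛-sumV a (σ b)) (trans
    (sumV-cong M (λ i _ → trans (cong (coord a i •_) (σ^-σ i b)) (sym (map-• σ-linear (coord a i) (σ^ i b)))))
    (trans (sym (linear-sumV σ-linear M _)) (cong σ (sym (⊛-sumV a b)))))
    where
    σ^-σ : ∀ i b → σ^ i (σ b) ≡ σ (σ^ i b)
    σ^-σ zero    b = refl
    σ^-σ (suc i) b = cong σ (σ^-σ i b)

  -- Shift the summation index by one. The coordinate wrapped from M - 1 to 0 carries a sign, which
  -- is absorbed by σ^M = -1.
  ⊛-σˡ : ∀ a b → σ a ⊛ b ≡ σ (a ⊛ b)
  ⊛-σˡ a b = begin
    σ a ⊛ b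
      ≡⟨ ⊛-sumV (σ a) b ⟩
    sumV M (λ i → coord (σ a) i • σ^ i b)
      ≡⟨ cong (λ n → sumV n (λ i → coord (σ a) i • σ^ i b)) (sym M≡) ⟩
    sumV (suc m) (λ i → coord (σ a) i • σ^ i b)
      ≡⟨ sumV-head m (λ i → coord (σ a) i • σ^ i b) ⟩
    coord (σ a) 0 • b ⊕ sumV m (λ i → coord (σ a) (suc i) • σ^ (suc i) b)
      ≡⟨ cong₂ _⊕_ wrap (sumV-cong m (λ i i<m → trans (cong (_• σ^ (suc i) b) (coord-σ-suc a i (subst (suc i <_) M≡ (s≤s i<m))))
           (sym (map-• σ-linear (coord a i) (σ^ i b))))) ⟩
    σ (coord a m • σ^ m b) ⊕ sumV m (λ i → σ (coord a i • σ^ i b))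
      ≡⟨ ⊕-comm _ _ ⟩
    sumV (suc m) (λ i → σ (coord a i • σ^ i b))
      ≡⟨ linear-sumV σ-linear (suc m) _ ⟨
    σ (sumV (suc m) (λ i → coord a i • σ^ i b))
      ≡⟨ cong (λ n → σ (sumV n (λ i → coord a i • σ^ i b))) M≡ ⟩
    σ (sumV M (λ i → coord a i • σ^ i b))
      ≡⟨ cong σ (⊛-sumV a b) ⟨
    σ (a ⊛ b) ∎
    where
    open ≡-Reasoning
    m : ℕ
    m = M ∸ 1
    M≡ : suc m ≡ M
    M≡ = ℕₚ.m+[n∸m]≡n 0<M
    wrap : coord (σ a) 0 • b ≡ σ (coord a m • σ^ m b)
    wrap = begin
      coord (σ a) 0 • b ≡⟨ cong (_• b) (coord-σ-zero a) ⟩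
      (ℚ.- coord a m) • b ≡⟨ cong (_• b) (solve 1 (λ x → :- x := x :* con -[1+ 0 ]) refl (coord a m)) ⟩
      (coord a m ℚ.* ℚ.- 1ℚ) • b ≡⟨ *-• (coord a m) (ℚ.- 1ℚ) b ⟩
      coord a m • neg b ≡⟨ cong (coord a m •_) (trans (sym (σ^M b)) (cong (λ n → σ^ n b) (sym M≡))) ⟩
      coord a m • σ (σ^ m b) ≡⟨ map-• σ-linear (coord a m) (σ^ m b) ⟨
      σ (coord a m • σ^ m b)                  ∎

  ⊛-identityˡ : ∀ b → oneK ⊛ b ≡ b
  ⊛-identityˡ b = trans (⊛-sumV oneK b) (trans (cong (λ n → sumV n (λ i → coord {M} oneK i • σ^ i b)) (sym (ℕₚ.m+[n∸m]≡n 0<M)))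
    (trans (sumV-head (M ∸ 1) _) (trans (cong₂ _⊕_ (trans (cong (_• b) (coord-embed-zero 1ℚ)) (1-• b))
      (zeros (M ∸ 1))) (trans (⊕-comm b zeroK) (⊕-identityˡ b)))))
    where
    zeros : ∀ n → sumV n (λ i → coord {M} oneK (suc i) • σ^ (suc i) b) ≡ zeroK
    zeros zero    = refl
    zeros (suc n) = trans (cong₂ _⊕_ (zeros n) (trans (cong (_• σ^ (suc n) b) (coord-embed-suc {M} 1ℚ n)) (0-• _))) (⊕-identityˡ zeroK)

  coord-oneK-pos : ∀ {j} → 0 < j → coord {M} oneK j ≡ 0ℚ
  coord-oneK-pos {suc j} _ = coord-embed-suc {M} 1ℚ j

  shifted-oneK-≢ : ∀ i k → i < M → i ≢ k → shifted oneK i k ≡ 0ℚ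
  shifted-oneK-≢ i k i<M i≢k with ℕₚ.<-cmp i k
  ... | tri< i<k _ _ = trans (cong (λ c → if c then coord {M} oneK (k ∸ i) else ℚ.- coord {M} oneK ((M ℕ.+ k) ∸ i)) (≤⇒≤ᵇ-true (ℕₚ.<⇒≤ i<k)))
                         (coord-oneK-pos (ℕₚ.m<n⇒0<n∸m i<k))
  ... | tri≈ _ i≡k _ = ⊥-elim (i≢k i≡k)
  ... | tri> _ _ k<i = trans (cong (λ c → if c then coord {M} oneK (k ∸ i) else ℚ.- coord {M} oneK ((M ℕ.+ k) ∸ i)) (<⇒≤ᵇ-false k<i))
                         (cong ℚ.-_ (coord-oneK-pos (ℕₚ.m<n⇒0<n∸m (ℕₚ.≤-trans i<M (ℕₚ.m≤m+n M k)))))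

  shifted-oneK-≡ : ∀ k → shifted oneK k k ≡ 1ℚ
  shifted-oneK-≡ k = trans (cong (λ c → if c then coord {M} oneK (k ∸ k) else ℚ.- coord {M} oneK ((M ℕ.+ k) ∸ k)) (≤⇒≤ᵇ-true (ℕₚ.≤-refl {k})))
    (trans (cong (coord {M} oneK) (ℕₚ.n∸n≡0 k)) (coord-embed-zero 1ℚ))

  ⊛-identityʳ : ∀ a → a ⊛ oneK ≡ a
  ⊛-identityʳ a = coord-ext (λ k k<M → trans (coord-⊛ a oneK k k<M) (select k M ℕₚ.≤-refl k<M))
    where
    f : ℕ → ℕ → ℚ
    f k i = coord a i ℚ.* shifted oneK i k
    off : ∀ i k → i < M → i ≢ k → f k i ≡ 0ℚ
    off i k i<M i≢k = trans (cong (coord a i ℚ.*_) (shifted-oneK-≢ i k i<M i≢k)) (ℚₚ.*-zeroʳ (coord a i))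
    none : ∀ k n → n ≤ M → n ≤ k → ∑ n (f k) ≡ 0ℚ
    none k zero    _   _   = refl
    none k (suc n) n<M n<k = cong₂ ℚ._+_ (none k n (ℕₚ.<⇒≤ n<M) (ℕₚ.<⇒≤ n<k)) (off n k n<M (ℕₚ.<⇒≢ n<k))
    select : ∀ k n → n ≤ M → k < n → ∑ n (f k) ≡ coord a k
    select k (suc n) n<M (s≤s k≤n) with ℕₚ.m≤n⇒m<n∨m≡n k≤n
    ... | inj₁ k<n  = trans (cong₂ ℚ._+_ (select k n (ℕₚ.<⇒≤ n<M) k<n) (off n k n<M (λ n≡k → ℕₚ.<⇒≢ k<n (sym n≡k)))) (ℚₚ.+-identityʳ (coord a k))
    ... | inj₂ refl = trans (cong₂ ℚ._+_ (none k n (ℕₚ.<⇒≤ n<M) ℕₚ.≤-refl)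
        (trans (cong (coord a k ℚ.*_) (shifted-oneK-≡ k)) (ℚₚ.*-identityʳ (coord a k)))) (ℚₚ.+-identityˡ (coord a k))

  -- K M is generated by ζ over ℚ, so a ℚ-linear map commuting with multiplication by ζ is determined by its value at 1.
  determined : ∀ {f} → Linear f → (∀ a → f (σ a) ≡ σ (f a)) → ∀ a → f a ≡ a ⊛ f oneK
  determined {f} lf fσ a = begin
    f a ≡⟨ cong f (⊛-identityʳ a) ⟨
    f (a ⊛ oneK) ≡⟨ cong f (⊛-sumV a oneK) ⟩
    f (sumV M (λ i → coord a i • σ^ i oneK))      ≡⟨ linear-sumV lf M _ ⟩
    sumV M (λ i → f (coord a i • σ^ i oneK))      ≡⟨ sumV-cong M (λ i _ → trans (map-• lf (coord a i) (σ^ i oneK)) (cong (coord a i •_) (fσ^ i))) ⟩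
    sumV M (λ i → coord a i • σ^ i (f oneK))      ≡⟨ ⊛-sumV a (f oneK) ⟨
    a ⊛ f oneK                                    ∎
    where
    open ≡-Reasoning
    fσ^ : ∀ i → f (σ^ i oneK) ≡ σ^ i (f oneK)
    fσ^ zero    = refl
    fσ^ (suc i) = trans (fσ (σ^ i oneK)) (cong σ (fσ^ i))

  -- Apply `determined` to a ↦ (a ⊛ b) ⊛ c, whose value at 1 is b ⊛ c. Commutativity comes in the
  -- same way from a ↦ b ⊛ a.
  ⊛-assoc : ∀ a b c → (a ⊛ b) ⊛ c ≡ a ⊛ (b ⊛ c)
  ⊛-assoc a b c = trans
    (determined (compose-linear (⊛-linearˡ c) (⊛-linearˡ b)) (λ a → trans (cong (_⊛ c) (⊛-σˡ a b)) (⊛-σˡ (a ⊛ b) c)) a)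
    (cong (λ x → a ⊛ (x ⊛ c)) (⊛-identityˡ b))

  ⊛-comm : ∀ a b → a ⊛ b ≡ b ⊛ a
  ⊛-comm a b = sym (trans (determined (⊛-linearʳ b) (⊛-σʳ b) a) (cong (a ⊛_) (⊛-identityʳ b)))

  embed-• : ∀ r (a : K M) → embed r ⊛ a ≡ r • a
  embed-• r a = trans (cong (_⊛ a) (coord-ext {a = embed r} {r • oneK} coords)) (trans (map-• (⊛-linearˡ a) r oneK) (cong (r •_) (⊛-identityˡ a)))
    where
    coords : ∀ k → k < M → coord {M} (embed r) k ≡ coord (r • oneK {M}) k
    coords zero    _ = sym (trans (coord-• r (oneK {M}) 0) (trans (cong (r ℚ.*_) (coord-embed-zero 1ℚ)) (trans (ℚₚ.*-identityʳ r) (sym (coord-embed-zero r)))))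
    coords (suc k) _ = trans (coord-embed-suc {M} r k) (sym (trans (coord-• r (oneK {M}) (suc k)) (trans (cong (r ℚ.*_) (coord-embed-suc {M} 1ℚ k)) (ℚₚ.*-zeroʳ r))))

  embed-≡ : ∀ r → embed r ≡ r • oneK {M}
  embed-≡ r = trans (sym (⊛-identityʳ (embed r))) (embed-• r oneK)

  embed-+ : ∀ r s → embed {M} (r ℚ.+ s) ≡ embed r ⊕ embed s
  embed-+ r s = trans (embed-≡ (r ℚ.+ s)) (trans (+-• r s oneK) (sym (cong₂ _⊕_ (embed-≡ r) (embed-≡ s))))

  embed-* : ∀ r s → embed {M} (r ℚ.* s) ≡ embed r ⊛ embed s
  embed-* r s = trans (embed-≡ (r ℚ.* s)) (trans (*-• r s oneK) (sym (trans (embed-• r (embed s)) (cong (r •_) (embed-≡ s)))))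

  embed-neg : ∀ r → embed {M} (ℚ.- r) ≡ neg (embed r)
  embed-neg r = trans (cong embed (solve 1 (λ r → :- r := con -[1+ 0 ] :* r) refl r)) (trans (embed-* (ℚ.- 1ℚ) r) (embed-• (ℚ.- 1ℚ) (embed r)))

  embed-0 : embed {M} 0ℚ ≡ zeroK
  embed-0 = trans (embed-≡ 0ℚ) (0-• oneK)

  -- Zero is written `embed 0ℚ` to agree definitionally with the image of the integer 0.
  isCommutativeRing : IsCommutativeRing _≡_ _⊕_ _⊛_ neg (embed {M} 0ℚ) (embed 1ℚ)
  isCommutativeRing = record
    { isRing = record
      { +-isAbelianGroup = record
        { isGroup = record
          { isMonoid = record
            { isSemigroup = record { isMagma = isMagma _⊕_ ; assoc = ⊕-assoc }
            ; identity = identityˡ , λ a → trans (⊕-comm a (embed 0ℚ)) (identityˡ a) }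
          ; inverse = inverseˡ , λ a → trans (⊕-comm a (neg a)) (inverseˡ a)
          ; ⁻¹-cong = cong neg }
        ; comm = ⊕-comm }
      ; *-cong = cong₂ _⊛_
      ; *-assoc = ⊛-assoc
      ; *-identity = ⊛-identityˡ , ⊛-identityʳ
      ; distrib = (λ a → map-⊕ (⊛-linearʳ a)) , (λ a → map-⊕ (⊛-linearˡ a)) }
    ; *-comm = ⊛-comm }
    where
    identityˡ : ∀ a → embed 0ℚ ⊕ a ≡ a
    identityˡ a = trans (cong (_⊕ a) embed-0) (⊕-identityˡ a)
    inverseˡ : ∀ a → neg a ⊕ a ≡ embed 0ℚ
    inverseˡ a = trans (⊕-inverseˡ a) (sym embed-0)

  record Integral (a : K M) : Set where
    constructor mkIntegral
    field coord-Z₂ : ∀ i → Z₂ (coord a i)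
  open Integral public

  TwoIntegral⇒Integral : ∀ {a} → TwoIntegral a → Integral a
  TwoIntegral⇒Integral h = mkIntegral (go h)
    where
    go : ∀ {n} {a : K n} → TwoIntegral a → ∀ i → Z₂ (coord a i)
    go []      i       = Z₂-ι (+ 0)
    go (p ∷ h) zero    = mkZ₂ p
    go (p ∷ h) (suc i) = go h i

  Integral⇒TwoIntegral : ∀ {a} → Integral a → TwoIntegral a
  Integral⇒TwoIntegral h = go (coord-Z₂ h)
    where
    go : ∀ {n} {a : K n} → (∀ i → Z₂ (coord a i)) → TwoIntegral a
    go {a = []}    h = []
    go {a = x ∷ a} h = Z₂.odd-denominator (h 0) ∷ go (h ∘ suc)

  -- Integrality quantifies over all indices; beyond the last one `coord` has the default value 0.
  below-Integral : ∀ {a} → (∀ i → i < M → Z₂ (coord a i)) → Integral a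
  below-Integral {a} h = mkIntegral all
    where
    beyond : ∀ {n} (a : K n) i → n ≤ i → coord a i ≡ 0ℚ
    beyond []      i       _         = refl
    beyond (x ∷ a) (suc i) (s≤s n≤i) = beyond a i n≤i
    all : ∀ i → Z₂ (coord a i)
    all i with i ℕₚ.<? M
    ... | yes i<M = h i i<M
    ... | no  i≮M = subst Z₂ (sym (beyond a i (ℕₚ.≮⇒≥ i≮M))) (Z₂-ι (+ 0))

  Z₂-neg : ∀ {q} → Z₂ q → Z₂ (ℚ.- q)
  Z₂-neg = 𝕢.Int-neg

  Integral-⊕ : ∀ {a b} → Integral a → Integral b → Integral (a ⊕ b)
  Integral-⊕ {a} {b} ia ib = mkIntegral (λ i → subst Z₂ (sym (coord-⊕ a b i)) (Z₂-+ (coord-Z₂ ia i) (coord-Z₂ ib i)))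

  Integral-⊛ : ∀ {a b} → Integral a → Integral b → Integral (a ⊛ b)
  Integral-⊛ {a} {b} ia ib = below-Integral (λ k k<M → subst Z₂ (sym (coord-⊛ a b k k<M))
    (∑-Int M (λ i → Z₂-* (coord-Z₂ ia i) (shifted-Z₂ i k (i ≤ᵇ k)))))
    where
    shifted-Z₂ : ∀ i k c → Z₂ (if c then coord b (k ∸ i) else ℚ.- coord b ((M ℕ.+ k) ∸ i))
    shifted-Z₂ i k true  = coord-Z₂ ib (k ∸ i)
    shifted-Z₂ i k false = Z₂-neg (coord-Z₂ ib ((M ℕ.+ k) ∸ i))

  Integral-embed : ∀ {r} → Z₂ r → Integral (embed r)
  Integral-embed {r} zr = mkIntegral coords
    where
    coords : ∀ i → Z₂ (coord {M} (embed r) i)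
    coords zero    = subst Z₂ (sym (coord-embed-zero r)) zr
    coords (suc i) = subst Z₂ (sym (coord-embed-suc {M} r i)) (Z₂-ι (+ 0))

  K-dyadic : DyadicRing
  K-dyadic = record
    { Carrier = K M ; _+_ = _⊕_ ; _*_ = _⊛_ ; -_ = neg ; #_ = λ z → embed (ι z)
    ; isCommutativeRing = isCommutativeRing
    ; #-+ = λ a b → trans (cong embed (ι-+ a b)) (embed-+ (ι a) (ι b))
    ; #-* = λ a b → trans (cong embed (ι-* a b)) (embed-* (ι a) (ι b))
    ; #-neg = λ a → trans (cong embed (ι-neg a)) (embed-neg (ι a))
    ; inverse = λ n → embed ((+ 1) ℚ./ suc n) , trans (sym (embed-* ((+ 1) ℚ./ suc n) (ι (+ suc n)))) (cong embed (/-*-ι (+ 1) (suc n)))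
    ; Int = Integral ; Int-+ = Integral-⊕ ; Int-* = Integral-⊛ ; Int-# = λ a → Integral-embed (Z₂-ι a) }

-- The cyclotomic field as a dyadic ring, and complex conjugation

module CyclotomicField (r : ℕ) where
  open PowerBasis (2 ℕ.^ r) (ℕₚ.m^n>0 2 r) public
  module 𝕂 = Dyadic K-dyadic
  open 𝕂 using (_∣_; _^_; 1#; 0#; 2#; ∣-+; ∣-*ʳ; ∣-*ˡ; ≡-∣; ∣-trans; ∣-refl; ∣-neg; ∣-0)
  open 𝕂 using (∑; ∑-Int)

  M : ℕ
  M = 2 ℕ.^ r

  0<M : 0 < M
  0<M = ℕₚ.m^n>0 2 r

  ⊖-≡ : ∀ (a b : K M) → a ⊖ b ≡ a 𝕂.- b
  ⊖-≡ a b = coord-ext (λ i _ → trans (coord-⊖ a b i) (sym (trans (coord-⊕ a (neg b) i) (cong (coord a i ℚ.+_) (coord-neg b i)))))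

  ζ : K M
  ζ = σ oneK

  ζ-⊛ : ∀ x → ζ ⊛ x ≡ σ x
  ζ-⊛ x = trans (⊛-σˡ oneK x) (cong σ (⊛-identityˡ x))

  ζ^ : ∀ i → ζ ^ i ≡ σ^ i oneK
  ζ^ zero    = refl
  ζ^ (suc i) = trans (ζ-⊛ (ζ ^ i)) (cong σ (ζ^ i))

  σ-Integral : ∀ {a} → Integral a → Integral (σ a)
  σ-Integral {a} ia = below-Integral λ where
    zero    _   → subst Z₂ (sym (coord-σ-zero a)) (Z₂-neg (coord-Z₂ ia (M ∸ 1)))
    (suc k) k<M → subst Z₂ (sym (coord-σ-suc a k k<M)) (coord-Z₂ ia k)

  ζ-Integral : Integral ζ
  ζ-Integral = σ-Integral (Integral-embed (Z₂-ι (+ 1)))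

  ζ-power : ζ ^ M ≡ 𝕂.# -[1+ 0 ]
  ζ-power = trans (ζ^ M) (trans (σ^M oneK) (sym (embed-neg 1ℚ)))

  embed-∣ : ∀ a {q} → ι a 𝕢.∣ q → 𝕂.# a ∣ embed q
  embed-∣ a (s , zs , refl) = embed s , Integral-embed zs , embed-* (ι a) s

  coordinate-parity : ∀ {q} → Z₂ q → 2# ∣ embed q ⊎ 2# ∣ embed q 𝕂.- 1#
  coordinate-parity {q} zq with Z₂-residue q zq
  ... | inj₁ h = inj₁ (embed-∣ (+ 2) h)
  ... | inj₂ h = inj₂ (subst (2# ∣_) (trans (embed-+ q (ℚ.- ι (+ 1))) (cong (embed q ⊕_) (embed-neg (ι (+ 1))))) (embed-∣ (+ 2) h))

  sumV-∑ : ∀ n f → sumV n f ≡ ∑ n f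
  sumV-∑ zero    f = sym embed-0
  sumV-∑ (suc n) f = cong (_⊕ f n) (sumV-∑ n f)

  power-basis : ∀ x → x ≡ ∑ M (λ i → embed (coord x i) ⊛ ζ ^ i)
  power-basis x = trans (sym (⊛-identityʳ x)) (trans (⊛-sumV x oneK)
    (trans (sumV-cong M (λ i _ → trans (sym (embed-• (coord x i) (σ^ i oneK))) (cong (embed (coord x i) ⊛_) (sym (ζ^ i)))))
      (sumV-∑ M (λ i → embed (coord x i) ⊛ ζ ^ i))))

  common-denominator : ∀ {n} (a : K n) → ∃ λ d → ∀ i → Z₂ (ι (+ suc d) ℚ.* coord a i)
  common-denominator []      = 0 , λ i → Z₂-ι (+ 0)
  common-denominator (x ∷ a) with common-denominator a
  -- The successor of this number is the product of the denominator of x with `suc d`.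
  ... | d , h = d ℕ.+ (↧ₙ x ℕ.∸ 1) ℕ.* suc d , coords
    where
    open ≡-Reasoning
    D : ℕ
    D = suc (d ℕ.+ (↧ₙ x ℕ.∸ 1) ℕ.* suc d)
    split : ∀ y → ι (+ D) ℚ.* y ≡ ι (+ (↧ₙ x)) ℚ.* (ι (+ suc d) ℚ.* y)
    split y = trans (cong (ℚ._* y) (ι-ℕ* (↧ₙ x) (suc d))) (ℚₚ.*-assoc (ι (+ (↧ₙ x))) (ι (+ suc d)) y)
    coords : ∀ i → Z₂ (ι (+ D) ℚ.* coord (x ∷ a) i)
    coords (suc i) = subst Z₂ (sym (split (coord a i))) (Z₂-* (Z₂-ι (+ (↧ₙ x))) (h i))
    coords zero    = subst Z₂ (sym (trans (split x)
      (trans (𝕢.solve 3 (λ x y z → y 𝕢.:* (z 𝕢.:* x) 𝕢.:= z 𝕢.:* (x 𝕢.:* y)) refl x (ι (+ (↧ₙ x))) (ι (+ suc d)))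
        (cong (ι (+ suc d) ℚ.*_) (*-ι-↧ x))))) (Z₂-* (Z₂-ι (+ suc d)) (Z₂-ι (↥ x)))

  nonzero-coord : ∀ {n} (a : K n) → a ≢ zeroK → ∃ λ i → coord a i ≢ 0ℚ
  nonzero-coord []      h = ⊥-elim (h refl)
  nonzero-coord (x ∷ a) h with x ℚₚ.≟ 0ℚ
  ... | no x≢0 = 0 , x≢0
  ... | yes x≡0 with nonzero-coord a (λ a≡0 → h (cong₂ _∷_ x≡0 a≡0))
  ...   | i , ≢0 = suc i , ≢0

  coord-∣ : ∀ a {x} i → 𝕂.# a ∣ x → ι a 𝕢.∣ coord x i
  coord-∣ a i (y , iy , refl) = coord y i , coord-Z₂ iy i , trans (cong (λ z → coord z i) (embed-• (ι a) y)) (coord-• (ι a) y i)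

  2#^-≡ : ∀ N → 2# ^ N ≡ 𝕂.# (+ (2 ℕ.^ N))
  2#^-≡ zero    = refl
  2#^-≡ (suc N) = trans (cong (2# ⊛_) (2#^-≡ N)) (sym (𝕂.#-double (2 ℕ.^ N)))

  2∤1ᴷ : ¬ 2# ∣ 1#
  2∤1ᴷ h = 2∤1 (subst (ι (+ 2) 𝕢.∣_) (coord-embed-zero 1ℚ) (coord-∣ (+ 2) 0 h))

  denominator-Integral : ∀ x → Integral (embed (ι (+ suc (proj₁ (common-denominator x)))) ⊛ x)
  denominator-Integral x = mkIntegral (λ i → subst Z₂
    (sym (trans (cong (λ y → coord y i) (embed-• q x)) (coord-• q x i))) (proj₂ (common-denominator x) i))
    where
    q : ℚ
    q = ι (+ suc (proj₁ (common-denominator x)))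

  separated : ∀ x → x ≢ 0# → ∃ λ N → ¬ 2# ^ N ∣ x
  separated x x≢0 = N , λ h → ¬N∣ (coord-∣ (+ (2 ℕ.^ N)) i (subst (_∣ x) (2#^-≡ N) h))
    where
    nonzero : ∃ λ i → coord x i ≢ 0ℚ
    nonzero = nonzero-coord x (λ e → x≢0 (trans e (sym embed-0)))
    i N : ℕ
    i = proj₁ nonzero
    N = proj₁ (Z₂-separated (coord x i) (proj₂ nonzero))
    ¬N∣ : ¬ ι (+ (2 ℕ.^ N)) 𝕢.∣ coord x i
    ¬N∣ = proj₂ (Z₂-separated (coord x i) (proj₂ nonzero))

  span : ∀ x → Integral x → ∃ λ (a : ℕ → K M) → (∀ i → Integral (a i) × (2# ∣ a i ⊎ 2# ∣ a i 𝕂.- 1#)) × x ≡ ∑ M (λ i → a i ⊛ ζ ^ i)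
  span x ix = (λ i → embed (coord x i)) , (λ i → Integral-embed (coord-Z₂ ix i) , coordinate-parity (coord-Z₂ ix i)) , power-basis x

  cyclotomic : 𝕂.CyclotomicData
  cyclotomic = record
    { r = r ; ζ = ζ ; Int-ζ = ζ-Integral ; ζ-power = ζ-power
    ; _≟_ = ≡-dec ℚₚ._≟_
    ; denominator = λ x → proj₁ (common-denominator x) , denominator-Integral x
    ; separated = separated
    ; span = span ; 2∤1 = 2∤1ᴷ }

  open 𝕂.Cyclotomic cyclotomic using (square-roots; roots-of-unity; ^-*) public

  conj-coord : ∀ (a : K M) j → j < M → coord (conj a) j ≡ (if j ≡ᵇ 0 then coord a 0 else ℚ.- coord a (M ∸ j))
  conj-coord a j j<M = coord-tabulate (λ j → if j ≡ᵇ 0 then coord a 0 else ℚ.- coord a (M ∸ j)) j j<M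

  -- Conjugation inverts ζ. Used once per factor ζ, this relation shows that ζʲ times its conjugate
  -- is 1, with no need for full multiplicativity of `conj`.
  σ-conj-σ : ∀ a → σ (conj (σ a)) ≡ conj a
  σ-conj-σ a = sym (σ-by-coords {conj a} {conj (σ a)} first rest)
    where
    open ≡-Reasoning
    first : coord (conj a) 0 ≡ ℚ.- coord (conj (σ a)) (M ∸ 1)
    first = trans (conj-coord a 0 0<M) (last (M ∸ 1) refl)
      where
      last : ∀ j → M ∸ 1 ≡ j → coord a 0 ≡ ℚ.- coord (conj (σ a)) (M ∸ 1)
      -- This is the case M = 1, where the coordinate M - 1 that wraps around is coordinate 0
      -- itself.
      last zero    e = sym (begin
        ℚ.- coord (conj (σ a)) (M ∸ 1)  ≡⟨ cong (λ j → ℚ.- coord (conj (σ a)) j) e ⟩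
        ℚ.- coord (conj (σ a)) 0 ≡⟨ cong ℚ.-_ (trans (conj-coord (σ a) 0 0<M) (coord-σ-zero a)) ⟩
        ℚ.- (ℚ.- coord a (M ∸ 1)) ≡⟨ 𝕢.solve 1 (λ x → 𝕢.:- (𝕢.:- x) 𝕢.:= x) refl (coord a (M ∸ 1)) ⟩
        coord a (M ∸ 1) ≡⟨ cong (coord a) e ⟩
        coord a 0                       ∎)
      last (suc j) e = sym (begin
        ℚ.- coord (conj (σ a)) (M ∸ 1) ≡⟨ cong (λ j → ℚ.- coord (conj (σ a)) j) e ⟩
        ℚ.- coord (conj (σ a)) (suc j) ≡⟨ cong ℚ.-_ (conj-coord (σ a) (suc j) (subst (_< M) e (ℕₚ.∸-monoʳ-< {M} (s≤s z≤n) 0<M))) ⟩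
        ℚ.- (ℚ.- coord (σ a) (M ∸ suc j))     ≡⟨ 𝕢.solve 1 (λ x → 𝕢.:- (𝕢.:- x) 𝕢.:= x) refl _ ⟩
        coord (σ a) (M ∸ suc j) ≡⟨ cong (λ k → coord (σ a) (k ∸ suc j)) M≡ ⟩
        coord (σ a) (suc (suc j) ∸ suc j)     ≡⟨ cong (coord (σ a)) (trans (ℕₚ.+-∸-assoc 1 (ℕₚ.≤-refl {suc j})) (cong suc (ℕₚ.n∸n≡0 (suc j)))) ⟩
        coord (σ a) 1 ≡⟨ coord-σ-suc a 0 (subst (1 <_) (sym M≡) (s≤s (s≤s z≤n))) ⟩
        coord a 0                             ∎)
        where
        M≡ : M ≡ suc (suc j)
        M≡ = trans (sym (ℕₚ.m+[n∸m]≡n 0<M)) (cong suc e)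
    rest : ∀ k → suc k < M → coord (conj a) (suc k) ≡ coord (conj (σ a)) k
    rest zero    k<M = trans (conj-coord a 1 k<M) (sym (trans (conj-coord (σ a) 0 0<M) (coord-σ-zero a)))
    rest (suc k) k<M = trans (conj-coord a (suc (suc k)) k<M) (sym (trans (conj-coord (σ a) (suc k) (ℕₚ.<⇒≤ k<M))
      (cong ℚ.-_ (trans (cong (coord (σ a)) (sym succ)) (coord-σ-suc a (M ∸ suc (suc k))
        (subst (_< M) (sym succ) (ℕₚ.∸-monoʳ-< {M} (s≤s z≤n) (ℕₚ.<⇒≤ (ℕₚ.<⇒≤ k<M)))))))))
      where
      succ : suc (M ∸ suc (suc k)) ≡ M ∸ suc k
      succ = sym (ℕₚ.+-∸-assoc 1 (ℕₚ.<⇒≤ k<M))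

  conj-oneK : conj {M} oneK ≡ oneK
  conj-oneK = coord-ext λ where
    zero    j<M → conj-coord oneK 0 j<M
    (suc j) j<M → trans (conj-coord oneK (suc j) j<M)
      (trans (cong ℚ.-_ (coord-oneK-pos (ℕₚ.m<n⇒0<n∸m j<M))) (sym (coord-embed-suc {M} 1ℚ j)))

  conj-root : ∀ j → ζ ^ j ⊛ conj (ζ ^ j) ≡ oneK
  conj-root j = trans (cong (λ x → ζ ^ j ⊛ conj x) (ζ^ j)) (go j)
    where
    open ≡-Reasoning
    go : ∀ j → ζ ^ j ⊛ conj (σ^ j oneK) ≡ oneK
    go zero    = trans (⊛-identityˡ (conj oneK)) conj-oneK
    go (suc j) = begin
      (ζ ⊛ ζ ^ j) ⊛ conj (σ (σ^ j oneK))   ≡⟨ trans (cong (_⊛ conj (σ (σ^ j oneK))) (⊛-comm ζ (ζ ^ j))) (⊛-assoc (ζ ^ j) ζ (conj (σ (σ^ j oneK)))) ⟩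
      ζ ^ j ⊛ (ζ ⊛ conj (σ (σ^ j oneK)))   ≡⟨ cong (ζ ^ j ⊛_) (trans (ζ-⊛ (conj (σ (σ^ j oneK)))) (σ-conj-σ (σ^ j oneK))) ⟩
      ζ ^ j ⊛ conj (σ^ j oneK) ≡⟨ go j ⟩
      oneK                                 ∎

  unit-root : ∀ {v} → v ^ (2 ℕ.^ suc r) ≡ oneK → Integral v × v ⊛ conj v ≡ oneK
  unit-root {v} e = from (roots-of-unity e)
    where
    from : (∃ λ j → v ≡ ζ ^ j) → Integral v × v ⊛ conj v ≡ oneK
    from (j , v≡) = subst (λ v → Integral v × v ⊛ conj v ≡ oneK) (sym v≡) (𝕂.Int-^ ζ-Integral j , conj-root j)

-- Transfer to the characters and Bernoulli numbers of the statement

module Main (r : ℕ)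
  (χ : ℤ → K (2 ℕ.^ r)) (isχ : IsDirichletChar (2 ℕ.^ (3 ℕ.+ r)) χ) (isPrimitive : IsPrimitive (2 ℕ.^ (3 ℕ.+ r)) χ)
  (B : ℕ → K (2 ℕ.^ r)) (isB : IsGenBernoulli (2 ℕ.^ (3 ℕ.+ r)) χ B) where

  open CyclotomicField r
  open 𝕂 using (∑; ∑-cong; ∑-head; ∑-*)
  open IsDirichletChar isχ

  N : ℕ
  N = 2 ℕ.^ (3 ℕ.+ r)

  sumK-∑ : ∀ (f : ℕ → K M) n → sumK (applyUpTo f n) ≡ ∑ n f
  sumK-∑ f zero    = sym embed-0
  sumK-∑ f (suc n) = trans (cong (f 0 ⊕_) (sumK-∑ (f ∘ suc) n)) (sym (∑-head n f))

  sumK-upTo : ∀ (f : ℕ → K M) n → sumK (List.map f (upTo n)) ≡ ∑ n f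
  sumK-upTo f n = trans (cong sumK (map-applyUpTo f id n)) (sumK-∑ f n)

  coefficient : ℕ → ℕ → ℚ
  coefficient n j = frac 1 (j !) {{j !≢0}} ℚ.* frac (N ℕ.^ (suc n ∸ j)) ((suc n ∸ j) !) {{(suc n ∸ j) !≢0}}

  coefficient-factorial : ∀ n j → 𝕂.# (+ (j ! ℕ.* (suc n ∸ j) !)) ⊛ embed (coefficient n j) ≡ 𝕂.# (+ N) 𝕂.^ (suc n ∸ j)
  coefficient-factorial n j = trans (sym (embed-* (ι (+ (j ! ℕ.* (suc n ∸ j) !))) (coefficient n j)))
    (trans (cong embed rational) (𝕂.#-^ N (suc n ∸ j)))
    where
    open ≡-Reasoning
    x y a b : ℚ
    x = ι (+ (j !))
    y = ι (+ ((suc n ∸ j) !))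
    a = frac 1 (j !) {{j !≢0}}
    b = frac (N ℕ.^ (suc n ∸ j)) ((suc n ∸ j) !) {{(suc n ∸ j) !≢0}}
    rearrange : ∀ x y a b → (x ℚ.* y) ℚ.* (a ℚ.* b) ≡ (a ℚ.* x) ℚ.* (b ℚ.* y)
    rearrange = 𝕢.solve 4 (λ x y a b → (x 𝕢.:* y) 𝕢.:* (a 𝕢.:* b) 𝕢.:= (a 𝕢.:* x) 𝕢.:* (b 𝕢.:* y)) refl
    rational : ι (+ (j ! ℕ.* (suc n ∸ j) !)) ℚ.* coefficient n j ≡ ι (+ (N ℕ.^ (suc n ∸ j)))
    rational = begin
      ι (+ (j ! ℕ.* (suc n ∸ j) !)) ℚ.* (a ℚ.* b)   ≡⟨ cong (ℚ._* (a ℚ.* b)) (ι-ℕ* (j !) ((suc n ∸ j) !)) ⟩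
      (x ℚ.* y) ℚ.* (a ℚ.* b) ≡⟨ rearrange x y a b ⟩
      (a ℚ.* x) ℚ.* (b ℚ.* y) ≡⟨ cong₂ ℚ._*_ (/-*-ι (+ 1) (j !) {{j !≢0}}) (/-*-ι (+ (N ℕ.^ (suc n ∸ j))) ((suc n ∸ j) !) {{(suc n ∸ j) !≢0}}) ⟩
      1ℚ ℚ.* ι (+ (N ℕ.^ (suc n ∸ j))) ≡⟨ ℚₚ.*-identityˡ _ ⟩
      ι (+ (N ℕ.^ (suc n ∸ j)))                     ∎

  generating : ∀ n → 𝕂.# (+ (n !)) ⊛ ∑ (suc n) (λ j → embed (coefficient n j) ⊛ B j)
                   ≡ ∑ N (λ i → 𝕂.# (+ (suc i ℕ.^ n)) ⊛ χ (+ suc i))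
  generating n = begin
    𝕂.# (+ (n !)) ⊛ ∑ (suc n) (λ j → embed (coefficient n j) ⊛ B j)
      ≡⟨ cong (𝕂.# (+ (n !)) ⊛_) (∑-cong (suc n) (λ j → embed-• (coefficient n j) (B j))) ⟩
    𝕂.# (+ (n !)) ⊛ ∑ (suc n) (λ j → coefficient n j • B j)
      ≡⟨ cong (𝕂.# (+ (n !)) ⊛_) (trans (sym (sumK-upTo (λ j → coefficient n j • B j) (suc n))) (trans (isB n) (sumK-upTo f N))) ⟩
    𝕂.# (+ (n !)) ⊛ ∑ N f
      ≡⟨ ∑-* N (𝕂.# (+ (n !))) f ⟨
    ∑ N (λ i → 𝕂.# (+ (n !)) ⊛ f i)
      ≡⟨ ∑-cong N term ⟩
    ∑ N (λ i → 𝕂.# (+ (suc i ℕ.^ n)) ⊛ χ (+ suc i)) ∎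
    where
    open ≡-Reasoning
    f : ℕ → K M
    f i = frac (suc i ℕ.^ n) (n !) {{n !≢0}} • χ (+ suc i)
    term : ∀ i → 𝕂.# (+ (n !)) ⊛ f i ≡ 𝕂.# (+ (suc i ℕ.^ n)) ⊛ χ (+ suc i)
    term i = trans (embed-• (ι (+ (n !))) (f i)) (trans (sym (*-• (ι (+ (n !))) q (χ (+ suc i))))
      (trans (cong (_• χ (+ suc i)) (trans (ℚₚ.*-comm (ι (+ (n !))) q) (/-*-ι (+ (suc i ℕ.^ n)) (n !) {{n !≢0}})))
        (sym (embed-• (ι (+ (suc i ℕ.^ n))) (χ (+ suc i))))))
      where
      q : ℚ
      q = frac (suc i ℕ.^ n) (n !) {{n !≢0}}

  Lneg-B : ∀ j → 𝕂.# (+ suc j) ⊛ Lneg B j ≡ neg (B (suc j))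
  Lneg-B j = trans (embed-• (ι (+ suc j)) (Lneg B j)) (trans (sym (*-• (ι (+ suc j)) (ℚ.- frac 1 (suc j)) (B (suc j))))
    (cong (_• B (suc j)) (trans (𝕢.solve 2 (λ x y → x 𝕢.:* (𝕢.:- y) 𝕢.:= 𝕢.:- (y 𝕢.:* x)) refl (ι (+ suc j)) (frac 1 (suc j)))
      (cong ℚ.-_ (/-*-ι (+ 1) (suc j))))))

  even-zero : ∀ b → χ (+ (2 ℕ.* b)) ≡ embed 0ℚ
  even-zero b = trans (nonunit-zero (+ (2 ℕ.* b)) not-coprime) (sym embed-0)
    where
    not-coprime : ¬ Coprime (2 ℕ.* b) N
    not-coprime c with c {2} (divides b (ℕₚ.*-comm 2 b) , divides (2 ℕ.^ (2 ℕ.+ r)) (ℕₚ.*-comm 2 (2 ℕ.^ (2 ℕ.+ r))))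
    ... | ()

  -- Primitivity is applied to d = 4M, half of the modulus; every proper divisor of the modulus
  -- divides it.
  nontrivial-kernel : ¬ (∀ c → χ (+ 1 ℤ.+ + (2 ℕ.^ (2 ℕ.+ r)) ℤ.* c) ≡ 𝕂.# (+ 1))
  nontrivial-kernel h = isPrimitive d (divides 2 refl) (ℕₚ.m<m+n d (ℕₚ.≤-trans (ℕₚ.m^n>0 2 (2 ℕ.+ r)) (ℕₚ.≤-reflexive (sym (ℕₚ.+-identityʳ d)))))
    (λ a _ d∣a-1 → at a (Signed.∣ᵤ⇒∣ d∣a-1))
    where
    d : ℕ
    d = 2 ℕ.^ (2 ℕ.+ r)
    at : ∀ a → + d Signed.∣ (a ℤ.- + 1) → χ a ≡ oneK
    at a (Signed.divides q e) = trans (cong χ (begin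
      a ≡⟨ ℤₚ.+-identityʳ a ⟨
      a ℤ.+ + 0 ≡⟨ ℤₚ.+-assoc a -[1+ 0 ] (+ 1) ⟨
      a ℤ.- + 1 ℤ.+ + 1 ≡⟨ cong (ℤ._+ + 1) e ⟩
      q ℤ.* + d ℤ.+ + 1 ≡⟨ ℤₚ.+-comm (q ℤ.* + d) (+ 1) ⟩
      + 1 ℤ.+ q ℤ.* + d ≡⟨ cong (λ x → + 1 ℤ.+ x) (ℤₚ.*-comm q (+ d)) ⟩
      + 1 ℤ.+ + d ℤ.* q               ∎)) (h q)
      where open ≡-Reasoning

  square-root-1 : ∀ {v} → v ⊛ v ≡ oneK → v ≡ oneK ⊎ v ≡ 𝕂.# -[1+ 0 ]
  square-root-1 {v} e = from (square-roots {v} {oneK} (trans e (sym (⊛-identityˡ oneK))))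
    where
    from : v ≡ oneK ⊎ v ≡ neg oneK → v ≡ oneK ⊎ v ≡ 𝕂.# -[1+ 0 ]
    from (inj₁ p) = inj₁ p
    from (inj₂ p) = inj₂ (trans p (sym (embed-neg 1ℚ)))

  character : 𝕂.PrimitiveCharacter
  character = record
    { r = r ; χ = χ ; χ-periodic = periodic ; χ-* = multiplicative ; χ-1 = at-one
    ; χ-even = even-zero ; χ-primitive = nontrivial-kernel ; ±1 = square-root-1
    ; root-Int = λ {v} e → proj₁ (unit-root {v} e)
    ; B = B ; L = Lneg B ; c = λ n j → embed (coefficient n j)
    ; c-factorial = coefficient-factorial ; B-generating = generating ; L-B = Lneg-B }

  open 𝕂.CharacterFacts character using (lvalues; X-root; parity-sign; χ[-1])
  open 𝕂.LCongruences lvalues using (s; 𝓛; 𝓛-difference; 𝓛-congruent; 𝓛-separated)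

  1/2^ : ℕ → ℚ
  1/2^ k = ℚ._/_ (+ 1) (2 ℕ.^ k) {{ℕₚ.m^n≢0 2 k}}

  2^-• : ∀ k z → 1/2^ k • (𝕂.2# 𝕂.^ k ⊛ z) ≡ z
  2^-• k z = trans (cong (λ x → h • (x ⊛ z)) (2#^-≡ k)) (trans (cong (h •_) (embed-• (ι (+ (2 ℕ.^ k))) z))
    (trans (sym (*-• h (ι (+ (2 ℕ.^ k))) z)) (trans (cong (_• z) (/-*-ι (+ 1) (2 ℕ.^ k) {{ℕₚ.m^n≢0 2 k}})) (1-• z))))
    where
    h : ℚ
    h = 1/2^ k

  •-2^ : ∀ k z → 𝕂.2# 𝕂.^ k ⊛ (1/2^ k • z) ≡ z
  •-2^ k z = trans (cong (_⊛ (h • z)) (2#^-≡ k)) (trans (embed-• (ι (+ (2 ℕ.^ k))) (h • z))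
    (trans (sym (*-• (ι (+ (2 ℕ.^ k))) h z)) (trans (cong (_• z) (trans (ℚₚ.*-comm (ι (+ (2 ℕ.^ k))) h) (/-*-ι (+ 1) (2 ℕ.^ k) {{ℕₚ.m^n≢0 2 k}}))) (1-• z))))
    where
    h : ℚ
    h = 1/2^ k

  ∣⇒CongMod2^ : ∀ k {x y} → 𝕂.2# 𝕂.^ k 𝕂.∣ x ⊖ y → CongMod2^ x y k
  ∣⇒CongMod2^ k {x} {y} (z , iz , e) = Integral⇒TwoIntegral (subst Integral (sym (trans (cong (1/2^ k •_) e) (2^-• k z))) iz)

  CongMod2^⇒∣ : ∀ k {x y} → CongMod2^ x y k → 𝕂.2# 𝕂.^ k 𝕂.∣ x ⊖ y
  CongMod2^⇒∣ k {x} {y} h = _ , TwoIntegral⇒Integral h , sym (•-2^ k (x ⊖ y))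

  calL-𝓛 : ∀ k → calL χ B k ≡ 𝓛 k
  calL-𝓛 k = cong (_⊛ Lneg B k) (⊖-≡ oneK (χ (+ 5)))

  signQ-power : ∀ k → embed (signQ k) ≡ 𝕂.# -[1+ 0 ] 𝕂.^ k
  signQ-power zero    = refl
  signQ-power (suc k) = trans (trans (embed-neg (signQ k)) (sym (embed-• (ℚ.- 1ℚ) (embed (signQ k)))))
    (cong (embed (ℚ.- 1ℚ) ⊛_) (signQ-power k))

  sign : ∀ k → OppParity χ k → s k ≡ oneK
  sign k h = parity-sign k (λ e → h (trans e (sym (signQ-power k))))

  conj-inverse : χ (+ 5) ⊛ conj (χ (+ 5)) ≡ oneK
  -- The index 2 stands for the odd number 2 · 2 + 1 = 5.
  conj-inverse = proj₂ (unit-root {χ (+ 5)} (X-root 2))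

  calL-difference : ∀ q n k → ¬ (2 ∣ℕ q) → 1 ≤ n → OppParity χ k → ∀ y →
    (oneK ⊖ conj (χ (+ 5))) ⊛ y ≡ frac (2 ℕ.^ (n ℕ.+ 2)) 1 • calL χ B (k % 2) →
    CongMod2^ (calL χ B (k ℕ.+ 2 ℕ.^ n ℕ.* q) ⊖ calL χ B k) y (n ℕ.+ 3)
  calL-difference q (suc n) k q-odd _ opp y e = ∣⇒CongMod2^ (suc n ℕ.+ 3)
    (subst₂ (λ j x → 𝕂.2# 𝕂.^ j 𝕂.∣ x) (ℕₚ.+-comm 3 (suc n)) (sym difference)
      (𝓛-difference n q k conj-inverse q-odd (sign k opp) equation))
    where
    open ≡-Reasoning
    difference : (calL χ B (k ℕ.+ 2 ℕ.^ suc n ℕ.* q) ⊖ calL χ B k) ⊖ y ≡ 𝓛 (k ℕ.+ 2 ℕ.^ suc n ℕ.* q) 𝕂.- 𝓛 k 𝕂.- y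
    difference = trans (⊖-≡ _ y) (cong (𝕂._- y) (trans (⊖-≡ _ _) (cong₂ 𝕂._-_ (calL-𝓛 (k ℕ.+ 2 ℕ.^ suc n ℕ.* q)) (calL-𝓛 k))))
    equation : (oneK 𝕂.- conj (χ (+ 5))) ⊛ y ≡ 𝕂.2# 𝕂.^ (3 ℕ.+ n) ⊛ 𝓛 (k % 2)
    equation = begin
      (oneK 𝕂.- conj (χ (+ 5))) ⊛ y ≡⟨ cong (_⊛ y) (⊖-≡ oneK (conj (χ (+ 5)))) ⟨
      (oneK ⊖ conj (χ (+ 5))) ⊛ y ≡⟨ e ⟩
      ι (+ (2 ℕ.^ (suc n ℕ.+ 2))) • calL χ B (k % 2)      ≡⟨ embed-• (ι (+ (2 ℕ.^ (suc n ℕ.+ 2)))) (calL χ B (k % 2)) ⟨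
      𝕂.# (+ (2 ℕ.^ (suc n ℕ.+ 2))) ⊛ calL χ B (k % 2)    ≡⟨ cong₂ _⊛_ (sym (2#^-≡ (suc n ℕ.+ 2))) (calL-𝓛 (k % 2)) ⟩
      𝕂.2# 𝕂.^ (suc n ℕ.+ 2) ⊛ 𝓛 (k % 2) ≡⟨ cong (λ j → 𝕂.2# 𝕂.^ j ⊛ 𝓛 (k % 2)) (ℕₚ.+-comm (suc n) 2) ⟩
      𝕂.2# 𝕂.^ (3 ℕ.+ n) ⊛ 𝓛 (k % 2)                      ∎

  calL-congruent : ∀ n d l → 1 ≤ n → OppParity χ l → 2 ℕ.^ n ∣ℕ d → CongMod2^ (calL χ B (d ℕ.+ l)) (calL χ B l) (n ℕ.+ 2)
  calL-congruent (suc n) d l _ opp h = ∣⇒CongMod2^ (suc n ℕ.+ 2)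
    (subst₂ (λ j x → 𝕂.2# 𝕂.^ j 𝕂.∣ x) (ℕₚ.+-comm 2 (suc n)) (sym (trans (⊖-≡ _ _) (cong₂ 𝕂._-_ (calL-𝓛 (d ℕ.+ l)) (calL-𝓛 l))))
      (𝓛-congruent n d l (sign l opp) h))

  calL-separated : ∀ n d l → 1 ≤ n → OppParity χ (d ℕ.+ l) → OppParity χ l →
    CongMod2^ (calL χ B (d ℕ.+ l)) (calL χ B l) (n ℕ.+ 2) → 2 ℕ.^ n ∣ℕ d
  calL-separated (suc n) d l _ opp-d opp h = 𝓛-separated 2∤1ᴷ n d l (sign l opp) (sign (d ℕ.+ l) opp-d)
    (subst₂ (λ j x → 𝕂.2# 𝕂.^ j 𝕂.∣ x) (ℕₚ.+-comm (suc n) 2) (trans (⊖-≡ _ _) (cong₂ 𝕂._-_ (calL-𝓛 (d ℕ.+ l)) (calL-𝓛 l)))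
      (CongMod2^⇒∣ (suc n ℕ.+ 2) h))

  CongMod2^-sym : ∀ k {x y : K M} → CongMod2^ x y k → CongMod2^ y x k
  CongMod2^-sym k {x} {y} h = ∣⇒CongMod2^ k (subst (𝕂.2# 𝕂.^ k 𝕂.∣_) flip (neg-∣ (CongMod2^⇒∣ k h)))
    where
    neg-∣ : ∀ {z} → 𝕂.2# 𝕂.^ k 𝕂.∣ z → 𝕂.2# 𝕂.^ k 𝕂.∣ neg z
    neg-∣ {z} = 𝕂.∣-neg {𝕂.2# 𝕂.^ k} {z}
    flip : neg (x ⊖ y) ≡ y ⊖ x
    flip = coord-ext (λ i _ → trans (coord-neg (x ⊖ y) i) (trans (cong ℚ.-_ (coord-⊖ x y i))
      (trans (𝕢.solve 2 (λ a b → 𝕢.:- (a 𝕢.:- b) 𝕢.:= b 𝕢.:- a) refl (coord x i) (coord y i)) (sym (coord-⊖ y x i)))))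

  abs-difference : ∀ d l → ℤ.∣ + (d ℕ.+ l) ℤ.- + l ∣ ≡ d
  abs-difference d l = trans (cong ℤ.∣_∣ (trans (ℤₚ.m-n≡m⊖n (d ℕ.+ l) l) (ℤₚ.⊖-≥ (ℕₚ.m≤n+m l d)))) (ℕₚ.m+n∸n≡m d l)

  -- Both sides are symmetric in k and l, so the larger exponent may be written as the smaller one
  -- plus d.
  calL-⇔ : ∀ n k l → 1 ≤ n → OppParity χ k → OppParity χ l →
    CongMod2^ (calL χ B k) (calL χ B l) (n ℕ.+ 2) ⇔ ((+ (2 ℕ.^ n)) ∣ℤ (+ k ℤ.- + l))
  calL-⇔ n k l 1≤n opp-k opp-l = by-order (ℕₚ.≤-total l k)
    where
    offset : ∀ {k l} → l ≤ k → k ≡ k ∸ l ℕ.+ l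
    offset l≤k = sym (ℕₚ.m∸n+n≡m l≤k)
    above : ∀ d l → OppParity χ (d ℕ.+ l) → OppParity χ l →
      CongMod2^ (calL χ B (d ℕ.+ l)) (calL χ B l) (n ℕ.+ 2) ⇔ ((+ (2 ℕ.^ n)) ∣ℤ (+ (d ℕ.+ l) ℤ.- + l))
    above d l opp-d opp = mk⇔
      (λ h → subst (2 ℕ.^ n ∣ℕ_) (sym (abs-difference d l)) (calL-separated n d l 1≤n opp-d opp h))
      (λ h → calL-congruent n d l 1≤n opp (subst (2 ℕ.^ n ∣ℕ_) (abs-difference d l) h))
    by-order : l ≤ k ⊎ k ≤ l → CongMod2^ (calL χ B k) (calL χ B l) (n ℕ.+ 2) ⇔ ((+ (2 ℕ.^ n)) ∣ℤ (+ k ℤ.- + l))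
    by-order (inj₁ l≤k) = subst (λ k → CongMod2^ (calL χ B k) (calL χ B l) (n ℕ.+ 2) ⇔ ((+ (2 ℕ.^ n)) ∣ℤ (+ k ℤ.- + l))) (sym (offset l≤k))
      (above (k ∸ l) l (subst (OppParity χ) (offset l≤k) opp-k) opp-l)
    by-order (inj₂ k≤l) = mk⇔
      (λ h → subst (2 ℕ.^ n ∣ℕ_) (ℤₚ.∣i-j∣≡∣j-i∣ (+ l) (+ k)) (Equivalence.to flipped (CongMod2^-sym (n ℕ.+ 2) h)))
      (λ h → CongMod2^-sym (n ℕ.+ 2) (Equivalence.from flipped (subst (2 ℕ.^ n ∣ℕ_) (ℤₚ.∣i-j∣≡∣j-i∣ (+ k) (+ l)) h)))
      where
      flipped : CongMod2^ (calL χ B l) (calL χ B k) (n ℕ.+ 2) ⇔ ((+ (2 ℕ.^ n)) ∣ℤ (+ l ℤ.- + k))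
      flipped = subst (λ l → CongMod2^ (calL χ B l) (calL χ B k) (n ℕ.+ 2) ⇔ ((+ (2 ℕ.^ n)) ∣ℤ (+ l ℤ.- + k))) (sym (offset k≤l))
        (above (l ∸ k) k (subst (OppParity χ) (offset k≤l) opp-l) opp-k)

open import Data.Nat.Base using (_+_; _*_; _^_)

theorem1p1 : (m : ℕ) → 3 ≤ m →
  (χ : ℤ → K (Mdeg m)) → IsDirichletChar (2 ^ m) χ → IsPrimitive (2 ^ m) χ →
  (B : ℕ → K (Mdeg m)) → IsGenBernoulli (2 ^ m) χ B →
  ((q n k : ℕ) → ¬ (2 ∣ℕ q) → 1 ≤ n → OppParity χ k →
    (y : K (Mdeg m)) →
    (oneK ⊖ conj (χ (+ 5))) ⊛ y ≡ frac (2 ^ (n + 2)) 1 • calL χ B (k % 2) →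
    CongMod2^ (calL χ B (k + 2 ^ n * q) ⊖ calL χ B k) y (n + 3))
  ×
  ((n k l : ℕ) → 1 ≤ n → OppParity χ k → OppParity χ l →
    (CongMod2^ (calL χ B k) (calL χ B l) (n + 2) ⇔ ((+ (2 ^ n)) ∣ℤ (+ k ℤ.- + l))))
theorem1p1 (suc (suc (suc r))) _ χ isχ isPrimitive B isB =
  (λ q n k q-odd 1≤n opp y e → calL-difference q n k q-odd 1≤n opp y e) , calL-⇔
  where open Main r χ isχ isPrimitive B isB using (calL-difference; calL-⇔)
theorem1p1 1 (s≤s ())
theorem1p1 2 (s≤s (s≤s ()))
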